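{- For every modular ortholattice $L$ of dimension (height) $2$, both decision problems $\mathrm{SAT}_L$ and $\mathrm{sat}_L$ are $\mathcal{NP}$-complete.
   Context: An ortholattice is a lattice $L$ with least element $0$ and greatest element $1$ and an order-reversing involution $\neg$ satisfying $a\wedge\neg a=0$ and $a\vee\neg a=1$. It is modular (a modular ortholattice, MOL) if $a\ge c$ implies $a\wedge(b\vee c)=(a\wedge b)\vee c$. The dimension (height) of $L$ is the cardinality of a maximal chain minus one. An ortholattice term is a syntactically correct expression built from variables $x_1,x_2,\ldots$ with the operations $\wedge,\vee,\neg$ and the constants $0,1$; $t_L(\bar a)$ denotes the value of $t$ in $L$ under an assignment $\bar a\in L^n$. Terms are encoded as binary strings $\langle t\rangle$ in a standard way. Then $\mathrm{SAT}_L=\{\langle t(x_1,\ldots,x_n)\rangle : n\in\mathbb N,\ \exists \bar a\in L^n:\ t_L(\bar a)=1\}$ (strong satisfiability) and $\mathrm{sat}_L=\{\langle t(x_1,\ldots,x_n)\rangle : n\in\mathbb N,\ \exists \bar a\in L^n:\ t_L(\bar a)\ne 0\}$ (weak satisfiability). $\mathcal{NP}$-completeness is with respect to polynomial-time many-one reductions by Turing machines. -}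

module Defs where

open import Data.Bool using (Bool; true; false; T)
open import Data.Fin as Fin using (Fin; toℕ)
open import Data.List as List using (List; []; _∷_; _++_; length)
open import Data.List.Membership.Propositional using (_∈_)
open import Data.Nat using (ℕ; zero; suc; _+_; _*_; _≤_)
open import Data.Nat.Binary as Binary using (ℕᵇ; 2[1+_]; 1+[2_])
open import Data.Product using (Σ; ∃; ∃-syntax; _×_; _,_)
open import Data.Sum using (_⊎_)
open import Data.Vec as Vec using (Vec; _∷_)
open import Function.Bundles using (_⇔_)
open import Level as Level using (Level; 0ℓ; _⊔_)
open import Relation.Binary.Core using (Rel)
open import Relation.Binary.Lattice.Bundles using (BoundedLattice)
import Relation.Binary.Construct.NonStrictToStrict as ToStrict
open import Relation.Binary.PropositionalEquality using (_≡_)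
open import Relation.Nullary using (¬_)
open import Relation.Unary using (Pred)

------------------------------------------------------------------------
-- Modular ortholattices

record Ortholattice (c ℓ₁ ℓ₂ : Level) : Set (Level.suc (c ⊔ ℓ₁ ⊔ ℓ₂)) where
  field
    boundedLattice : BoundedLattice c ℓ₁ ℓ₂

  open BoundedLattice boundedLattice public
    renaming (_≤_ to _⊑_; ⊥ to 0#; ⊤ to 1#)

  infix 9 ∼_
  field
    ∼_           : Carrier → Carrier
    ∼-antitone   : ∀ {x y} → x ⊑ y → ∼ y ⊑ ∼ x
    ∼-involutive : ∀ x → ∼ ∼ x ≈ x
    ∧-complement : ∀ x → x ∧ ∼ x ≈ 0#
    ∨-complement : ∀ x → x ∨ ∼ x ≈ 1#

  open ToStrict _≈_ _⊑_ public using () renaming (_<_ to _⊏_)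

module _ {c ℓ₁ ℓ₂ : Level} (L : Ortholattice c ℓ₁ ℓ₂) where
  open Ortholattice L

  Modular : Set (c ⊔ ℓ₁ ⊔ ℓ₂)
  Modular = ∀ x y z → z ⊑ x → x ∧ (y ∨ z) ≈ (x ∧ y) ∨ z

  -- A finite chain is given by its strictly increasing enumeration.
  IsChain : ∀ {m} → (Fin m → Carrier) → Set (ℓ₁ ⊔ ℓ₂)
  IsChain γ = ∀ {i j} → i Fin.< j → γ i ⊏ γ j

  IsMaximalChain : ∀ {m} → (Fin m → Carrier) → Set (c ⊔ ℓ₁ ⊔ ℓ₂)
  IsMaximalChain γ =
    IsChain γ × (∀ x → (∀ i → x ⊑ γ i ⊎ γ i ⊑ x) → ∃[ i ] x ≈ γ i)

  HasHeight : ℕ → Set (c ⊔ ℓ₁ ⊔ ℓ₂)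
  HasHeight n = ∃[ γ ] IsMaximalChain {suc n} γ

------------------------------------------------------------------------
-- Terms and their binary encoding

data Term (n : ℕ) : Set where
  var       : Fin n → Term n
  zero one  : Term n
  not       : Term n → Term n
  and or    : Term n → Term n → Term n

Word : Set
Word = List Bool

-- ℕᵇ is bijective base 2, least significant digit first.  Writing the digits
-- 1, 2 as false, true yields the usual binary expansion of i + 1 without its
-- leading one.  Each digit is preceded by true; false ends the numeral.
digits : ℕᵇ → Word
digits Binary.zero = false ∷ []
digits 2[1+ b ]    = true ∷ true  ∷ digits b
digits 1+[2 b ]    = true ∷ false ∷ digits b

-- Postfix notation with three-bit symbols, which needs no parentheses and is
-- uniquely decodable.  The word does not depend on n, only on the expression.
⟨_⟩ : ∀ {n} → Term n → Word
⟨ zero ⟩    = false ∷ false ∷ false ∷ []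
⟨ one ⟩     = false ∷ false ∷ true  ∷ []
⟨ not t ⟩   = ⟨ t ⟩ ++ false ∷ true ∷ false ∷ []
⟨ and s t ⟩ = ⟨ s ⟩ ++ ⟨ t ⟩ ++ false ∷ true ∷ true ∷ []
⟨ or s t ⟩  = ⟨ s ⟩ ++ ⟨ t ⟩ ++ true ∷ false ∷ false ∷ []
⟨ var i ⟩   = true ∷ false ∷ true ∷ digits (Binary.fromℕ (toℕ i))

Language : (ℓ : Level) → Set (Level.suc ℓ)
Language ℓ = Pred Word ℓ

module _ {c ℓ₁ ℓ₂ : Level} (L : Ortholattice c ℓ₁ ℓ₂) where
  open Ortholattice L

  eval : ∀ {n} → Term n → (Fin n → Carrier) → Carrier
  eval (var i)   a = a i
  eval zero      a = 0#
  eval one       a = 1#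
  eval (not t)   a = ∼ eval t a
  eval (and s t) a = eval s a ∧ eval t a
  eval (or s t)  a = eval s a ∨ eval t a

  StrongSAT : Language (c ⊔ ℓ₁)
  StrongSAT w =
    ∃[ n ] Σ (Term n) λ t → w ≡ ⟨ t ⟩ × (∃[ a ] eval t a ≈ 1#)

  WeakSAT : Language (c ⊔ ℓ₁)
  WeakSAT w =
    ∃[ n ] Σ (Term n) λ t → w ≡ ⟨ t ⟩ × (∃[ a ] ¬ (eval t a ≈ 0#))

------------------------------------------------------------------------
-- Turing machines

data Symbol (g : ℕ) : Set where
  blank : Symbol g
  bit   : Bool → Symbol g
  aux   : Fin g → Symbol g

data Move : Set where
  left stay right : Move

-- A two-way infinite tape; `before` lists the cells to the left of the head,
-- nearest first.  Cells beyond either list are blank.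
record Tape (g : ℕ) : Set where
  constructor tape
  field
    before : List (Symbol g)
    head   : Symbol g
    after  : List (Symbol g)

module _ {g : ℕ} where

  emptyTape : Tape g
  emptyTape = tape [] blank []

  inputTape : Word → Tape g
  inputTape []      = emptyTape
  inputTape (b ∷ w) = tape [] (bit b) (List.map bit w)

  move : Move → Tape g → Tape g
  move left  (tape []       s rs)       = tape [] blank (s ∷ rs)
  move left  (tape (l ∷ ls) s rs)       = tape ls l (s ∷ rs)
  move stay  t                          = t
  move right (tape ls       s [])       = tape (s ∷ ls) blank []
  move right (tape ls       s (r ∷ rs)) = tape (s ∷ ls) r rs

  act : Symbol g × Move → Tape g → Tape g
  act (s , m) (tape ls _ rs) = move m (tape ls s rs)

  leadingBits : List (Symbol g) → Word
  leadingBits (bit b ∷ ss) = b ∷ leadingBits ss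
  leadingBits _            = []

  -- The word starting at the head and ending before the first non-bit.
  outputWord : Tape g → Word
  outputWord (tape _ s rs) = leadingBits (s ∷ rs)

-- Nondeterministic multitape machines: δ lists the available transitions, and
-- the machine halts when there are none.  Machines used only to compute
-- functions ignore `accept`.
record TM : Set where
  field
    extraTapes auxSymbols states : ℕ

  tapes : ℕ
  tapes = suc extraTapes

  State : Set
  State = Fin states

  Sym : Set
  Sym = Symbol auxSymbols

  field
    start  : State
    accept : State → Bool
    δ      : State → Vec Sym tapes → List (State × Vec (Sym × Move) tapes)

module _ (M : TM) where
  open TM M

  Config : Set
  Config = State × Vec (Tape auxSymbols) tapes

  options : Config → List (State × Vec (Sym × Move) tapes)
  options (q , ts) = δ q (Vec.map Tape.head ts)

  initial : Word → Config
  initial w = start , inputTape w ∷ Vec.replicate extraTapes emptyTape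

  -- Run k c c′: some computation leads from c to c′ in exactly k steps.
  data Run : ℕ → Rel Config 0ℓ where
    done : ∀ {c} → Run zero c c
    step : ∀ {k q ts q′ as c} → (q′ , as) ∈ options (q , ts) →
           Run k (q′ , Vec.zipWith act as ts) c → Run (suc k) (q , ts) c

  Halted : Config → Set
  Halted c = options c ≡ []

  Accepting : Config → Set
  Accepting (q , _) = T (accept q)

  AcceptsIn : ℕ → Word → Set
  AcceptsIn k w = ∃[ c ] Run k (initial w) c × Accepting c

  -- The input is on the first tape and the output on the last.
  output : Config → Word
  output (_ , ts) = outputWord (Vec.last ts)

  Deterministic : Set
  Deterministic = ∀ q ss → length (δ q ss) ≤ 1

------------------------------------------------------------------------
-- Polynomial time, NP, completeness

data Polynomial : Set where
  X       : Polynomial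
  const   : ℕ → Polynomial
  _⊕_ _⊗_ : Polynomial → Polynomial → Polynomial

⟦_⟧ : Polynomial → ℕ → ℕ
⟦ X ⟧       n = n
⟦ const k ⟧ n = k
⟦ p ⊕ q ⟧   n = ⟦ p ⟧ n + ⟦ q ⟧ n
⟦ p ⊗ q ⟧   n = ⟦ p ⟧ n * ⟦ q ⟧ n

PolyTimeComputable : (Word → Word) → Set
PolyTimeComputable f =
  Σ TM λ M → Deterministic M × Σ Polynomial λ p → ∀ w →
    ∃[ k ] k ≤ ⟦ p ⟧ (length w) ×
    (∃[ c ] Run M k (initial M w) c × Halted M c × output M c ≡ f w)

-- As usual for nondeterministic time, the bound is on a shortest accepting
-- computation for each accepted word.
NP : ∀ {ℓ} → Language ℓ → Set ℓ
NP A =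
  Σ TM λ M → Σ Polynomial λ p → ∀ w →
    (A w ⇔ (∃[ k ] AcceptsIn M k w)) ×
    (A w → ∃[ k ] k ≤ ⟦ p ⟧ (length w) × AcceptsIn M k w)

_≤ₚ_ : ∀ {a b} → Language a → Language b → Set (a ⊔ b)
A ≤ₚ B = Σ (Word → Word) λ f → PolyTimeComputable f × (∀ w → A w ⇔ B (f w))

-- Every language in NP is equivalent to the acceptance predicate of a machine,
-- which can be lifted to any level, so fixing the level of A loses nothing.
NPHard : ∀ {ℓ} → Language ℓ → Set (Level.suc ℓ)
NPHard {ℓ} B = ∀ (A : Language ℓ) → NP A → A ≤ₚ B

NPComplete : ∀ {ℓ} → Language ℓ → Set (Level.suc ℓ)
NPComplete B = NP B × NPHard B

-- A modular ortholattice of height 2 consists of 0, 1 and atoms, and two distinct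
-- atoms meet in 0 and join to 1.  So terms can be evaluated on finite codes of
-- elements, and the codes of the values of the variables are a certificate of
-- polynomial size; the codes depend only on whether the number of pairs {x , ¬x}
-- of atoms is finite, and on that number.
--
-- For hardness, the tableau of a nondeterministic machine is written as a
-- conjunction of Shannon expansions (x ∧ A) ∨ (¬x ∧ B).  The atoms can be given
-- truth values that respect complements in such a way that a nonzero value
-- becomes true; this is no homomorphism, but the two joinands of an expansion
-- commute, and so the truth values of the variables satisfy the tableau.
-- Conversely {0 , 1} is a subalgebra.  Hence the same reduction works for the
-- strong and for the weak problem.
--
-- Both machines come from programs all of whose loops are bounded by the length
-- of the input, so that polynomial time bounds are read off the syntax.
module Submission where

open import Defs
open import Axiom.ExcludedMiddle using (ExcludedMiddle)
open import Data.Bool using (Bool; true; false; T; if_then_else_; _∧_; _∨_) renaming (not to ¬ᵇ_)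
open import Data.Bool.Properties using (∨-identityʳ; ∧-assoc; ∧-identityʳ)
open import Data.Empty using (⊥-elim)
open import Data.Fin as Fin using (Fin; zero; suc; toℕ; _↑ʳ_)
open import Data.Fin.Patterns
open import Data.Fin.Properties as FinP using (+↔⊎; *↔×; 1↔⊤; 2↔Bool)
open import Data.List as List using (List; []; _∷_; _++_; length; replicate; _ʳ++_)
open import Data.List.Membership.DecPropositional using (_∈?_)
open import Data.List.Membership.Propositional using (_∈_)
open import Data.List.Membership.Propositional.Properties using (∈-map⁺; ∈-map⁻; ∈-++⁺ˡ; ∈-++⁺ʳ; ∈-++⁻)
open import Data.List.Properties using (length-map; length-replicate; length-reverse; length-++; ++-assoc; ++-identityʳ; ++-ʳ++; ʳ++-ʳ++; ∷-injective; drop-all; reverse-involutive)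
open import Data.List.Relation.Unary.All as All using (All; []; _∷_)
import Data.List.Relation.Unary.All.Properties as AllP
open import Data.List.Relation.Unary.Any using (here; there)
open import Data.Maybe as Maybe using (Maybe; just; nothing; maybe′)
open import Data.Maybe.Properties using (just-injective)
open import Data.Nat using (ℕ; zero; suc; _+_; _*_; _∸_; _≤_; _<_; z≤n; s≤s; s≤s⁻¹) renaming (_⊔_ to _⊔ₙ_)
open import Data.Nat.Binary as Binary using (ℕᵇ; 2[1+_]; 1+[2_])
import Data.Nat.Binary.Properties as BinaryP
open import Data.Nat.Properties hiding (⊓-comm; ⊓-zeroˡ)
open import Data.Product as Product using (Σ; ∃-syntax; _×_; _,_; proj₁; proj₂)
open import Data.Product.Function.NonDependent.Propositional using (_×-↔_)
open import Data.Sum using (_⊎_; inj₁; inj₂)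
open import Data.Sum.Function.Propositional using (_⊎-↔_)
open import Data.Unit using (⊤; tt)
open import Data.Vec as Vec using (Vec; []; _∷_; lookup; updateAt; _[_]≔_; _∷ʳ_)
open import Data.Vec.Properties using (init-∷ʳ; last-∷ʳ; map-∷ʳ; lookup∘updateAt; lookup∘updateAt′; updateAt-updateAt-local; updateAt-commutes; tabulate-∘; tabulate-cong; lookup-map; lookup-zipWith)
open import Function using (_∘_; id; case_of_)
open import Function.Bundles using (_⇔_; _↔_; mk⇔; mk↔ₛ′; Inverse; Equivalence)
open import Function.Properties.Inverse using (↔-trans; ↔-sym; ↔-refl; ↔⇒↣)
open import Level as Level using (_⊔_)
open import Relation.Binary.Definitions using (DecidableEquality)
open import Relation.Binary.PropositionalEquality hiding (setoid)
open import Relation.Nullary using (¬_; Dec; yes; no)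
open import Relation.Nullary.Decidable using (⌊_⌋; _×-dec_; _⊎-dec_)

-- Loop programs

-- The lattice is abstract, so a machine cannot compute in it. Only the width of the codes of atoms
-- depends on `L`, and excluded middle supplies it. Codes have to be plentiful enough for all values
-- of the variables, and yet different codes must denote different elements, since the verifier
-- compares words instead of elements.
--
-- Hardness cannot go through clauses: two atoms from different pairs join to 1, so a clause can
-- have value 1 although the chosen truth assignment makes all its literals false. Shannon
-- expansions avoid this, and nested ones form decision trees. The tree over all bits of the four
-- tiles of a window is exponential in the number of these bits, but that number depends on the
-- machine alone and not on its input.
--
-- Programs are verified as functions on stacks. A single simulation theorem turns them into
-- multitape machines, with one counter tape for each level of loop nesting.

infixr 5 _⨾_

-- An empty stack pops `nothing`; `loop` repeats its body n times, n being the
-- length of the input.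
data Prog (k : ℕ) : Set where
  skip : Prog k
  push : Fin k → Bool → Prog k
  pop  : Fin k → (Maybe Bool → Prog k) → Prog k
  _⨾_  : Prog k → Prog k → Prog k
  loop : Prog k → Prog k

Stacks : ℕ → Set
Stacks k = Vec Word k

iter : ∀ {A : Set} → ℕ → (A → A) → A → A
iter zero    f x = x
iter (suc n) f x = iter n f (f x)

run : ∀ {k} → Prog k → ℕ → Stacks k → Stacks k
run skip       n σ = σ
run (push i b) n σ = updateAt σ i (b ∷_)
run (pop i P)  n σ = run (P (List.head (lookup σ i))) n (updateAt σ i (List.drop 1))
run (P ⨾ Q)    n σ = run Q n (run P n σ)
run (loop P)   n σ = iter n (run P n) σ

depth : ∀ {k} → Prog k → ℕ
depth skip       = 0
depth (push _ _) = 0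
depth (pop _ P)  = depth (P nothing) ⊔ₙ (depth (P (just false)) ⊔ₙ depth (P (just true)))
depth (P ⨾ Q)    = depth P ⊔ₙ depth Q
depth (loop P)   = suc (depth P)

-- Serves twice: it bounds the steps of the compiled machine and the growth of each stack. Branches
-- are added since polynomials offer no maximum. A loop pays two steps per round on its counter
-- tape, and `X ⊕ const 3` for turning at the marker and going back.
cost : ∀ {k} → Prog k → Polynomial
cost skip       = const 1
cost (push _ _) = const 1
cost (pop _ P)  = const 2 ⊕ (cost (P nothing) ⊕ (cost (P (just false)) ⊕ cost (P (just true))))
cost (P ⨾ Q)    = cost P ⊕ cost Q
cost (loop P)   = (X ⊗ (const 2 ⊕ cost P)) ⊕ (X ⊕ const 3)

maybe-bool-elim : ∀ {ℓ} (P : Maybe Bool → Set ℓ) →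
  P nothing → P (just false) → P (just true) → ∀ x → P x
maybe-bool-elim P a b c nothing      = a
maybe-bool-elim P a b c (just false) = b
maybe-bool-elim P a b c (just true)  = c

depth-branch : ∀ {k} i (P : Maybe Bool → Prog k) x → depth (P x) ≤ depth (pop i P)
depth-branch i P = maybe-bool-elim _
  (m≤m⊔n _ _)
  (≤-trans (m≤m⊔n _ _) (m≤n⊔m (depth (P nothing)) _))
  (≤-trans (m≤n⊔m (depth (P (just false))) _) (m≤n⊔m (depth (P nothing)) _))

cost-branch : ∀ {k} i (P : Maybe Bool → Prog k) n x → 2 + ⟦ cost (P x) ⟧ n ≤ ⟦ cost (pop i P) ⟧ n
cost-branch i P n x = +-monoʳ-≤ 2 (maybe-bool-elim (λ x → ⟦ cost (P x) ⟧ n ≤ ⟦ cs ⟧ n)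
  (m≤m+n _ _)
  (≤-trans (m≤m+n _ _) (m≤n+m _ (⟦ cost (P nothing) ⟧ n)))
  (≤-trans (m≤n+m _ (⟦ cost (P (just false)) ⟧ n)) (m≤n+m _ (⟦ cost (P nothing) ⟧ n))) x)
  where cs = cost (P nothing) ⊕ (cost (P (just false)) ⊕ cost (P (just true)))

length-updateAt : ∀ {k} (σ : Stacks k) i j f c → (∀ w → length (f w) ≤ c + length w) →
  length (lookup (updateAt σ i f) j) ≤ c + length (lookup σ j)
length-updateAt (w ∷ σ) zero    zero    f c h = h w
length-updateAt (w ∷ σ) zero    (suc j) f c h = m≤n+m _ c
length-updateAt (w ∷ σ) (suc i) zero    f c h = m≤n+m _ c
length-updateAt (w ∷ σ) (suc i) (suc j) f c h = length-updateAt σ i j f c h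

-- The output of a function machine is unloaded bit by bit, so its running time depends on the
-- length of a stack and not only on the steps of the program.
length-run : ∀ {k} (P : Prog k) n σ j →
  length (lookup (run P n σ) j) ≤ ⟦ cost P ⟧ n + length (lookup σ j)
length-run skip       n σ j = n≤1+n _
length-run (push i b) n σ j = length-updateAt σ i j (b ∷_) 1 (λ _ → ≤-refl)
length-run (pop i P)  n σ j = begin
  length (lookup (run (P x) n σ′) j)         ≤⟨ length-run (P x) n σ′ j ⟩
  ⟦ cost (P x) ⟧ n + length (lookup σ′ j)    ≤⟨ +-monoʳ-≤ (⟦ cost (P x) ⟧ n)
                                                  (length-updateAt σ i j (List.drop 1) 0 shrink) ⟩
  ⟦ cost (P x) ⟧ n + length (lookup σ j)     ≤⟨ +-monoˡ-≤ _ (≤-trans (m≤n+m _ 2) (cost-branch i P n x)) ⟩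
  ⟦ cost (pop i P) ⟧ n + length (lookup σ j) ∎
  where
  open ≤-Reasoning
  x  = List.head (lookup σ i)
  σ′ = updateAt σ i (List.drop 1)
  shrink : ∀ (w : Word) → length (List.drop 1 w) ≤ length w
  shrink []      = z≤n
  shrink (_ ∷ w) = n≤1+n _
length-run (P ⨾ Q)    n σ j = begin
  length (lookup (run Q n (run P n σ)) j)                     ≤⟨ length-run Q n (run P n σ) j ⟩
  ⟦ cost Q ⟧ n + length (lookup (run P n σ) j)                ≤⟨ +-monoʳ-≤ (⟦ cost Q ⟧ n) (length-run P n σ j) ⟩
  ⟦ cost Q ⟧ n + (⟦ cost P ⟧ n + length (lookup σ j))         ≡⟨ +-assoc (⟦ cost Q ⟧ n) _ _ ⟨
  ⟦ cost Q ⟧ n + ⟦ cost P ⟧ n + length (lookup σ j)           ≡⟨ cong (_+ length (lookup σ j)) (+-comm (⟦ cost Q ⟧ n) _) ⟩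
  ⟦ cost P ⟧ n + ⟦ cost Q ⟧ n + length (lookup σ j)           ∎
  where open ≤-Reasoning
length-run (loop P)   n σ j = begin
  length (lookup (iter n (run P n) σ) j)                      ≤⟨ go n σ ⟩
  n * (2 + ⟦ cost P ⟧ n) + length (lookup σ j)                ≤⟨ +-monoˡ-≤ _ (m≤m+n (n * (2 + ⟦ cost P ⟧ n)) (n + 3)) ⟩
  ⟦ cost (loop P) ⟧ n + length (lookup σ j)                   ∎
  where
  open ≤-Reasoning
  c = ⟦ cost P ⟧ n
  go : ∀ m σ → length (lookup (iter m (run P n) σ) j) ≤ m * (2 + c) + length (lookup σ j)
  go zero    σ = ≤-refl
  go (suc m) σ = begin
    length (lookup (iter m (run P n) (run P n σ)) j)     ≤⟨ go m (run P n σ) ⟩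
    m * (2 + c) + length (lookup (run P n σ) j)          ≤⟨ +-monoʳ-≤ (m * (2 + c)) (length-run P n σ j) ⟩
    m * (2 + c) + (c + length (lookup σ j))              ≡⟨ +-assoc (m * (2 + c)) c _ ⟨
    m * (2 + c) + c + length (lookup σ j)                ≤⟨ +-monoˡ-≤ _ (+-monoʳ-≤ (m * (2 + c)) (m≤n+m c 2)) ⟩
    m * (2 + c) + (2 + c) + length (lookup σ j)          ≡⟨ cong (_+ length (lookup σ j)) (+-comm (m * (2 + c)) (2 + c)) ⟩
    suc m * (2 + c) + length (lookup σ j)                ∎

iter-+ : ∀ {A : Set} m n (f : A → A) x → iter (m + n) f x ≡ iter n f (iter m f x)
iter-+ zero    n f x = refl
iter-+ (suc m) n f x = iter-+ m n f (f x)

iter-* : ∀ {A : Set} m n (f : A → A) x → iter (m * n) f x ≡ iter m (iter n f) x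
iter-* zero    n f x = refl
iter-* (suc m) n f x = trans (iter-+ n (m * n) f x) (iter-* m n f (iter n f x))

iter-cong : ∀ {A : Set} n {f g : A → A} → (∀ x → f x ≡ g x) → ∀ x → iter n f x ≡ iter n g x
iter-cong zero    h x = refl
iter-cong (suc n) {g = g} h x = trans (cong (iter n _) (h x)) (iter-cong n h (g x))

-- Sums become sequences and products become nestings, so the number of counter tapes depends on the
-- polynomial and not on the input.
loopP : ∀ {k} → Polynomial → Prog k → Prog k
loopP X               P = loop P
loopP (const zero)    P = skip
loopP (const (suc m)) P = P ⨾ loopP (const m) P
loopP (p ⊕ q)         P = loopP p P ⨾ loopP q P
loopP (p ⊗ q)         P = loopP p (loopP q P)

run-loopP : ∀ {k} p (P : Prog k) n σ → run (loopP p P) n σ ≡ iter (⟦ p ⟧ n) (run P n) σ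
run-loopP X               P n σ = refl
run-loopP (const zero)    P n σ = refl
run-loopP (const (suc m)) P n σ = run-loopP (const m) P n (run P n σ)
run-loopP (p ⊕ q)         P n σ = trans (run-loopP q P n _)
  (trans (cong (iter (⟦ q ⟧ n) (run P n)) (run-loopP p P n σ))
         (sym (iter-+ (⟦ p ⟧ n) (⟦ q ⟧ n) (run P n) σ)))
run-loopP (p ⊗ q)         P n σ = trans (run-loopP p (loopP q P) n σ)
  (trans (iter-cong (⟦ p ⟧ n) (run-loopP q P n) σ)
         (sym (iter-* (⟦ p ⟧ n) (⟦ q ⟧ n) (run P n) σ)))

-- Compilation of loop programs

Sy : Set
Sy = Symbol 0

Act : Set
Act = Sy × Move

-- `down` moves the head onto the top of the stack and thereby removes it, since a stack is what
-- lies to the left of the head. `look` can still read the removed bit and branches on it.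
data PopState (S : Maybe Bool → Set) : Set where
  down look : PopState S
  branch    : ∀ x → S x → PopState S

-- `back` steps left on the counter tape. `look` finds a tick, which starts a round, or the marker,
-- which ends the loop. `rewind` runs right to the blank behind the ticks. The position of the head
-- counts the rounds left, so the ticks themselves never change.
data LoopState (S : Set) : Set where
  back look rewind : LoopState S
  body             : S → LoopState S

States : ∀ {k} → Prog k → Set
States skip       = ⊤
States (push _ _) = ⊤
States (pop _ P)  = PopState (λ x → States (P x))
States (P ⨾ Q)    = States P ⊎ States Q
States (loop P)   = LoopState (States P)

entry : ∀ {k} (P : Prog k) → States P
entry skip       = tt
entry (push _ _) = tt
entry (pop _ _)  = down
entry (P ⨾ Q)    = inj₁ (entry P)
entry (loop P)   = back

keep : ∀ {g m} → Vec (Symbol g) m → Vec (Symbol g × Move) m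
keep = Vec.map (_, stay)

symbol : Sy → Maybe Bool
symbol (bit b) = just b
symbol _       = nothing

-- One transition, given the scanned symbols of d loop tapes followed by the k
-- stacks; the state `nothing` is the exit.
next : ∀ {k} (P : Prog k) {d} → States P → Vec Sy (d + k) → Maybe (States P) × Vec Act (d + k)
next skip           s hs = nothing , keep hs
next (push i b) {d} s hs = nothing , keep hs [ d ↑ʳ i ]≔ (bit b , right)
next (pop i P)  {d} down hs = just look , keep hs [ d ↑ʳ i ]≔ (lookup hs (d ↑ʳ i) , left)
next (pop i P)  {d} look hs = just (branch x (entry (P x))) , keep hs
  where x = symbol (lookup hs (d ↑ʳ i))
next (pop i P) (branch x s) hs = Product.map₁ (Maybe.map (branch x)) (next (P x) s hs)
next (P ⨾ Q) (inj₁ s) hs = Product.map₁ (just ∘ maybe′ inj₁ (inj₂ (entry Q))) (next P s hs)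
next (P ⨾ Q) (inj₂ s) hs = Product.map₁ (Maybe.map inj₂) (next Q s hs)
-- Without a counter tape there is nothing to count on; `exec` excludes this case by requiring
-- `depth P ≤ d`.
next (loop P) {zero}  s hs = nothing , keep hs
next (loop P) {suc d} back (h ∷ hs) = just look , (h , left) ∷ keep hs
next (loop P) {suc d} look (bit false ∷ hs) = just (body (entry P)) , keep (bit false ∷ hs)
next (loop P) {suc d} look (h ∷ hs) = just rewind , (h , right) ∷ keep hs
next (loop P) {suc d} rewind (blank ∷ hs) = nothing , keep (blank ∷ hs)
next (loop P) {suc d} rewind (h ∷ hs) = just rewind , (h , right) ∷ keep hs
next (loop P) {suc d} (body s) (h ∷ hs) =
  Product.map (just ∘ maybe′ body back) ((h , stay) ∷_) (next P s hs)

heads : ∀ {g m} → Vec (Tape g) m → Vec (Symbol g) m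
heads = Vec.map Tape.head

step₁ : ∀ {k} (P : Prog k) {d} → States P × Vec (Tape 0) (d + k) → Maybe (States P) × Vec (Tape 0) (d + k)
step₁ P (s , ts) = Product.map₂ (λ as → Vec.zipWith act as ts) (next P s (heads ts))

data Steps {S T : Set} (f : S × T → Maybe S × T) : ℕ → Maybe S × T → Maybe S × T → Set where
  done : ∀ {c} → Steps f 0 c c
  step : ∀ {n s t c} → Steps f n (f (s , t)) c → Steps f (suc n) (just s , t) c

module _ {S T : Set} {f : S × T → Maybe S × T} where

  steps-trans : ∀ {m n a b c} → Steps f m a b → Steps f n b c → Steps f (m + n) a c
  steps-trans done      q = q
  steps-trans (step p) q = step (steps-trans p q)

-- How a run of a part becomes a run of the whole: `φ` embeds the states, `ψ` may add a tape that
-- stays put, and `e` is where the whole continues after the part has exited.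
steps-lift : ∀ {S T S′ T′ : Set} {f : S × T → Maybe S × T} {g : S′ × T′ → Maybe S′ × T′}
  (φ : S → S′) (ψ : T → T′) (e : Maybe S′) →
  (∀ s t → g (φ s , ψ t) ≡ Product.map (maybe′ (just ∘ φ) e) ψ (f (s , t))) →
  ∀ {n a b} → Steps f n a b →
  Steps g n (Product.map (maybe′ (just ∘ φ) e) ψ a) (Product.map (maybe′ (just ∘ φ) e) ψ b)
steps-lift φ ψ e h done = done
steps-lift {f = f} {g} φ ψ e h (step {n} {s} {t} p) =
  step (subst (λ a → Steps g n a _) (sym (h s t)) (steps-lift φ ψ e h p))

-- The stack is what lies to the left of the head; the rest of its tape is
-- arbitrary.
Holds : Tape 0 → Word → Set
Holds t w = Tape.before t ≡ List.map bit w

-- `floor` is read leftwards from the head, `above` rightwards. The final blank of `above` is the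
-- resting cell, left behind by the first move to the left, so that the way back ends exactly in
-- `rest`.
floor above : ℕ → List Sy
floor zero    = bit true ∷ []
floor (suc i) = bit false ∷ floor i
above zero    = blank ∷ []
above (suc i) = bit false ∷ above i

-- A loop tape carries a marker followed by n ticks.  At rest the head is behind
-- the ticks.
rest : ℕ → Tape 0
rest n = tape (floor n) blank []

onTick : ℕ → ℕ → Tape 0
onTick i j = tape (floor i) (bit false) (above j)

Store : ∀ {k} d → ℕ → Stacks k → Vec (Tape 0) (d + k) → Set
Store zero    n []      []       = ⊤
Store zero    n (w ∷ σ) (t ∷ ts) = Holds t w × Store zero n σ ts
Store (suc d) n σ       (t ∷ ts) = t ≡ rest n × Store d n σ ts

act-keep : ∀ {g m} (ts : Vec (Tape g) m) → Vec.zipWith act (keep (heads ts)) ts ≡ ts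
act-keep []       = refl
act-keep (t ∷ ts) = cong (t ∷_) (act-keep ts)

store-keep : ∀ {k} d n (σ : Stacks k) ts → Store d n σ ts →
  Store d n σ (Vec.zipWith act (keep (heads ts)) ts)
store-keep d n σ ts = subst (Store d n σ) (sym (act-keep ts))

holds-push : ∀ b t w → Holds t w → Holds (act (bit b , right) t) (b ∷ w)
holds-push b (tape ls s [])       w h = cong (bit b ∷_) h
holds-push b (tape ls s (r ∷ rs)) w h = cong (bit b ∷_) h

store-push : ∀ {k} d n (σ : Stacks k) i b ts → Store d n σ ts →
  Store d n (updateAt σ i (b ∷_)) (Vec.zipWith act (keep (heads ts) [ d ↑ʳ i ]≔ (bit b , right)) ts)
store-push zero    n (w ∷ σ) zero    b (t ∷ ts) (p , q) = holds-push b t w p , store-keep 0 n σ ts q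
store-push zero    n (w ∷ σ) (suc i) b (t ∷ ts) (p , q) = p , store-push 0 n σ i b ts q
store-push (suc d) n σ       i       b (t ∷ ts) (p , q) = p , store-push d n σ i b ts q

store-pop : ∀ {k} d n (σ : Stacks k) i ts → Store d n σ ts →
  let ts′ = Vec.zipWith act (keep (heads ts) [ d ↑ʳ i ]≔ (lookup (heads ts) (d ↑ʳ i) , left)) ts in
  Store d n (updateAt σ i (List.drop 1)) ts′ ×
  symbol (lookup (heads ts′) (d ↑ʳ i)) ≡ List.head (lookup σ i)
store-pop zero n ([] ∷ σ) zero (tape [] s rs ∷ ts) (p , q) = (refl , store-keep 0 n σ ts q) , refl
store-pop zero n ((b ∷ w) ∷ σ) zero (tape (l ∷ ls) s rs ∷ ts) (refl , q) =
  (refl , store-keep 0 n σ ts q) , refl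
store-pop zero n ([] ∷ σ) zero (tape (l ∷ ls) s rs ∷ ts) (() , q)
store-pop zero n ((b ∷ w) ∷ σ) zero (tape [] s rs ∷ ts) (() , q)
store-pop zero    n (w ∷ σ) (suc i) (t ∷ ts) (p , q) = Product.map₁ (p ,_) (store-pop 0 n σ i ts q)
store-pop (suc d) n σ       i       (t ∷ ts) (p , q) = Product.map₁ (p ,_) (store-pop d n σ i ts q)

_⊢_⟶_within_ : ∀ {k} (P : Prog k) {d} → Maybe (States P) × Vec (Tape 0) (d + k) →
  (Maybe (States P) × Vec (Tape 0) (d + k)) → ℕ → Set
P ⊢ a ⟶ b within m = ∃[ l ] l ≤ m × Steps (step₁ P) l a b

within-trans : ∀ {k} {P : Prog k} {d} {a b c : Maybe (States P) × Vec (Tape 0) (d + k)} {m n} →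
  P ⊢ a ⟶ b within m → P ⊢ b ⟶ c within n → P ⊢ a ⟶ c within (m + n)
within-trans (l , p , q) (l′ , p′ , q′) = l + l′ , +-mono-≤ p p′ , steps-trans q q′

within-≤ : ∀ {k} {P : Prog k} {d} {a b : Maybe (States P) × Vec (Tape 0) (d + k)} {m n} →
  m ≤ n → P ⊢ a ⟶ b within m → P ⊢ a ⟶ b within n
within-≤ m≤n (l , p , q) = l , ≤-trans p m≤n , q

-- Induction on the program. A loop takes the first counter tape and leaves the others to its body.
-- On exit all counter tapes are at rest again, so consecutive loops and later rounds can reuse
-- them.
exec : ∀ {k} (P : Prog k) d → depth P ≤ d → ∀ n σ ts → Store d n σ ts →
  ∃[ ts′ ] P ⊢ (just (entry P) , ts) ⟶ (nothing , ts′) within ⟦ cost P ⟧ n × Store d n (run P n σ) ts′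
exec skip d h n σ ts r = _ , (1 , ≤-refl , step done) , store-keep d n σ ts r
exec (push i b) d h n σ ts r = _ , (1 , ≤-refl , step done) , store-push d n σ i b ts r
exec (pop i P) d h n σ ts r
  with store-pop d n σ i ts r
... | r₁ , eq
  with exec (P (List.head (lookup σ i))) d (≤-trans (depth-branch i P _) h) n _ _ (store-keep d n _ _ r₁)
... | ts₂ , (l , l≤ , p) , r₂ =
  ts₂ , (2 + l , ≤-trans (s≤s (s≤s l≤)) (cost-branch i P n x) , step (step (subst
    (λ y → Steps (step₁ (pop i P)) l (just (branch y (entry (P y))) , _) (nothing , ts₂)) (sym eq) p′))) , r₂
  where
  x  = List.head (lookup σ i)
  p′ = steps-lift {g = step₁ (pop i P)} (branch x) id nothing (λ s t → helper (next (P x) s (heads t)) t) p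
    where
    helper : ∀ (c : Maybe (States (P x)) × Vec Act (d + _)) t →
      Product.map₂ (λ as → Vec.zipWith act as t) (Product.map₁ (Maybe.map (branch x)) c) ≡
      Product.map (maybe′ (just ∘ branch x) nothing) id (Product.map₂ (λ as → Vec.zipWith act as t) c)
    helper (just _  , _) t = refl
    helper (nothing , _) t = refl
exec (P ⨾ Q) d h n σ ts r
  with exec P d (≤-trans (m≤m⊔n _ _) h) n σ ts r
... | ts₁ , (l₁ , l₁≤ , p) , r₁
  with exec Q d (≤-trans (m≤n⊔m (depth P) _) h) n _ ts₁ r₁
... | ts₂ , (l₂ , l₂≤ , q) , r₂ =
  ts₂ , (l₁ + l₂ , +-mono-≤ l₁≤ l₂≤ , steps-trans p′ q′) , r₂
  where
  p′ = steps-lift {g = step₁ (P ⨾ Q)} inj₁ id (just (inj₂ (entry Q))) (λ s t → helper (next P s (heads t)) t) p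
    where
    helper : ∀ (c : Maybe (States P) × Vec Act (d + _)) t →
      Product.map₂ (λ as → Vec.zipWith act as t) (Product.map₁ (just ∘ maybe′ inj₁ (inj₂ (entry Q))) c) ≡
      Product.map (maybe′ (just ∘ inj₁) (just (inj₂ (entry Q)))) id (Product.map₂ (λ as → Vec.zipWith act as t) c)
    helper (just _  , _) t = refl
    helper (nothing , _) t = refl
  q′ = steps-lift {g = step₁ (P ⨾ Q)} inj₂ id nothing (λ s t → helper (next Q s (heads t)) t) q
    where
    helper : ∀ (c : Maybe (States Q) × Vec Act (d + _)) t →
      Product.map₂ (λ as → Vec.zipWith act as t) (Product.map₁ (Maybe.map inj₂) c) ≡
      Product.map (maybe′ (just ∘ inj₂) nothing) id (Product.map₂ (λ as → Vec.zipWith act as t) c)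
    helper (just _  , _) t = refl
    helper (nothing , _) t = refl
exec (loop P) (suc d) (s≤s h) n σ (_ ∷ ts) (refl , r) = whole n refl
  where
  c = ⟦ cost P ⟧ n
  L = loop P

  pass : ∀ t {σ} ts → Store d n σ ts → ∃[ ts′ ]
    L ⊢ (just (body (entry P)) , t ∷ ts) ⟶ (just back , t ∷ ts′) within c × Store d n (run P n σ) ts′
  pass t ts r with exec P d h n _ ts r
  ... | ts′ , (l , l≤ , p) , r′ = ts′ , (l , l≤ , p′) , r′
    where
    p′ = steps-lift {g = step₁ L} body (t ∷_) (just back) (λ s u → helper (next P s (heads u)) u) p
      where
      helper : ∀ (c : Maybe (States P) × Vec Act (d + _)) u →
        Product.map₂ (λ as → Vec.zipWith act as (t ∷ u))
          (Product.map (just ∘ maybe′ body back) ((Tape.head t , stay) ∷_) c) ≡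
        Product.map (maybe′ (just ∘ body) (just back)) (t ∷_) (Product.map₂ (λ as → Vec.zipWith act as u) c)
      helper (just _  , _) u = refl
      helper (nothing , _) u = refl

  -- With `i` ticks below the head there are `i` rounds to come; then the marker is met and the head
  -- turns round onto the lowest tick.
  fall : ∀ i j m → i + j ≡ m → ∀ {σ} ts → Store d n σ ts → ∃[ ts′ ]
    L ⊢ (just back , onTick i j ∷ ts) ⟶ (just rewind , onTick 0 m ∷ ts′) within (i * (2 + c) + 2) ×
    Store d n (iter i (run P n) σ) ts′
  fall zero j m refl ts r = _ , (2 , ≤-refl , step (step done)) , store-keep d n _ _ (store-keep d n _ _ r)
  fall (suc i) j m eq ts r
    with pass (onTick i (suc j)) _ (store-keep d n _ _ (store-keep d n _ _ r))
  ... | ts₁ , (l₁ , l₁≤ , p) , r₁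
    with fall i (suc j) m (trans (+-suc i j) eq) ts₁ r₁
  ... | ts₂ , q , r₂ = ts₂ , within-≤ (≤-reflexive (sym (+-assoc (2 + c) _ 2)))
    (within-trans (2 + l₁ , s≤s (s≤s l₁≤) , step (step p)) q) , r₂

  rise : ∀ i j m → j + i ≡ m → ∀ {σ} ts → Store d n σ ts → ∃[ ts′ ]
    L ⊢ (just rewind , onTick i j ∷ ts) ⟶ (nothing , rest (suc m) ∷ ts′) within (2 + j) ×
    Store d n σ ts′
  rise i zero m refl ts r = _ , (2 , ≤-refl , step (step done)) , store-keep d n _ _ (store-keep d n _ _ r)
  rise i (suc j) m eq ts r with rise (suc i) j m (trans (+-suc j i) eq) _ (store-keep d n _ ts r)
  ... | ts′ , (l , l≤ , p) , r′ = ts′ , (suc l , s≤s l≤ , step p) , r′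

  -- The count is split into cases as `m`, while `n` stays intact in `c` and in the ticks of the
  -- inner loops.
  whole : ∀ m → m ≡ n → ∃[ ts′ ]
    L ⊢ (just back , rest m ∷ ts) ⟶ (nothing , ts′) within (m * (2 + c) + (m + 3)) ×
    Store (suc d) n (iter m (run P n) σ) ts′
  whole zero eq = _ , (3 , ≤-refl , step (step (step done))) ,
    cong rest eq , store-keep d n _ _ (store-keep d n _ _ (store-keep d n _ ts r))
  whole (suc m) eq
    with pass (onTick m 0) _ (store-keep d n _ _ (store-keep d n _ _ r))
  ... | ts₁ , (l₁ , l₁≤ , p) , r₁
    with fall m 0 m (+-identityʳ m) ts₁ r₁
  ... | ts₂ , q , r₂
    with rise 0 m m (+-identityʳ m) ts₂ r₂
  ... | ts₃ , q′ , r₃ = rest (suc m) ∷ ts₃ ,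
    within-≤ (begin
      2 + c + (m * (2 + c) + 2 + (2 + m))       ≡⟨ cong (2 + c +_) (+-assoc (m * (2 + c)) 2 (2 + m)) ⟩
      2 + c + (m * (2 + c) + (4 + m))           ≡⟨ +-assoc (2 + c) (m * (2 + c)) (4 + m) ⟨
      suc m * (2 + c) + (4 + m)                 ≡⟨ cong (λ z → suc m * (2 + c) + suc z) (+-comm 3 m) ⟩
      suc m * (2 + c) + (suc m + 3)             ∎)
      (within-trans (2 + l₁ , s≤s (s≤s l₁≤) , step (step p)) (within-trans q q′)) ,
    cong rest eq , r₃
    where open ≤-Reasoning

-- Turing machines running loop programs

Finite : Set → Set
Finite A = ∃[ n ] A ↔ Fin n

via : ∀ {A B : Set} → A ↔ B → Finite B → Finite A
via f (n , g) = n , ↔-trans f g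

finite-⊤ : Finite ⊤
finite-⊤ = 1 , ↔-sym 1↔⊤

finite-Bool : Finite Bool
finite-Bool = 2 , ↔-sym 2↔Bool

finite-⊎ : ∀ {A B : Set} → Finite A → Finite B → Finite (A ⊎ B)
finite-⊎ (m , f) (n , g) = m + n , ↔-trans (f ⊎-↔ g) (↔-sym +↔⊎)

finite-× : ∀ {A B : Set} → Finite A → Finite B → Finite (A × B)
finite-× (m , f) (n , g) = m * n , ↔-trans (f ×-↔ g) (↔-sym *↔×)

finite-Vec : ∀ {A : Set} → Finite A → ∀ n → Finite (Vec A n)
finite-Vec f zero    = via (mk↔ₛ′ (λ _ → tt) (λ _ → []) (λ _ → refl) (λ { [] → refl })) finite-⊤
finite-Vec f (suc n) = via
  (mk↔ₛ′ (λ { (x ∷ xs) → x , xs }) (λ { (x , xs) → x ∷ xs }) (λ { (x , xs) → refl }) (λ { (x ∷ xs) → refl }))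
  (finite-× f (finite-Vec f n))

finite-Symbol : ∀ g → Finite (Symbol g)
finite-Symbol g = via
  (mk↔ₛ′ (λ { blank → inj₁ tt ; (bit b) → inj₂ (inj₁ b) ; (aux i) → inj₂ (inj₂ i) })
         (λ { (inj₁ _) → blank ; (inj₂ (inj₁ b)) → bit b ; (inj₂ (inj₂ i)) → aux i })
         (λ { (inj₁ _) → refl ; (inj₂ (inj₁ b)) → refl ; (inj₂ (inj₂ i)) → refl })
         (λ { blank → refl ; (bit b) → refl ; (aux i) → refl }))
  (finite-⊎ finite-⊤ (finite-⊎ finite-Bool (g , ↔-refl)))

finite-Move : Finite Move
finite-Move = via
  (mk↔ₛ′ (λ { left → inj₁ tt ; stay → inj₂ false ; right → inj₂ true })
         (λ { (inj₁ _) → left ; (inj₂ false) → stay ; (inj₂ true) → right })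
         (λ { (inj₁ _) → refl ; (inj₂ false) → refl ; (inj₂ true) → refl })
         (λ { left → refl ; stay → refl ; right → refl }))
  (finite-⊎ finite-⊤ finite-Bool)

finite-States : ∀ {k} (P : Prog k) → Finite (States P)
finite-States skip       = finite-⊤
finite-States (push _ _) = finite-⊤
finite-States (pop _ P)  = via
  (mk↔ₛ′ (λ { down → inj₁ false ; look → inj₁ true ; (branch nothing s) → inj₂ (inj₁ s)
            ; (branch (just false) s) → inj₂ (inj₂ (inj₁ s)) ; (branch (just true) s) → inj₂ (inj₂ (inj₂ s)) })
         (λ { (inj₁ false) → down ; (inj₁ true) → look ; (inj₂ (inj₁ s)) → branch nothing s
            ; (inj₂ (inj₂ (inj₁ s))) → branch (just false) s ; (inj₂ (inj₂ (inj₂ s))) → branch (just true) s })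
         (λ { (inj₁ false) → refl ; (inj₁ true) → refl ; (inj₂ (inj₁ s)) → refl
            ; (inj₂ (inj₂ (inj₁ s))) → refl ; (inj₂ (inj₂ (inj₂ s))) → refl })
         (λ { down → refl ; look → refl ; (branch nothing s) → refl
            ; (branch (just false) s) → refl ; (branch (just true) s) → refl }))
  (finite-⊎ finite-Bool (finite-⊎ (finite-States (P nothing))
    (finite-⊎ (finite-States (P (just false))) (finite-States (P (just true))))))
finite-States (P ⨾ Q)    = finite-⊎ (finite-States P) (finite-States Q)
finite-States (loop P)   = via
  (mk↔ₛ′ (λ { back → inj₁ tt ; look → inj₂ (inj₁ false) ; rewind → inj₂ (inj₁ true) ; (body s) → inj₂ (inj₂ s) })
         (λ { (inj₁ _) → back ; (inj₂ (inj₁ false)) → look ; (inj₂ (inj₁ true)) → rewind ; (inj₂ (inj₂ s)) → body s })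
         (λ { (inj₁ _) → refl ; (inj₂ (inj₁ false)) → refl ; (inj₂ (inj₁ true)) → refl ; (inj₂ (inj₂ s)) → refl })
         (λ { back → refl ; look → refl ; rewind → refl ; (body s) → refl }))
  (finite-⊎ finite-⊤ (finite-⊎ finite-Bool (finite-States P)))

zipWith-∷ʳ : ∀ {A B C : Set} {m} (f : A → B → C) (as : Vec A m) a (bs : Vec B m) b →
  Vec.zipWith f (as ∷ʳ a) (bs ∷ʳ b) ≡ Vec.zipWith f as bs ∷ʳ f a b
zipWith-∷ʳ f []       a []       b = refl
zipWith-∷ʳ f (x ∷ as) a (y ∷ bs) b = cong (f x y ∷_) (zipWith-∷ʳ f as a bs b)

-- Machines over an arbitrary finite set of states

module Machine {S : Set} (finite : Finite S) (m : ℕ) (start : S) (accepting : S → Bool)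
  (δ : S → Sy → Vec Sy m → Sy → List (S × Act × Vec Act m × Act)) where

  C : Set
  C = S × Tape 0 × Vec (Tape 0) m × Tape 0

  apply : C → S × Act × Vec Act m × Act → C
  apply (_ , t , ts , u) (s , a , as , b) = s , act a t , Vec.zipWith act as ts , act b u

  choices : C → List (S × Act × Vec Act m × Act)
  choices (s , t , ts , u) = δ s (Tape.head t) (heads ts) (Tape.head u)

  opts : C → List C
  opts c = List.map (apply c) (choices c)

  data Path : ℕ → C → C → Set where
    done : ∀ {c} → Path 0 c c
    step : ∀ {k a b c} → b ∈ opts a → Path k b c → Path (suc k) a c

  data Forced : ℕ → C → C → Set where
    done : ∀ {c} → Forced 0 c c
    step : ∀ {k a b c} → opts a ≡ b ∷ [] → Forced k b c → Forced (suc k) a c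

  forced-trans : ∀ {j k a b c} → Forced j a b → Forced k b c → Forced (j + k) a c
  forced-trans done       q = q
  forced-trans (step e p) q = step e (forced-trans p q)

  path-trans : ∀ {j k a b c} → Path j a b → Path k b c → Path (j + k) a c
  path-trans done       q = q
  path-trans (step e p) q = step e (path-trans p q)

  forced⇒path : ∀ {k a b} → Forced k a b → Path k a b
  forced⇒path done       = done
  forced⇒path (step e p) = step (subst (_ ∈_) (sym e) (here refl)) (forced⇒path p)

  -- A forced stretch offers no alternative, and the path cannot end inside it because `c` has no
  -- successor; so the path passes through `b`.
  factor : ∀ {j k a b c} → Forced j a b → Path k a c → opts c ≡ [] → ∃[ l ] Path l b c
  factor done       q          h = _ , q
  factor (step e p) done       h = case trans (sym e) h of λ ()
  factor (step e p) (step x q) h with subst (_ ∈_) e x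
  ... | here refl = factor p q h

  enc : S → Fin (proj₁ finite)
  enc = Inverse.to (proj₂ finite)

  dec : Fin (proj₁ finite) → S
  dec = Inverse.from (proj₂ finite)

  dec-enc : ∀ s → dec (enc s) ≡ s
  dec-enc s = Inverse.inverseʳ (proj₂ finite) refl

  flat : S × Act × Vec Act m × Act → Fin (proj₁ finite) × Vec Act (suc (suc m))
  flat (s , a , as , b) = enc s , a ∷ (as ∷ʳ b)

  machine : TM
  machine = record
    { extraTapes = suc m
    ; auxSymbols = 0
    ; states     = proj₁ finite
    ; start      = enc start
    ; accept     = accepting ∘ dec
    ; δ          = λ { q (h ∷ hs) → List.map flat (δ (dec q) h (Vec.init hs) (Vec.last hs)) }
    }

  config : C → Config machine
  config (s , t , ts , u) = enc s , t ∷ (ts ∷ʳ u)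

  options-config : ∀ c → options machine (config c) ≡ List.map flat (choices c)
  options-config (s , t , ts , u)
    rewrite dec-enc s | map-∷ʳ Tape.head u ts
          | init-∷ʳ (Tape.head u) (heads ts) | last-∷ʳ (Tape.head u) (heads ts) = refl

  act-config : ∀ c o →
    (proj₁ (flat o) , Vec.zipWith act (proj₂ (flat o)) (proj₂ (config c))) ≡ config (apply c o)
  act-config (s , t , ts , u) (s′ , a , as , b) =
    cong (λ z → enc s′ , act a t ∷ z) (zipWith-∷ʳ act as b ts u)

  path⇒run : ∀ {k a b} → Path k a b → Run machine k (config a) (config b)
  path⇒run done = done
  path⇒run {a = a} (step {k = j} {c = y} x p) with ∈-map⁻ (apply a) x
  ... | o , o∈ , refl = step (subst (_ ∈_) (sym (options-config a)) (∈-map⁺ flat o∈))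
                             (subst (λ z → Run machine j z (config y)) (sym (act-config a o)) (path⇒run p))

  run⇒path : ∀ {k a x} → Run machine k (config a) x → ∃[ b ] x ≡ config b × Path k a b
  run⇒path {a = a} done = a , refl , done
  run⇒path {a = a} (step {k = j} {c = y} x r) with ∈-map⁻ flat (subst (_ ∈_) (options-config a) x)
  ... | o , o∈ , refl with run⇒path (subst (λ z → Run machine j z y) (act-config a o) r)
  ... | b , eq , p = b , eq , step (∈-map⁺ (apply a) o∈) p

  halted : ∀ c → opts c ≡ [] → Halted machine (config c)
  halted c h with choices c | options-config c
  ... | [] | eq = eq

-- `marking` and `loading` prepare the counter tapes, with one tick per letter, while the input is
-- pushed on the first stack. `guessing` pushes arbitrary bits on the second stack, the one from
-- which `unstacking` and `reading` later take the result.
data Phase (S : Set) : Set where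
  marking loading guessing unstacking reading halting accepted : Phase S
  running : S → Phase S

module Driver {k} (P : Prog (2 + k)) (guess : Bool) where

  d : ℕ
  d = depth P

  m : ℕ
  m = d + (2 + k)

  stack₁ : Fin m
  stack₁ = d ↑ʳ suc zero

  loadAct : Act → Act → Vec Act m
  loadAct a b = Vec.replicate d a Vec.++ b ∷ Vec.replicate (suc k) (blank , stay)

  ready : Phase (States P)
  ready = if guess then guessing else running (entry P)

  -- A function machine writes its output from right to left, so the top of the stack becomes the
  -- last letter, and the final move puts the head on the first letter. An acceptor only inspects
  -- the top bit.
  read : Bool → Maybe Bool → Phase (States P) × Move
  read false (just _)    = unstacking , left
  read false nothing     = halting , right
  read true  (just true) = accepted , stay
  read true  _           = halting , stay

  cell : Maybe Bool → Sy
  cell = maybe′ bit blank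

  δ : Phase (States P) → Sy → Vec Sy m → Sy → List (Phase (States P) × Act × Vec Act m × Act)
  δ marking       h hs o = (loading , (h , stay) , loadAct (bit true , right) (blank , stay) , (o , stay)) ∷ []
  δ loading (bit b) hs o = (loading , (bit b , right) , loadAct (bit false , right) (bit b , right) , (o , stay)) ∷ []
  δ loading       h hs o = (ready , (h , stay) , keep hs , (o , stay)) ∷ []
  δ guessing      h hs o = if guess then
    (guessing , (h , stay) , keep hs [ stack₁ ]≔ (bit false , right) , (o , stay)) ∷
    (guessing , (h , stay) , keep hs [ stack₁ ]≔ (bit true , right) , (o , stay)) ∷
    (running (entry P) , (h , stay) , keep hs , (o , stay)) ∷ []
    else []
  δ (running s)   h hs o =
    (maybe′ running unstacking (proj₁ (next P s hs)) , (h , stay) , proj₂ (next P s hs) , (o , stay)) ∷ []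
  δ unstacking    h hs o = (reading , (h , stay) , keep hs [ stack₁ ]≔ (lookup hs stack₁ , left) , (o , stay)) ∷ []
  δ reading       h hs o =
    (proj₁ (read guess x) , (h , stay) , keep hs , (cell x , proj₂ (read guess x))) ∷ []
    where x = symbol (lookup hs stack₁)
  δ halting       h hs o = []
  δ accepted      h hs o = []

  finite : Finite (Phase (States P))
  finite = via
    (mk↔ₛ′ (λ { marking → inj₁ 0F ; loading → inj₁ 1F ; guessing → inj₁ 2F ; unstacking → inj₁ 3F
              ; reading → inj₁ 4F ; halting → inj₁ 5F ; accepted → inj₁ 6F ; (running s) → inj₂ s })
           (λ { (inj₁ 0F) → marking ; (inj₁ 1F) → loading ; (inj₁ 2F) → guessing ; (inj₁ 3F) → unstacking
              ; (inj₁ 4F) → reading ; (inj₁ 5F) → halting ; (inj₁ 6F) → accepted ; (inj₂ s) → running s })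
           (λ { (inj₁ 0F) → refl ; (inj₁ 1F) → refl ; (inj₁ 2F) → refl ; (inj₁ 3F) → refl
              ; (inj₁ 4F) → refl ; (inj₁ 5F) → refl ; (inj₁ 6F) → refl ; (inj₂ s) → refl })
           (λ { marking → refl ; loading → refl ; guessing → refl ; unstacking → refl
              ; reading → refl ; halting → refl ; accepted → refl ; (running s) → refl }))
    (finite-⊎ (7 , ↔-refl) (finite-States P))

  accepting : Phase (States P) → Bool
  accepting accepted = true
  accepting _        = false

  open Machine finite m marking accepting δ public

  blanks : Vec (Tape 0) m
  blanks = Vec.replicate m emptyTape

  inputAt : List Sy → Word → Tape 0
  inputAt ls []      = tape ls blank []
  inputAt ls (b ∷ w) = tape ls (bit b) (List.map bit w)

  initial-config : ∀ w → initial machine w ≡ config (marking , inputAt [] w , blanks , emptyTape)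
  initial-config w = cong₂ (λ t ts → enc marking , t ∷ ts) (input w) (replicate-∷ʳ m)
    where
    input : ∀ w → inputTape w ≡ inputAt [] w
    input []      = refl
    input (_ ∷ _) = refl
    replicate-∷ʳ : ∀ j → Vec.replicate (suc j) (emptyTape {0}) ≡ Vec.replicate j emptyTape ∷ʳ emptyTape
    replicate-∷ʳ zero    = refl
    replicate-∷ʳ (suc j) = cong (emptyTape ∷_) (replicate-∷ʳ j)

  start-config : Word → C
  start-config w = marking , inputAt [] w , blanks , emptyTape

  run-from : ∀ {l b} w → Path l (start-config w) b → Run machine l (initial machine w) (config b)
  run-from {l} {b} w p = subst (λ a → Run machine l a (config b)) (sym (initial-config w)) (path⇒run p)

  path-from : ∀ {l x} w → Run machine l (initial machine w) x → ∃[ b ] x ≡ config b × Path l (start-config w) b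
  path-from {l} {x} w r = run⇒path (subst (λ a → Run machine l a x) (initial-config w) r)

  store-idle : ∀ {j} n n′ (σ : Stacks j) ts → Store 0 n σ ts →
    Store 0 n′ σ (Vec.zipWith act (Vec.replicate j (blank , stay)) ts)
  store-idle n n′ []      []       r       = tt
  store-idle n n′ (w ∷ σ) (t ∷ ts) (p , r) = p , store-idle n n′ σ ts r

  store-empty : ∀ j → Store 0 0 (Vec.replicate j []) (Vec.replicate j emptyTape)
  store-empty zero    = tt
  store-empty (suc j) = refl , store-empty j

  store-mark : ∀ e → Store e 0 (Vec.replicate (2 + k) [])
    (Vec.zipWith act (Vec.replicate e (bit true , right) Vec.++ (blank , stay) ∷ Vec.replicate (suc k) (blank , stay))
      (Vec.replicate (e + (2 + k)) emptyTape))
  store-mark zero    = store-idle 0 0 (Vec.replicate (2 + k) []) (Vec.replicate (2 + k) emptyTape) (store-empty (2 + k))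
  store-mark (suc e) = refl , store-mark e

  store-load : ∀ e n w (σ : Stacks (suc k)) b ts → Store e n (w ∷ σ) ts → Store e (suc n) ((b ∷ w) ∷ σ)
    (Vec.zipWith act (Vec.replicate e (bit false , right) Vec.++ (bit b , right) ∷ Vec.replicate (suc k) (blank , stay)) ts)
  store-load zero    n w σ b (t ∷ ts) (p , r)    = holds-push b t w p , store-idle n (suc n) σ ts r
  store-load (suc e) n w σ b (t ∷ ts) (refl , r) = refl , store-load e n w σ b ts r

  load : ∀ w ls n v σ ts o → Store d n (v ∷ σ) ts → ∃[ t′ ] ∃[ ts′ ]
    Forced (suc (length w)) (loading , inputAt ls w , ts , o) (ready , t′ , ts′ , o) ×
    Store d (length w + n) ((w ʳ++ v) ∷ σ) ts′
  load [] ls n v σ ts o r = _ , _ , step refl done , store-keep d n _ ts r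
  load (b ∷ w) ls n v σ ts o r with load w (bit b ∷ ls) (suc n) (b ∷ v) σ _ o (store-load d n v σ b ts r)
  ... | t′ , ts′ , p , r′ = t′ , ts′ , step (cong (λ t → (loading , t , _ , o) ∷ []) (advance w)) p ,
    subst (λ l → Store d l ((w ʳ++ b ∷ v) ∷ σ) ts′) (+-suc (length w) n) r′
    where
    advance : ∀ w → move right (tape ls (bit b) (List.map bit w)) ≡ inputAt (bit b ∷ ls) w
    advance []      = refl
    advance (_ ∷ _) = refl

  start : Word → Word → Stacks (2 + k)
  start w c = List.reverse w ∷ c ∷ Vec.replicate k []

  setup : ∀ w → ∃[ t ] ∃[ ts ]
    Forced (2 + length w) (marking , inputAt [] w , blanks , emptyTape) (ready , t , ts , emptyTape) ×
    Store d (length w) (start w []) ts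
  setup w with load w [] 0 [] _ _ emptyTape (store-mark d)
  ... | t , ts , p , r = t , ts , step refl p , subst (λ l → Store d l (start w []) ts) (+-identityʳ (length w)) r

  forced-steps : ∀ {l} (a b : Maybe (States P) × Vec (Tape 0) m) t o → Steps (step₁ P) l a b →
    Forced l (maybe′ running unstacking (proj₁ a) , t , proj₂ a , o) (maybe′ running unstacking (proj₁ b) , t , proj₂ b , o)
  forced-steps a .a t o done = done
  forced-steps (just s , ts) b t o (step p) = step refl (forced-steps _ b t o p)

  execute : ∀ n σ t ts o → Store d n σ ts → ∃[ l ] ∃[ ts′ ] l ≤ ⟦ cost P ⟧ n ×
    Forced l (running (entry P) , t , ts , o) (unstacking , t , ts′ , o) × Store d n (run P n σ) ts′
  execute n σ t ts o r with exec P d ≤-refl n σ ts r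
  ... | ts′ , (l , l≤ , p) , r′ = l , ts′ , l≤ , forced-steps _ _ t o p , r′

  result : Word → Word → Word
  result w c = lookup (run P (length w) (start w c)) (suc zero)

  unstack : ∀ n σ t ts o → Store d n σ ts → let x = List.head (lookup σ (suc zero)) in ∃[ ts′ ]
    Forced 2 (unstacking , t , ts , o)
      (proj₁ (read guess x) , t , ts′ , act (cell x , proj₂ (read guess x)) o) ×
    Store d n (updateAt σ (suc zero) (List.drop 1)) ts′
  unstack n σ t ts o r with store-pop d n σ (suc zero) ts r
  ... | r′ , eq = _ , step refl (step (cong (λ x →
    (proj₁ (read guess x) , t , _ , act (cell x , proj₂ (read guess x)) o) ∷ []) eq) done) , store-keep d n _ _ r′

leadingBits-map : ∀ {g} w → leadingBits {g} (List.map bit w) ≡ w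
leadingBits-map []      = refl
leadingBits-map (b ∷ w) = cong (b ∷_) (leadingBits-map w)

-- The outer `List.reverse` is due to unloading. Setting up takes two steps more than the input is
-- long, execution at most `cost P`, and unloading two steps for each of at most `cost P` bits, plus
-- two to notice the empty stack.
compute : ∀ {k} (P : Prog (2 + k)) →
  PolyTimeComputable (λ w → List.reverse (lookup
    (run P (length w) (List.reverse w ∷ [] ∷ Vec.replicate k [])) (suc zero)))
compute {k} P = machine , deterministic , (X ⊕ const 4) ⊕ (cost P ⊕ (cost P ⊕ cost P)) , computation
  where
  open Driver P false

  deterministic : Deterministic machine
  deterministic q (h ∷ hs) = ≤-trans (≤-reflexive (length-map flat (δ (dec q) h (Vec.init hs) (Vec.last hs))))
    (single (dec q) h (Vec.init hs) (Vec.last hs))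
    where
    single : ∀ s h hs o → length (δ s h hs o) ≤ 1
    single marking     h       hs o = ≤-refl
    single loading     blank   hs o = ≤-refl
    single loading     (bit b) hs o = ≤-refl
    single guessing    h       hs o = z≤n
    single unstacking  h       hs o = ≤-refl
    single reading     h       hs o = ≤-refl
    single halting     h       hs o = z≤n
    single accepted    h       hs o = z≤n
    single (running s) h       hs o = ≤-refl

  unload : ∀ n v (w : Word) σ t ts → lookup σ (suc zero) ≡ w → Store d n σ ts → ∃[ l ] ∃[ ts′ ] ∃[ o ]
    Forced l (unstacking , t , ts , tape [] blank (List.map bit v)) (halting , t , ts′ , o) ×
    l ≤ length w + length w + 2 × outputWord o ≡ w ʳ++ v
  unload n v [] σ t ts eq r with unstack n σ t ts (tape [] blank (List.map bit v)) r
  ... | ts′ , p , _ rewrite eq = 2 , ts′ , _ , p , ≤-refl , written v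
    where
    written : ∀ v → outputWord (move {0} right (tape [] blank (List.map bit v))) ≡ v
    written []      = refl
    written (b ∷ v) = cong (b ∷_) (leadingBits-map v)
  unload n v (b ∷ w) σ t ts eq r with unstack n σ t ts (tape [] blank (List.map bit v)) r
  ... | ts₁ , p , r₁ rewrite eq
    with unload n (b ∷ v) w _ t ts₁ (tail-at σ eq) r₁
    where
    tail-at : ∀ {j} (σ : Stacks (suc (suc j))) → lookup σ (suc zero) ≡ b ∷ w →
      lookup (updateAt σ (suc zero) (List.drop 1)) (suc zero) ≡ w
    tail-at (_ ∷ _ ∷ _) eq = cong (List.drop 1) eq
  ... | l , ts₂ , o , q , l≤ , out = 2 + l , ts₂ , o , forced-trans p q ,
    ≤-trans (+-monoʳ-≤ 2 l≤) (≤-reflexive (cong (λ z → suc (z + 2)) (sym (+-suc (length w) (length w))))) , out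

  computation : ∀ w → ∃[ l ] l ≤ ⟦ (X ⊕ const 4) ⊕ (cost P ⊕ (cost P ⊕ cost P)) ⟧ (length w) ×
    (∃[ x ] Run machine l (initial machine w) x × Halted machine x × output machine x ≡ List.reverse (result w []))
  computation w
    with setup w
  ... | t , ts₁ , p₁ , r₁
    with execute (length w) _ t ts₁ emptyTape r₁
  ... | l₂ , ts₂ , l₂≤ , p₂ , r₂
    with unload (length w) [] (result w []) _ t ts₂ refl r₂
  ... | l₃ , ts₃ , o , p₃ , l₃≤ , out = (2 + length w) + (l₂ + l₃) ,
    (begin
      2 + length w + (l₂ + l₃)                          ≤⟨ +-monoʳ-≤ (2 + length w) (+-mono-≤ l₂≤ l₃≤) ⟩
      2 + length w + (c + (r + r + 2))                  ≤⟨ +-monoʳ-≤ (2 + length w) (+-monoʳ-≤ c (+-monoˡ-≤ 2 (+-mono-≤ r≤ r≤))) ⟩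
      2 + length w + (c + (c + c + 2))                  ≡⟨ cong (2 + length w +_) (+-assoc c (c + c) 2) ⟨
      2 + length w + (c + (c + c) + 2)                  ≡⟨ cong (2 + length w +_) (+-comm (c + (c + c)) 2) ⟩
      2 + length w + (2 + (c + (c + c)))                ≡⟨ +-assoc (2 + length w) 2 (c + (c + c)) ⟨
      2 + length w + 2 + (c + (c + c))                  ≡⟨ cong (_+ (c + (c + c))) (trans (cong (_+ 2) (+-comm 2 (length w))) (+-assoc (length w) 2 2)) ⟩
      length w + 4 + (c + (c + c))                      ∎) ,
    _ , run-from w (forced⇒path (forced-trans p₁ (forced-trans p₂ p₃))) ,
    halted (halting , t , ts₃ , o) refl , trans (cong outputWord (last-∷ʳ o (t ∷ ts₃))) out
    where
    open ≤-Reasoning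
    c = ⟦ cost P ⟧ (length w)
    r = length (result w [])
    r≤ : r ≤ c
    r≤ = ≤-trans (length-run P (length w) _ (suc zero)) (≤-reflexive (+-identityʳ c))

verdict : ∀ {k} → Prog (2 + k) → Word → Word → Maybe Bool
verdict {k} P w c = List.head (lookup (run P (length w) (List.reverse w ∷ c ∷ Vec.replicate k [])) (suc zero))

-- Guessing has no length limit, so the soundness premise must cover all certificates; the
-- completeness premise has to offer a short one, and only that enters the time bound.
decide : ∀ {k ℓ} (P : Prog (2 + k)) (q : Polynomial) (A : Language ℓ) →
  (∀ w c → verdict P w c ≡ just true → A w) →
  (∀ w → A w → ∃[ c ] length c ≤ ⟦ q ⟧ (length w) × verdict P w c ≡ just true) →
  NP A
decide P q A sound complete = machine , bound , λ w →
  mk⇔ (λ a → let (l , _ , r) = accepts w a in l , r) (λ (l , r) → rejects w l r) , accepts w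
  where
  open Driver P true

  bound : Polynomial
  bound = (const 2 ⊕ X) ⊕ (q ⊕ (const 1 ⊕ (cost P ⊕ const 2)))

  guessed : ∀ n v σ c t ts → Store d n (v ∷ [] ∷ σ) ts → ∃[ ts′ ]
    Path (length c) (guessing , t , ts , emptyTape) (guessing , t , ts′ , emptyTape) × Store d n (v ∷ c ∷ σ) ts′
  guessed n v σ []      t ts r = ts , done , r
  guessed n v σ (b ∷ c) t ts r with guessed n v σ c t ts r
  ... | ts′ , p , r′ = ts″ , subst (λ l → Path l (guessing , t , ts , emptyTape) (guessing , t , ts″ , emptyTape))
    (+-comm (length c) 1) (path-trans p (step (member b) done)) , store-push d n _ (suc zero) b ts′ r′
    where
    ts″ = Vec.zipWith act (keep (heads ts′) [ stack₁ ]≔ (bit b , right)) ts′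
    member : ∀ b → (guessing , t , Vec.zipWith act (keep (heads ts′) [ stack₁ ]≔ (bit b , right)) ts′ , emptyTape) ∈
      opts (guessing , t , ts′ , emptyTape)
    member false = here refl
    member true  = there (here refl)

  finish : ∀ w c t ts → Store d (length w) (start w c) ts → ∃[ l ] ∃[ ts′ ] ∃[ o ]
    l ≤ ⟦ cost P ⟧ (length w) + 2 ×
    Path 1 (guessing , t , ts , emptyTape) (running (entry P) , t , Vec.zipWith act (keep (heads ts)) ts , emptyTape) ×
    Forced l (running (entry P) , t , Vec.zipWith act (keep (heads ts)) ts , emptyTape)
      (proj₁ (read true (verdict P w c)) , t , ts′ , o)
  finish w c t ts r
    with execute (length w) _ t _ emptyTape (store-keep d (length w) _ ts r)
  ... | l₁ , ts₁ , l₁≤ , p₁ , r₁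
    with unstack (length w) _ t ts₁ emptyTape r₁
  ... | ts₂ , p₂ , _ = l₁ + 2 , ts₂ , _ , +-monoˡ-≤ 2 l₁≤ ,
    step (there (there (here refl))) done , forced-trans p₁ p₂

  accepts : ∀ w → A w → ∃[ l ] l ≤ ⟦ bound ⟧ (length w) × AcceptsIn machine l w
  accepts w a
    with complete w a | setup w
  ... | c , c≤ , v | t , ts₁ , p₁ , r₁
    with guessed (length w) _ _ c t ts₁ r₁
  ... | ts₂ , p₂ , r₂
    with finish w c t ts₂ r₂
  ... | l , ts₃ , o , l≤ , p₃ , p₄ rewrite v = _ ,
    +-monoʳ-≤ (2 + length w) (+-mono-≤ c≤ (s≤s l≤)) , _ ,
    run-from w (path-trans (forced⇒path p₁) (path-trans p₂ (path-trans p₃ (forced⇒path p₄)))) ,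
    subst (λ s → T (accepting s)) (sym (dec-enc accepted)) tt

  final : ∀ s t ts o → T (accepting s) → opts (s , t , ts , o) ≡ []
  final accepted t ts o _ = refl

  judged : ∀ x {t t′ ts ts′ o o′ l s} → T (accepting s) →
    Path l (proj₁ (read true x) , t , ts , o) (s , t′ , ts′ , o′) → x ≡ just true
  judged (just true)  acc p = refl
  judged (just false) () done
  judged (just false) acc (step () p)
  judged nothing      () done
  judged nothing      acc (step () p)

  -- `c` collects the bits guessed so far. Once guessing stops the machine is deterministic, and the
  -- verdict on `c` decides.
  guesses : ∀ w c t ts {l s t′ ts′ o′} → Store d (length w) (start w c) ts → T (accepting s) →
    Path l (guessing , t , ts , emptyTape) (s , t′ , ts′ , o′) → ∃[ c′ ] verdict P w c′ ≡ just true
  guesses w c t ts r () done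
  guesses w c t ts r acc (step (here refl) p) = guesses w (false ∷ c) t _ (store-push d _ _ (suc zero) false ts r) acc p
  guesses w c t ts r acc (step (there (here refl)) p) = guesses w (true ∷ c) t _ (store-push d _ _ (suc zero) true ts r) acc p
  guesses w c t ts {s = s} {t′} {ts′} {o′} r acc (step (there (there (here refl))) p)
    with finish w c t ts r
  ... | l , ts₃ , o , l≤ , p₃ , p₄ with factor p₄ p (final s t′ ts′ o′ acc)
  ... | _ , p₅ = c , judged (verdict P w c) acc p₅

  rejects : ∀ w l → AcceptsIn machine l w → A w
  rejects w l (x , r , acc)
    with path-from w r
  ... | (s , t′ , ts′ , o′) , refl , p
    with setup w
  ... | t , ts , p₁ , r₁
    with subst (λ s → T (accepting s)) (dec-enc s) acc
  ... | acc′
    with factor p₁ p (final s t′ ts′ o′ acc′)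
  ... | _ , p₂ with guesses w [] t ts r₁ acc′ p₂
  ... | c , v = sound w c v

-- Terms and their words

-- Variables of any type: words for the terms that machines read and write, and positions relative
-- to a window for the fixed pieces of a tableau.
data Exp (V : Set) : Set where
  var      : V → Exp V
  zero one : Exp V
  not      : Exp V → Exp V
  and or   : Exp V → Exp V → Exp V

record Algebra {c} (A : Set c) : Set c where
  field
    zero# one# : A
    not#       : A → A
    and# or#   : A → A → A

module _ {c} {A : Set c} (𝔸 : Algebra A) where
  open Algebra 𝔸

  value : ∀ {V} → (V → A) → Exp V → A
  value ρ (var x)   = ρ x
  value ρ zero      = zero#
  value ρ one       = one#
  value ρ (not e)   = not# (value ρ e)
  value ρ (and e f) = and# (value ρ e) (value ρ f)
  value ρ (or e f)  = or# (value ρ e) (value ρ f)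

-- Variables are named by arbitrary words, via bijective base 2.
name : Word → Word
name []      = false ∷ []
name (b ∷ x) = true ∷ b ∷ name x

code : Exp Word → Word
code zero      = false ∷ false ∷ false ∷ []
code one       = false ∷ false ∷ true ∷ []
code (not e)   = code e ++ false ∷ true ∷ false ∷ []
code (and e f) = code e ++ code f ++ false ∷ true ∷ true ∷ []
code (or e f)  = code e ++ code f ++ true ∷ false ∷ false ∷ []
code (var x)   = true ∷ false ∷ true ∷ name x

toWord : ℕᵇ → Word
toWord ℕᵇ.zero  = []
toWord 2[1+ b ] = true ∷ toWord b
toWord 1+[2 b ] = false ∷ toWord b

fromWord : Word → ℕᵇ
fromWord []          = ℕᵇ.zero
fromWord (true ∷ x)  = 2[1+ fromWord x ]
fromWord (false ∷ x) = 1+[2 fromWord x ]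

toWord-fromWord : ∀ x → toWord (fromWord x) ≡ x
toWord-fromWord []          = refl
toWord-fromWord (true ∷ x)  = cong (true ∷_) (toWord-fromWord x)
toWord-fromWord (false ∷ x) = cong (false ∷_) (toWord-fromWord x)

fromWord-toWord : ∀ b → fromWord (toWord b) ≡ b
fromWord-toWord ℕᵇ.zero  = refl
fromWord-toWord 2[1+ b ] = cong 2[1+_] (fromWord-toWord b)
fromWord-toWord 1+[2 b ] = cong 1+[2_] (fromWord-toWord b)

digits-toWord : ∀ b → digits b ≡ name (toWord b)
digits-toWord ℕᵇ.zero  = refl
digits-toWord 2[1+ b ] = cong (λ w → true ∷ true ∷ w) (digits-toWord b)
digits-toWord 1+[2 b ] = cong (λ w → true ∷ false ∷ w) (digits-toWord b)

numeral : ℕ → Word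
numeral n = toWord (Binary.fromℕ n)

number : Word → ℕ
number x = Binary.toℕ (fromWord x)

number-numeral : ∀ n → number (numeral n) ≡ n
number-numeral n = trans (cong Binary.toℕ (fromWord-toWord (Binary.fromℕ n))) (BinaryP.toℕ-fromℕ n)

numeral-number : ∀ x → numeral (number x) ≡ x
numeral-number x = trans (cong toWord (BinaryP.fromℕ-toℕ (fromWord x))) (toWord-fromWord x)

fromTerm : ∀ {n} → Term n → Exp Word
fromTerm (var i)   = var (numeral (toℕ i))
fromTerm zero      = zero
fromTerm one       = one
fromTerm (not t)   = not (fromTerm t)
fromTerm (and s t) = and (fromTerm s) (fromTerm t)
fromTerm (or s t)  = or (fromTerm s) (fromTerm t)

code-fromTerm : ∀ {n} (t : Term n) → ⟨ t ⟩ ≡ code (fromTerm t)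
code-fromTerm (var i)   = cong (λ w → true ∷ false ∷ true ∷ w) (digits-toWord _)
code-fromTerm zero      = refl
code-fromTerm one       = refl
code-fromTerm (not t)   = cong (_++ _) (code-fromTerm t)
code-fromTerm (and s t) = cong₂ (λ u v → u ++ v ++ _) (code-fromTerm s) (code-fromTerm t)
code-fromTerm (or s t)  = cong₂ (λ u v → u ++ v ++ _) (code-fromTerm s) (code-fromTerm t)

bound : Exp Word → ℕ
bound (var x)   = suc (number x)
bound zero      = 0
bound one       = 0
bound (not e)   = bound e
bound (and e f) = bound e ⊔ₙ bound f
bound (or e f)  = bound e ⊔ₙ bound f

toTerm : ∀ n e → bound e ≤ n → ∃[ t ] fromTerm {n} t ≡ e
toTerm n (var x) h = var (Fin.fromℕ< h) ,
  cong var (trans (cong numeral (FinP.toℕ-fromℕ< h)) (numeral-number x))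
toTerm n zero    h = zero , refl
toTerm n one     h = one , refl
toTerm n (not e) h = Product.map not (cong not) (toTerm n e h)
toTerm n (and e f) h with toTerm n e (m⊔n≤o⇒m≤o _ _ h) | toTerm n f (m⊔n≤o⇒n≤o (bound e) _ h)
... | s , p | t , q = and s t , cong₂ and p q
toTerm n (or e f) h with toTerm n e (m⊔n≤o⇒m≤o _ _ h) | toTerm n f (m⊔n≤o⇒n≤o (bound e) _ h)
... | s , p | t , q = or s t , cong₂ or p q

-- Parsing postfix notation

readName : Word → Maybe (Word × Word)
readName []               = nothing
readName (false ∷ r)      = just ([] , r)
readName (true ∷ [])      = nothing
readName (true ∷ b ∷ r)   = Maybe.map (Product.map₁ (b ∷_)) (readName r)

readName-name : ∀ x r → readName (name x ++ r) ≡ just (x , r)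
readName-name []      r = refl
readName-name (b ∷ x) r rewrite readName-name x r = refl

readName-sound : ∀ w {x r} → readName w ≡ just (x , r) → w ≡ name x ++ r
readName-sound (false ∷ w) refl = refl
readName-sound (true ∷ b ∷ w) eq with readName w in e
readName-sound (true ∷ b ∷ w) refl | just (x , r) = cong (λ v → true ∷ b ∷ v) (readName-sound w e)

-- One evaluator for two purposes: over the syntax it shows unique decoding, over codes of elements
-- it specifies the main loop of the verifier.
module Parser {c} {A : Set c} (𝔸 : Algebra A) (ρ : Word → A) where
  open Algebra 𝔸

  State : Set c
  State = Word × List A

  token : Bool → Bool → Bool → Word → List A → Maybe State
  token false false false r vs           = just (r , zero# ∷ vs)
  token false false true  r vs           = just (r , one# ∷ vs)
  token false true  false r []           = nothing
  token false true  false r (v ∷ vs)     = just (r , not# v ∷ vs)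
  token false true  true  r (v ∷ u ∷ vs) = just (r , and# u v ∷ vs)
  token false true  true  r _            = nothing
  token true  false false r (v ∷ u ∷ vs) = just (r , or# u v ∷ vs)
  token true  false false r _            = nothing
  token true  false true  r vs           = Maybe.map (λ (x , r′) → r′ , ρ x ∷ vs) (readName r)
  token true  true  _     r vs           = nothing

  parse₁ : Word → List A → Maybe State
  -- An exhausted input idles, so rounds beyond the number of symbols do no harm.
  parse₁ []              vs = just ([] , vs)
  parse₁ (_ ∷ [])        vs = nothing
  parse₁ (_ ∷ _ ∷ [])    vs = nothing
  parse₁ (a ∷ b ∷ c ∷ r) vs = token a b c r vs

  parse : ℕ → Word → List A → Maybe State
  parse zero    r vs = just (r , vs)
  parse (suc m) r vs = maybe′ (λ (r′ , vs′) → parse m r′ vs′) nothing (parse₁ r vs)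

  parse-[] : ∀ m vs → parse m [] vs ≡ just ([] , vs)
  parse-[] zero    vs = refl
  parse-[] (suc m) vs = parse-[] m vs

  tokens : Exp Word → ℕ
  tokens (var _)   = 1
  tokens zero      = 1
  tokens one       = 1
  tokens (not e)   = tokens e + 1
  tokens (and e f) = tokens e + (tokens f + 1)
  tokens (or e f)  = tokens e + (tokens f + 1)

  tokens≤ : ∀ e → tokens e ≤ length (code e)
  tokens≤ (var x)   = s≤s z≤n
  tokens≤ zero      = s≤s z≤n
  tokens≤ one       = s≤s z≤n
  tokens≤ (not e)   = ≤-trans (+-mono-≤ (tokens≤ e) (s≤s z≤n)) (≤-reflexive (sym (length-++ (code e))))
  tokens≤ (and e f) = ≤-trans (+-mono-≤ (tokens≤ e)
    (≤-trans (+-mono-≤ (tokens≤ f) (s≤s z≤n)) (≤-reflexive (sym (length-++ (code f))))))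
    (≤-reflexive (sym (length-++ (code e))))
  tokens≤ (or e f)  = ≤-trans (+-mono-≤ (tokens≤ e)
    (≤-trans (+-mono-≤ (tokens≤ f) (s≤s z≤n)) (≤-reflexive (sym (length-++ (code f))))))
    (≤-reflexive (sym (length-++ (code e))))

  parse-code : ∀ e m r vs → parse (tokens e + m) (code e ++ r) vs ≡ parse m r (value 𝔸 ρ e ∷ vs)
  parse-code (var x)   m r vs rewrite readName-name x r = refl
  parse-code zero      m r vs = refl
  parse-code one       m r vs = refl
  parse-code (not e)   m r vs
    rewrite +-assoc (tokens e) 1 m | ++-assoc (code e) (false ∷ true ∷ false ∷ []) r =
    parse-code e (1 + m) (false ∷ true ∷ false ∷ r) vs
  parse-code (and e f) m r vs
    rewrite +-assoc (tokens e) (tokens f + 1) m | +-assoc (tokens f) 1 m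
          | ++-assoc (code e) (code f ++ false ∷ true ∷ true ∷ []) r | ++-assoc (code f) (false ∷ true ∷ true ∷ []) r =
    trans (parse-code e (tokens f + (1 + m)) (code f ++ false ∷ true ∷ true ∷ r) vs)
          (parse-code f (1 + m) (false ∷ true ∷ true ∷ r) _)
  parse-code (or e f)  m r vs
    rewrite +-assoc (tokens e) (tokens f + 1) m | +-assoc (tokens f) 1 m
          | ++-assoc (code e) (code f ++ true ∷ false ∷ false ∷ []) r | ++-assoc (code f) (true ∷ false ∷ false ∷ []) r =
    trans (parse-code e (tokens f + (1 + m)) (code f ++ true ∷ false ∷ false ∷ r) vs)
          (parse-code f (1 + m) (true ∷ false ∷ false ∷ r) _)

  parse-complete : ∀ e m → length (code e) ≤ m → parse m (code e) [] ≡ just ([] , value 𝔸 ρ e ∷ [])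
  parse-complete e m h = begin
    parse m (code e) []                                    ≡⟨ cong₂ (λ l w → parse l w [])
      (sym (m+[n∸m]≡n (≤-trans (tokens≤ e) h))) (sym (++-identityʳ (code e))) ⟩
    parse (tokens e + (m ∸ tokens e)) (code e ++ []) []    ≡⟨ parse-code e (m ∸ tokens e) [] [] ⟩
    parse (m ∸ tokens e) [] (value 𝔸 ρ e ∷ [])             ≡⟨ parse-[] (m ∸ tokens e) _ ⟩
    just ([] , value 𝔸 ρ e ∷ [])                           ∎
    where open ≡-Reasoning

  unparse : List (Exp Word) → Word
  unparse []       = []
  unparse (e ∷ es) = unparse es ++ code e

  -- The invariant behind soundness: the values on the stack belong to expressions whose codes,
  -- bottom first, make up the consumed part of the input.
  Reads : Word → State → List (Exp Word) → Set c
  Reads w (r , vs) es = vs ≡ List.map (value 𝔸 ρ) es × w ≡ unparse es ++ r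

  shift : ∀ es e r → unparse es ++ code e ++ r ≡ unparse (e ∷ es) ++ r
  shift es e r = sym (++-assoc (unparse es) (code e) r)

  binary : ∀ es e f k r → ((unparse es ++ code e) ++ code f) ++ k ++ r ≡ (unparse es ++ code e ++ code f ++ k) ++ r
  binary es e f k r = begin
    ((unparse es ++ code e) ++ code f) ++ k ++ r ≡⟨ ++-assoc (unparse es ++ code e) (code f) (k ++ r) ⟩
    (unparse es ++ code e) ++ code f ++ k ++ r   ≡⟨ ++-assoc (unparse es) (code e) _ ⟩
    unparse es ++ code e ++ code f ++ k ++ r     ≡⟨ cong (λ w → unparse es ++ code e ++ w) (++-assoc (code f) k r) ⟨
    unparse es ++ code e ++ (code f ++ k) ++ r   ≡⟨ cong (unparse es ++_) (++-assoc (code e) (code f ++ k) r) ⟨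
    unparse es ++ (code e ++ code f ++ k) ++ r   ≡⟨ ++-assoc (unparse es) (code e ++ code f ++ k) r ⟨
    (unparse es ++ code e ++ code f ++ k) ++ r   ∎
    where open ≡-Reasoning

  token-sound : ∀ a b c r vs {s w es} → token a b c r vs ≡ just s →
    Reads w (a ∷ b ∷ c ∷ r , vs) es → ∃[ es′ ] Reads w s es′
  token-sound false false false r vs {es = es} refl (refl , refl) = zero ∷ es , refl , shift es zero r
  token-sound false false true r vs {es = es} refl (refl , refl) = one ∷ es , refl , shift es one r
  token-sound false true false r (v ∷ vs) {es = e ∷ es} refl (refl , refl) = not e ∷ es , refl ,
    trans (++-assoc (unparse es) (code e) _)
      (trans (cong (unparse es ++_) (sym (++-assoc (code e) (false ∷ true ∷ false ∷ []) r))) (shift es (not e) r))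
  token-sound false true true r (v ∷ u ∷ vs) {es = f ∷ e ∷ es} refl (refl , refl) = and e f ∷ es , refl ,
    binary es e f (false ∷ true ∷ true ∷ []) r
  token-sound true false false r (v ∷ u ∷ vs) {es = f ∷ e ∷ es} refl (refl , refl) = or e f ∷ es , refl ,
    binary es e f (true ∷ false ∷ false ∷ []) r
  token-sound true false true r vs {es = es} eq (refl , refl) with readName r in e
  token-sound true false true r vs {es = es} refl (refl , refl) | just (x , r′) =
    var x ∷ es , refl , trans (cong (λ z → unparse es ++ true ∷ false ∷ true ∷ z) (readName-sound r e))
      (shift es (var x) r′)

  parse₁-sound : ∀ r vs {s w es} → parse₁ r vs ≡ just s → Reads w (r , vs) es → ∃[ es′ ] Reads w s es′
  parse₁-sound []              vs refl R = _ , R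
  parse₁-sound (a ∷ b ∷ c ∷ r) vs eq   R = token-sound a b c r vs eq R

  parse-sound : ∀ m r vs {s w es} → parse m r vs ≡ just s → Reads w (r , vs) es → ∃[ es′ ] Reads w s es′
  parse-sound zero    r vs refl R = _ , R
  parse-sound (suc m) r vs eq R with parse₁ r vs in e
  ... | just (r′ , vs′) with parse₁-sound r vs e R
  ... | _ , R′ = parse-sound m r′ vs′ eq R′

  parse-complete⁻¹ : ∀ m w v → parse m w [] ≡ just ([] , v ∷ []) → ∃[ e ] w ≡ code e × v ≡ value 𝔸 ρ e
  parse-complete⁻¹ m w v eq with parse-sound m w [] {es = []} eq (refl , refl)
  ... | e ∷ [] , refl , q = e , trans q (++-identityʳ (code e)) , refl

syntaxAlgebra : Algebra (Exp Word)
syntaxAlgebra = record { zero# = zero ; one# = one ; not# = not ; and# = and ; or# = or }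

value-syntax : ∀ e → value syntaxAlgebra var e ≡ e
value-syntax (var x)   = refl
value-syntax zero      = refl
value-syntax one       = refl
value-syntax (not e)   = cong not (value-syntax e)
value-syntax (and e f) = cong₂ and (value-syntax e) (value-syntax f)
value-syntax (or e f)  = cong₂ or (value-syntax e) (value-syntax f)

-- Membership of a word in the satisfiability problems only gives some expression with that code;
-- this identifies it with the tableau that was written.
code-injective : ∀ e f → code e ≡ code f → e ≡ f
code-injective e f eq with trans (sym (parse-complete e (length (code e)) ≤-refl))
    (trans (cong (λ w → parse (length (code e)) w []) eq) (parse-complete f (length (code e)) (≤-reflexive (cong length (sym eq)))))
  where open Parser syntaxAlgebra var
... | q = trans (sym (value-syntax e)) (trans (head-≡ q) (value-syntax f))
  where
  head-≡ : ∀ {r : Word} {u v : Exp Word} →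
    _≡_ {A = Maybe (Word × List (Exp Word))} (just (r , u ∷ [])) (just (r , v ∷ [])) → u ≡ v
  head-≡ refl = refl

-- Ortholattices of height two

_==_ : Bool → Bool → Bool
true  == b = b
false == b = ¬ᵇ b

==-true : ∀ a b → (a == b) ≡ true → a ≡ b
==-true true  b     e = sym e
==-true false false e = refl

==-refl : ∀ a → (a == a) ≡ true
==-refl true  = refl
==-refl false = refl

same : Word → Word → Bool
same []      []      = true
same (a ∷ u) (b ∷ v) = (a == b) ∧ same u v
same _       _       = false

same-true : ∀ u v → same u v ≡ true → u ≡ v
same-true []      []      e = refl
same-true (a ∷ u) (b ∷ v) e with a == b in p
... | true = cong₂ _∷_ (==-true a b p) (same-true u v e)

same-refl : ∀ u → same u u ≡ true
same-refl []      = refl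
same-refl (a ∷ u) rewrite ==-refl a = same-refl u

boolAlgebra : Algebra Bool
boolAlgebra = record { zero# = false ; one# = true ; not# = ¬ᵇ_ ; and# = _∧_ ; or# = _∨_ }

-- (false , b) stands for the constant b, (true , true) for an atom and
-- (true , false) for its complement; the word of an element tells which atom.
Kind : Set
Kind = Bool × Bool

Element : Set
Element = Kind × Word

neg : Kind → Kind
neg (k , s) = k , ¬ᵇ s

-- The second component tells whether the word is inherited from the first
-- argument.
meet : Kind → Kind → Bool → Kind × Bool
meet (false , false) _               _ = (false , false) , true
meet (false , true)  y               _ = y , false
meet (true , s)      (false , false) _ = (false , false) , true
meet (true , s)      (false , true)  _ = (true , s) , true
meet (true , s)      (true , s′)     e = (if e ∧ (s == s′) then (true , s) else (false , false)) , true

join : Kind → Kind → Bool → Kind × Bool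
join x y e = Product.map₁ neg (meet (neg x) (neg y) e)

combine : (Kind → Kind → Bool → Kind × Bool) → Element → Element → Element
combine f (x , u) (y , v) = proj₁ r , (if proj₂ r then u else v)
  where r = f x y (same u v)

elementAlgebra : Word → Algebra Element
elementAlgebra o = record
  { zero# = (false , false) , o ; one# = (false , true) , o
  ; not# = Product.map₁ neg ; and# = combine meet ; or# = combine join }

-- A truth assignment to the elements that respects complements: the atoms, or
-- all their complements, are made true.
truth : Bool → Kind → Bool
truth s (false , b)  = b
truth s (true , s′) = s == s′

forAll : ∀ n → (Vec Bool n → Bool) → Bool
forAll zero    f = f []
forAll (suc n) f = forAll n (f ∘ (false ∷_)) ∧ forAll n (f ∘ (true ∷_))

∧-true : ∀ {a b} → a ∧ b ≡ true → a ≡ true × b ≡ true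
∧-true {true} e = refl , e

-- Proof by truth table: for a concrete `f` the premise holds by `refl`, all rows being evaluated.
exhaust : ∀ n f → forAll n f ≡ true → ∀ v → f v ≡ true
exhaust zero    f e []          = e
exhaust (suc n) f e (false ∷ v) = exhaust n _ (proj₁ (∧-true e)) v
exhaust (suc n) f e (true ∷ v)  = exhaust n _ (proj₂ (∧-true {forAll n (f ∘ (false ∷_))} e)) v

modus-ponens : ∀ {a b} → ¬ᵇ a ∨ b ≡ true → a ≡ true → b ≡ true
modus-ponens e refl = e

-- One direction only, since two distinct true atoms meet in 0. The table leaves the comparison bit
-- `e` free, so nothing about words enters.
truth-meet : ∀ s x y e → truth s (proj₁ (meet x y e)) ≡ true → truth s x ∧ truth s y ≡ true
truth-meet s (k , a) (l , b) e =
  modus-ponens (exhaust 6 check refl (s ∷ k ∷ a ∷ l ∷ b ∷ e ∷ []))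
  where
  check : Vec Bool 6 → Bool
  check (s ∷ k ∷ a ∷ l ∷ b ∷ e ∷ []) =
    ¬ᵇ truth s (proj₁ (meet (k , a) (l , b) e)) ∨ (truth s (k , a) ∧ truth s (l , b))

-- Joins of noncommuting atoms can be true although both atoms are false, but
-- the two joinands of a Shannon expansion commute.
truth-shannon : ∀ s x y z d e f →
  truth s (proj₁ (join (proj₁ (meet x y d)) (proj₁ (meet (neg x) z e)) f)) ≡ true →
  (truth s x ∧ truth s y) ∨ (¬ᵇ truth s x ∧ truth s z) ≡ true
truth-shannon s (k , a) (l , b) (m , c) d e f =
  modus-ponens (exhaust 10 check refl (s ∷ k ∷ a ∷ l ∷ b ∷ m ∷ c ∷ d ∷ e ∷ f ∷ []))
  where
  check : Vec Bool 10 → Bool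
  check (s ∷ k ∷ a ∷ l ∷ b ∷ m ∷ c ∷ d ∷ e ∷ f ∷ []) =
    ¬ᵇ truth s (proj₁ (join (proj₁ (meet x y d)) (proj₁ (meet (neg x) z e)) f)) ∨
      ((truth s x ∧ truth s y) ∨ (¬ᵇ truth s x ∧ truth s z))
    where
    x = k , a
    y = l , b
    z = m , c

-- A one-sided transfer from codes to Booleans, preserved by conjunctions and Shannon expansions. A
-- plain `or` does not preserve it, because two false atoms from different pairs join to 1; nor does
-- `not`, because two true ones meet in 0, whose complement is true.
Safe : Exp Word → Set
Safe e = ∀ o ρ s → truth s (proj₁ (value (elementAlgebra o) ρ e)) ≡ true →
  value boolAlgebra (truth s ∘ proj₁ ∘ ρ) e ≡ true

∧-intro : ∀ {a b} → a ≡ true → b ≡ true → a ∧ b ≡ true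
∧-intro refl refl = refl

safe-and : ∀ {e f} → Safe e → Safe f → Safe (and e f)
safe-and {e} {f} p q o ρ s h
  with ∧-true (truth-meet s (proj₁ (value (elementAlgebra o) ρ e)) (proj₁ (value (elementAlgebra o) ρ f)) _ h)
... | h₁ , h₂ = ∧-intro (p o ρ s h₁) (q o ρ s h₂)

shannon : ∀ {V} → V → Exp V → Exp V → Exp V
shannon x e f = or (and (var x) e) (and (not (var x)) f)

safe-shannon : ∀ x {e f} → Safe e → Safe f → Safe (shannon x e f)
safe-shannon x {e} {f} p q o ρ s h
  with truth s (proj₁ (ρ x)) | truth-shannon s (proj₁ (ρ x)) (proj₁ (value (elementAlgebra o) ρ e))
    (proj₁ (value (elementAlgebra o) ρ f)) _ _ _ h
... | true  | h′ = ∨-introˡ (p o ρ s (∨-false h′))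
  where
  ∨-introˡ : ∀ {a} → a ≡ true → a ∨ false ≡ true
  ∨-introˡ refl = refl
  ∨-false : ∀ {a} → a ∨ false ≡ true → a ≡ true
  ∨-false {true} e = refl
... | false | h′ = q o ρ s h′

-- Padding with falses gives all names of atoms the same length `m`, so that comparing and moving
-- them takes a fixed number of rounds.
unary : ∀ {m} → Fin (suc m) → Word
unary {zero}  zero    = []
unary {suc m} zero    = false ∷ unary {m} zero
unary {suc m} (suc i) = true ∷ unary i

index : ∀ m → Word → Fin (suc m)
index zero    u           = zero
index (suc m) (true ∷ u)  = suc (index m u)
index (suc m) _           = zero

index-unary : ∀ {m} (i : Fin (suc m)) → index m (unary i) ≡ i
index-unary {zero}  zero    = refl
index-unary {suc m} zero    = refl
index-unary {suc m} (suc i) = cong suc (index-unary i)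

length-unary : ∀ {m} (i : Fin (suc m)) → length (unary i) ≡ m
length-unary {zero}  zero    = refl
length-unary {suc m} zero    = cong suc (length-unary {m} zero)
length-unary {suc m} (suc i) = cong suc (length-unary i)

unary-zero : ∀ m → replicate m false ≡ unary {m} zero
unary-zero zero    = refl
unary-zero (suc m) = cong (false ∷_) (unary-zero m)

Unary : ℕ → Word → Set
Unary m u = ∃[ i ] u ≡ unary {m} i

variables : Exp Word → List Word
variables (var x)   = x ∷ []
variables zero      = []
variables one       = []
variables (not e)   = variables e
variables (and e f) = variables e ++ variables f
variables (or e f)  = variables e ++ variables f

module HeightTwo {c ℓ₁ ℓ₂} (em : ExcludedMiddle (c ⊔ ℓ₁ ⊔ ℓ₂))
  (L : Ortholattice c ℓ₁ ℓ₂) (modular : Modular L) (height : HasHeight L 2) where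

  open Ortholattice L renaming (_∧_ to _⊓_; _∨_ to _⊔ₗ_; trans to ⊑-trans; refl to ⊑-refl)
  open Ortholattice L using () renaming (reflexive to ⊑-reflexive)
  open Eq using () renaming (refl to ≈-refl; sym to ≈-sym; trans to ≈-trans)

  lem : (P : Set (c ⊔ ℓ₁)) → Dec P
  lem P with em {Level.Lift ℓ₂ P}
  ... | yes (Level.lift p) = yes p
  ... | no ¬p = no (λ p → ¬p (Level.lift p))

  _≈?_ : ∀ x y → Dec (x ≈ y)
  x ≈? y with lem (Level.Lift c (x ≈ y))
  ... | yes (Level.lift p) = yes p
  ... | no ¬p = no (λ p → ¬p (Level.lift p))

  ≈0 : ∀ {x} → x ⊑ 0# → x ≈ 0#
  ≈0 p = antisym p (minimum _)

  ≈1 : ∀ {x} → 1# ⊑ x → x ≈ 1#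
  ≈1 p = antisym (maximum _) p

  ⊓-cong : ∀ {x x′ y y′} → x ≈ x′ → y ≈ y′ → x ⊓ y ≈ x′ ⊓ y′
  ⊓-cong p q = antisym
    (∧-greatest (⊑-trans (x∧y≤x _ _) (⊑-reflexive p)) (⊑-trans (x∧y≤y _ _) (⊑-reflexive q)))
    (∧-greatest (⊑-trans (x∧y≤x _ _) (⊑-reflexive (≈-sym p))) (⊑-trans (x∧y≤y _ _) (⊑-reflexive (≈-sym q))))

  ∼-cong : ∀ {x y} → x ≈ y → ∼ x ≈ ∼ y
  ∼-cong p = antisym (∼-antitone (⊑-reflexive (≈-sym p))) (∼-antitone (⊑-reflexive p))

  ⊓-comm : ∀ x y → x ⊓ y ≈ y ⊓ x
  ⊓-comm x y = antisym (∧-greatest (x∧y≤y x y) (x∧y≤x x y)) (∧-greatest (x∧y≤y y x) (x∧y≤x y x))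

  ⊑⇒⊓ : ∀ {x y} → x ⊑ y → x ⊓ y ≈ x
  ⊑⇒⊓ p = antisym (x∧y≤x _ _) (∧-greatest ⊑-refl p)

  ⊓-identityˡ : ∀ x → 1# ⊓ x ≈ x
  ⊓-identityˡ x = ≈-trans (⊓-comm 1# x) (⊑⇒⊓ (maximum x))

  ⊓-zeroˡ : ∀ x → 0# ⊓ x ≈ 0#
  ⊓-zeroˡ x = ≈0 (x∧y≤x 0# x)

  ∼1≈0 : ∼ 1# ≈ 0#
  ∼1≈0 = ≈-trans (≈-sym (⊓-identityˡ (∼ 1#))) (∧-complement 1#)

  ∼0≈1 : ∼ 0# ≈ 1#
  ∼0≈1 = ≈-trans (∼-cong (≈-sym ∼1≈0)) (∼-involutive 1#)

  deMorgan : ∀ x y → x ⊔ₗ y ≈ ∼ (∼ x ⊓ ∼ y)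
  deMorgan x y = antisym
    (∨-least (⊑-trans (⊑-reflexive (≈-sym (∼-involutive x))) (∼-antitone (x∧y≤x _ _)))
             (⊑-trans (⊑-reflexive (≈-sym (∼-involutive y))) (∼-antitone (x∧y≤y _ _))))
    (⊑-trans (∼-antitone (∧-greatest (∼-antitone (x≤x∨y x y)) (∼-antitone (y≤x∨y x y))))
             (⊑-reflexive (∼-involutive _)))

  γ : Fin 3 → Carrier
  γ = proj₁ height

  chain : ∀ {i j} → i Fin.< j → γ i ⊏ γ j
  chain = proj₁ (proj₂ height)

  maximal : ∀ x → (∀ i → x ⊑ γ i ⊎ γ i ⊑ x) → ∃[ i ] x ≈ γ i
  maximal = proj₂ (proj₂ height)

  -- Being comparable with everything, 0 occurs on the maximal chain, whose lowest member lies below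
  -- all others.
  bottom : γ 0F ≈ 0#
  bottom with maximal 0# (λ i → inj₁ (minimum (γ i)))
  ... | 0F , p = ≈-sym p
  ... | 1F , p = ≈0 (⊑-trans (proj₁ (chain {0F} {1F} (s≤s z≤n))) (⊑-reflexive (≈-sym p)))
  ... | 2F , p = ≈0 (⊑-trans (proj₁ (chain {0F} {2F} (s≤s z≤n))) (⊑-reflexive (≈-sym p)))

  top : γ 2F ≈ 1#
  top with maximal 1# (λ i → inj₂ (maximum (γ i)))
  ... | 0F , p = ≈1 (⊑-trans (⊑-reflexive p) (proj₁ (chain {0F} {2F} (s≤s z≤n))))
  ... | 1F , p = ≈1 (⊑-trans (⊑-reflexive p) (proj₁ (chain {1F} {2F} (s≤s (s≤s z≤n)))))
  ... | 2F , p = ≈-sym p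

  a : Carrier
  a = γ 1F

  a≉0 : ¬ a ≈ 0#
  a≉0 p = proj₂ (chain {0F} {1F} (s≤s z≤n)) (≈-trans bottom (≈-sym p))

  a≉1 : ¬ a ≈ 1#
  a≉1 p = proj₂ (chain {1F} {2F} (s≤s (s≤s z≤n))) (≈-trans p (≈-sym top))

  comparable-a : ∀ x → x ⊑ a ⊎ a ⊑ x → x ≈ 0# ⊎ x ≈ a ⊎ x ≈ 1#
  comparable-a x h with maximal x compare
    where
    compare : ∀ i → x ⊑ γ i ⊎ γ i ⊑ x
    compare 0F = inj₂ (⊑-trans (⊑-reflexive bottom) (minimum x))
    compare 1F = h
    compare 2F = inj₁ (⊑-trans (maximum x) (⊑-reflexive (≈-sym top)))
  ... | 0F , p = inj₁ (≈-trans p bottom)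
  ... | 1F , p = inj₂ (inj₁ p)
  ... | 2F , p = inj₂ (inj₂ (≈-trans p top))

  below-a : ∀ {x} → x ⊑ a → x ≈ 0# ⊎ x ≈ a
  below-a {x} h with comparable-a x (inj₁ h)
  ... | inj₁ p = inj₁ p
  ... | inj₂ (inj₁ p) = inj₂ p
  ... | inj₂ (inj₂ p) = ⊥-elim (a≉1 (≈1 (⊑-trans (⊑-reflexive (≈-sym p)) h)))

  above-a : ∀ {x} → a ⊑ x → x ≈ a ⊎ x ≈ 1#
  above-a {x} h with comparable-a x (inj₂ h)
  ... | inj₁ p = ⊥-elim (a≉0 (≈0 (⊑-trans h (⊑-reflexive p))))
  ... | inj₂ p = p

  Proper : Carrier → Set ℓ₁
  Proper x = ¬ x ≈ 0# × ¬ x ≈ 1#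

  -- The modular law excludes a pentagon: if `a ⊓ y` is 0 and `a ⊔ₗ x` is 1, then `y` equals
  -- `y ⊓ (a ⊔ₗ x)`, hence `(y ⊓ a) ⊔ₗ x`, hence `x`. In the other cases `x` or `y` is comparable
  -- with `a` and the maximal chain decides.
  proper-≈ : ∀ {x y} → Proper x → Proper y → x ⊑ y → x ≈ y
  proper-≈ {x} {y} (x≉0 , x≉1) (y≉0 , y≉1) h with below-a (x∧y≤x a y)
  ... | inj₂ p with above-a (⊑-trans (⊑-reflexive (≈-sym p)) (x∧y≤y a y))
  ...   | inj₂ q = ⊥-elim (y≉1 q)
  ...   | inj₁ q with below-a (⊑-trans h (⊑-reflexive q))
  ...     | inj₁ r = ⊥-elim (x≉0 r)
  ...     | inj₂ r = ≈-trans r (≈-sym q)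
  proper-≈ {x} {y} (x≉0 , x≉1) (y≉0 , y≉1) h | inj₁ p with above-a (x≤x∨y a x)
  ... | inj₁ q with below-a (⊑-trans (y≤x∨y a x) (⊑-reflexive q))
  ...   | inj₁ r = ⊥-elim (x≉0 r)
  ...   | inj₂ r = ⊥-elim (a≉0 (≈-trans (≈-sym (⊑⇒⊓ (⊑-trans (⊑-reflexive (≈-sym r)) h))) p))
  proper-≈ {x} {y} (x≉0 , x≉1) (y≉0 , y≉1) h | inj₁ p | inj₂ q = antisym h
    (⊑-trans (∧-greatest ⊑-refl (⊑-trans (maximum y) (⊑-reflexive (≈-sym q))))
    (⊑-trans (⊑-reflexive (modular y a x h))
             (∨-least (⊑-trans (⊑-reflexive (≈-trans (⊓-comm y a) p)) (minimum x)) ⊑-refl)))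

  -- Otherwise the meet would be proper, hence equal to both `x` and `y`.
  proper-⊓ : ∀ {x y} → Proper x → Proper y → ¬ x ≈ y → x ⊓ y ≈ 0#
  proper-⊓ {x} {y} px py x≉y with (x ⊓ y) ≈? 0#
  ... | yes p = p
  ... | no q = ⊥-elim (x≉y (proper-≈ px py (⊑-trans (⊑-reflexive (≈-sym (proper-≈ pm px (x∧y≤x x y)))) (x∧y≤y x y))))
    where
    pm : Proper (x ⊓ y)
    pm = q , λ p → proj₂ px (≈1 (⊑-trans (⊑-reflexive (≈-sym p)) (x∧y≤x x y)))

  proper-∼ : ∀ {x} → Proper x → Proper (∼ x)
  proper-∼ {x} (p , q) =
    (λ r → q (≈-trans (≈-sym (∼-involutive x)) (≈-trans (∼-cong r) ∼0≈1))) ,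
    (λ r → p (≈-trans (≈-sym (∼-involutive x)) (≈-trans (∼-cong r) ∼1≈0)))

  latticeAlgebra : Algebra Carrier
  latticeAlgebra = record { zero# = 0# ; one# = 1# ; not# = ∼_ ; and# = _⊓_ ; or# = _⊔ₗ_ }

  Covered : ∀ {m} → Vec Carrier m → Carrier → Set ℓ₁
  Covered F x = x ≈ 0# ⊎ x ≈ 1# ⊎ ∃[ i ] (x ≈ lookup F i ⊎ x ≈ ∼ lookup F i)

  -- Pairwise noncommuting atoms.
  data Independent : ∀ {m} → Vec Carrier m → Set (c ⊔ ℓ₁) where
    []  : Independent []
    _∷_ : ∀ {m x} {F : Vec Carrier m} → ¬ Covered F x → Independent F → Independent (x ∷ F)

  independent-proper : ∀ {m} {F : Vec Carrier m} → Independent F → ∀ i → Proper (lookup F i)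
  independent-proper (p ∷ _) zero    = p ∘ inj₁ , p ∘ inj₂ ∘ inj₁
  independent-proper (_ ∷ I) (suc i) = independent-proper I i

  sign : Bool → Carrier → Carrier
  sign true  x = x
  sign false x = ∼ x

  sign-not : ∀ s x → sign (¬ᵇ s) x ≈ ∼ sign s x
  sign-not true  x = ≈-refl
  sign-not false x = ≈-sym (∼-involutive x)

  sign-proper : ∀ s {x} → Proper x → Proper (sign s x)
  sign-proper true  p = p
  sign-proper false p = proper-∼ p

  covered-sign : ∀ {m} {F : Vec Carrier m} {x} s s′ j → sign s x ≈ sign s′ (lookup F j) → Covered F x
  covered-sign true  true  j p = inj₂ (inj₂ (j , inj₁ p))
  covered-sign true  false j p = inj₂ (inj₂ (j , inj₂ p))
  covered-sign false true  j p = inj₂ (inj₂ (j , inj₂ (≈-trans (≈-sym (∼-involutive _)) (∼-cong p))))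
  covered-sign false false j p = inj₂ (inj₂ (j , inj₁
    (≈-trans (≈-sym (∼-involutive _)) (≈-trans (∼-cong p) (∼-involutive _)))))

  independent-≉ : ∀ {m} {F : Vec Carrier m} → Independent F → ∀ s s′ i j →
    sign s (lookup F i) ≈ sign s′ (lookup F j) → i ≡ j
  independent-≉ (p ∷ I) s s′ zero    zero    e = refl
  independent-≉ {F = _ ∷ F} (p ∷ I) s s′ zero (suc j) e = ⊥-elim (p (covered-sign {F = F} s s′ j e))
  independent-≉ {F = _ ∷ F} (p ∷ I) s s′ (suc i) zero e = ⊥-elim (p (covered-sign {F = F} s′ s i (≈-sym e)))
  independent-≉ (p ∷ I) s s′ (suc i) (suc j) e = cong suc (independent-≉ I s s′ i j e)

  module Interpretation {m} (F : Vec Carrier (suc m)) (I : Independent F) where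

    atom : Word → Carrier
    atom u = lookup F (index m u)

    interpret : Element → Carrier
    interpret ((k , s) , u) = sign s (if k then atom u else 1#)

    Good : Element → Set
    Good (_ , u) = Unary m u

    interpret-neg : ∀ x u → interpret (neg x , u) ≈ ∼ interpret (x , u)
    interpret-neg (k , s) u = sign-not s _

    -- Different names denote atoms from different pairs. Equal names with different signs denote an
    -- atom and its complement, and an element equal to its complement would be 0.
    distinct : ∀ s s′ {u v} → Unary m u → Unary m v → same u v ∧ (s == s′) ≡ false →
      ¬ sign s (atom u) ≈ sign s′ (atom v)
    distinct s s′ (i , refl) (j , refl) e p rewrite index-unary i | index-unary j
      with independent-≉ I s s′ i j p
    ... | refl rewrite same-refl (unary i) = opposite s s′ e p
      where
      proper = independent-proper I i
      x = lookup F i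
      no-fixpoint : ¬ x ≈ ∼ x
      no-fixpoint q = proj₁ proper (≈-trans (≈-sym (⊑⇒⊓ (⊑-reflexive q))) (∧-complement x))
      opposite : ∀ s s′ → (s == s′) ≡ false → ¬ sign s x ≈ sign s′ x
      opposite true  false e q = no-fixpoint q
      opposite false true  e q = no-fixpoint (≈-sym q)

    interpret-meet : ∀ x y u v → Unary m u → Unary m v →
      interpret (combine meet (x , u) (y , v)) ≈ interpret (x , u) ⊓ interpret (y , v)
    interpret-meet (false , false) y u v p q = ≈-trans ∼1≈0 (≈-sym (≈-trans (⊓-cong ∼1≈0 ≈-refl) (⊓-zeroˡ _)))
    interpret-meet (false , true)  y u v p q = ≈-sym (⊓-identityˡ _)
    interpret-meet (true , s) (false , false) u v p q =
      ≈-trans ∼1≈0 (≈-sym (≈-trans (⊓-comm _ _) (≈-trans (⊓-cong ∼1≈0 ≈-refl) (⊓-zeroˡ _))))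
    interpret-meet (true , s) (false , true)  u v p q = ≈-sym (≈-trans (⊓-comm _ _) (⊓-identityˡ _))
    interpret-meet (true , s) (true , s′)     u v p q with same u v ∧ (s == s′) in e
    ... | true with ∧-true {same u v} e
    ...   | e₁ , e₂ rewrite same-true u v e₁ | ==-true s s′ e₂ = ≈-sym (⊑⇒⊓ ⊑-refl)
    interpret-meet (true , s) (true , s′)     u v p q | false =
      ≈-trans ∼1≈0 (≈-sym (proper-⊓ (sign-proper s (independent-proper I _))
        (sign-proper s′ (independent-proper I _)) (distinct s s′ p q e)))

    interpret-join : ∀ x y u v → Unary m u → Unary m v →
      interpret (combine join (x , u) (y , v)) ≈ interpret (x , u) ⊔ₗ interpret (y , v)
    interpret-join x y u v p q = begin
      interpret (combine join (x , u) (y , v))              ≈⟨ interpret-neg (proj₁ r) (if proj₂ r then u else v) ⟩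
      ∼ interpret (combine meet (neg x , u) (neg y , v))    ≈⟨ ∼-cong (interpret-meet (neg x) (neg y) u v p q) ⟩
      ∼ (interpret (neg x , u) ⊓ interpret (neg y , v))     ≈⟨ ∼-cong (⊓-cong (interpret-neg x u) (interpret-neg y v)) ⟩
      ∼ (∼ interpret (x , u) ⊓ ∼ interpret (y , v))         ≈⟨ deMorgan _ _ ⟨
      interpret (x , u) ⊔ₗ interpret (y , v)                ∎
      where
      open import Relation.Binary.Reasoning.Setoid setoid
      r = meet (neg x) (neg y) (same u v)

    origin : Word
    origin = replicate m false

    elements : Algebra Element
    elements = elementAlgebra origin

    good-combine : ∀ f x y → Good x → Good y → Good (combine f x y)
    good-combine f (x , u) (y , v) p q with proj₂ (f x y (same u v))
    ... | true  = p
    ... | false = q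

    module _ (κ : Word → Element) (κ-good : ∀ x → Good (κ x)) where

      kind : Exp Word → Kind
      kind e = proj₁ (value elements κ e)

      word : Exp Word → Word
      word e = proj₂ (value elements κ e)

      good-value : ∀ e → Good (value elements κ e)
      good-value (var x)   = κ-good x
      good-value zero      = zero , unary-zero m
      good-value one       = zero , unary-zero m
      good-value (not e)   = good-value e
      good-value (and e f) = good-combine meet (value elements κ e) (value elements κ f) (good-value e) (good-value f)
      good-value (or e f)  = good-combine join (value elements κ e) (value elements κ f) (good-value e) (good-value f)

      -- Agreement is asked for the occurring variables only, since a certificate need not describe
      -- any others.
      interpret-value : ∀ (ρ : Word → Carrier) e → (∀ x → x ∈ variables e → interpret (κ x) ≈ ρ x) →
        interpret (value elements κ e) ≈ value latticeAlgebra ρ e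
      interpret-value ρ (var x)   h = h x (here refl)
      interpret-value ρ zero      h = ∼1≈0
      interpret-value ρ one       h = ≈-refl
      interpret-value ρ (not e)   h = ≈-trans (interpret-neg (kind e) (word e)) (∼-cong (interpret-value ρ e h))
      interpret-value ρ (and e f) h = ≈-trans
        (interpret-meet (kind e) (kind f) (word e) (word f) (good-value e) (good-value f))
        (⊓-cong (interpret-value ρ e (λ x → h x ∘ ∈-++⁺ˡ)) (interpret-value ρ f (λ x → h x ∘ ∈-++⁺ʳ (variables e))))
      interpret-value ρ (or e f)  h = ≈-trans
        (interpret-join (kind e) (kind f) (word e) (word f) (good-value e) (good-value f)) (≈-trans (deMorgan _ _) (≈-trans
        (∼-cong (⊓-cong (∼-cong (interpret-value ρ e (λ x → h x ∘ ∈-++⁺ˡ)))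
                        (∼-cong (interpret-value ρ f (λ x → h x ∘ ∈-++⁺ʳ (variables e))))))
        (≈-sym (deMorgan _ _))))

    element-of : ∀ x → Covered F x → ∃[ y ] Good y × interpret y ≈ x
    element-of x (inj₁ p)                      = ((false , false) , origin) , (zero , unary-zero m) , ≈-trans ∼1≈0 (≈-sym p)
    element-of x (inj₂ (inj₁ p))               = ((false , true) , origin) , (zero , unary-zero m) , ≈-sym p
    element-of x (inj₂ (inj₂ (i , inj₁ p)))    = ((true , true) , unary i) , (i , refl) ,
      ≈-sym (≈-trans p (Eq.reflexive (cong (lookup F) (sym (index-unary i)))))
    element-of x (inj₂ (inj₂ (i , inj₂ p)))    = ((true , false) , unary i) , (i , refl) ,
      ≈-sym (≈-trans p (Eq.reflexive (cong (∼_ ∘ lookup F) (sym (index-unary i)))))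

    represent : (ρ : Word → Carrier) → ∃[ κ ] (∀ x → Good (κ x)) × (∀ x → Covered F (ρ x) → interpret (κ x) ≈ ρ x)
    represent ρ = (λ x → proj₁ (choice x)) , (λ x → proj₁ (proj₂ (choice x))) , (λ x → proj₂ (proj₂ (choice x)))
      where
      choice : ∀ x → ∃[ y ] Good y × (Covered F (ρ x) → interpret y ≈ ρ x)
      choice x with lem (Level.Lift c (Covered F (ρ x)))
      ... | yes (Level.lift p) = let (y , g , e) = element-of (ρ x) p in y , g , λ _ → e
      -- A placeholder: nothing is claimed about values that the family does not cover.
      ... | no ¬p = ((false , false) , origin) , (zero , unary-zero m) , λ p → ⊥-elim (¬p (Level.lift p))

  covered? : ∀ {m} (F : Vec Carrier m) x → Dec (Covered F x)
  covered? F x with lem (Level.Lift c (Covered F x))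
  ... | yes (Level.lift p) = yes p
  ... | no ¬p = no (λ p → ¬p (Level.lift p))

  covered-∷ : ∀ {m} {F : Vec Carrier m} y {x} → Covered F x → Covered (y ∷ F) x
  covered-∷ y (inj₁ p)                = inj₁ p
  covered-∷ y (inj₂ (inj₁ p))         = inj₂ (inj₁ p)
  covered-∷ y (inj₂ (inj₂ (i , p)))   = inj₂ (inj₂ (suc i , p))

  -- Greedy choice: a value not covered so far joins the family, which thus grows by at most one
  -- atom per value.
  grow : ∀ (vs : List Carrier) {m} (F : Vec Carrier (suc m)) → Independent F →
    ∃[ m′ ] m′ ≤ length vs + m × Σ (Vec Carrier (suc m′)) λ F′ →
    Independent F′ × (∀ x → Covered F x → Covered F′ x) × (∀ x → x ∈ vs → Covered F′ x)
  grow []       {m} F I = m , ≤-refl , F , I , (λ _ p → p) , λ _ ()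
  grow (v ∷ vs) {m} F I with covered? F v
  ... | yes p with grow vs F I
  ...   | m′ , m′≤ , F′ , I′ , old , new = m′ , m≤n⇒m≤1+n m′≤ , F′ , I′ , old ,
    λ { x (here refl) → old v p ; x (there q) → new x q }
  grow (v ∷ vs) {m} F I | no p with grow vs (v ∷ F) (p ∷ I)
  ... | m′ , m′≤ , F′ , I′ , old , new = m′ , ≤-trans m′≤ (≤-reflexive (+-suc (length vs) m)) , F′ , I′ ,
    (λ x → old x ∘ covered-∷ v) ,
    λ { x (here refl) → old v (inj₂ (inj₂ (zero , inj₁ ≈-refl))) ; x (there q) → new x q }

  singleton : Independent (a ∷ [])
  singleton = (λ { (inj₁ p) → a≉0 p ; (inj₂ (inj₁ p)) → a≉1 p ; (inj₂ (inj₂ (() , _))) }) ∷ []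

  family : ∀ (vs : List Carrier) → ∃[ m ] m ≤ length vs × Σ (Vec Carrier (suc m)) λ F →
    Independent F × (∀ x → x ∈ vs → Covered F x)
  family vs with grow vs (a ∷ []) singleton
  ... | m , m≤ , F , I , _ , new = m , ≤-trans m≤ (≤-reflexive (+-identityʳ _)) , F , I , new

  -- With finitely many blocks {x , ∼ x} a fixed number of names suffices;
  -- otherwise as many independent atoms as wanted are available.
  Names : Polynomial → Set (c ⊔ ℓ₁)
  Names W = ∀ n (vs : List Carrier) → length vs ≤ n →
    Σ (Vec Carrier (suc (⟦ W ⟧ n))) λ F → Independent F × (∀ x → x ∈ vs → Covered F x)

  -- The width must be exact. With too few atoms some values have no code; with too many names the
  -- verifier would tell words apart although no distinct pairs of atoms exist for them to denote.
  names : ∃[ W ] Names W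
  names with lem (∃[ m ] Σ (Vec Carrier (suc m)) λ F → Independent F × (∀ x → Covered F x))
  ... | yes (m , F , I , all) = const m , λ n vs _ → F , I , λ x _ → all x
  ... | no ¬finite = X , λ n vs h → let (m , m≤ , F , I , cov) = family vs in
    pad (n ∸ m) F I (m∸n+n≡m (≤-trans m≤ h)) (λ x → cov x)
    where
    extend : ∀ {m} (F : Vec Carrier (suc m)) → Independent F → ∃[ x ] ¬ Covered F x
    extend F I with lem (∃[ x ] ¬ Covered F x)
    ... | yes p = p
    ... | no ¬p = ⊥-elim (¬finite (_ , F , I , total))
      where
      total : ∀ x → Covered F x
      total x with covered? F x
      ... | yes p = p
      ... | no q = ⊥-elim (¬p (x , q))
    pad : ∀ k {m n vs} (F : Vec Carrier (suc m)) → Independent F → k + m ≡ n → (∀ x → x ∈ vs → Covered F x) →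
      Σ (Vec Carrier (suc n)) λ F → Independent F × (∀ x → x ∈ vs → Covered F x)
    pad zero    F I refl cov = F , I , cov
    pad (suc k) {m} F I e cov with extend F I
    ... | x , p = pad k (x ∷ F) (p ∷ I) (trans (+-suc k m) e) (λ y → covered-∷ x ∘ cov y)

  -- A nonzero value is 1 or an atom. Choosing `s` as the sign of that atom makes it true, and
  -- safety carries this over to the Boolean value.
  safe-satisfiable : ∀ e → Safe e → (ρ : Word → Carrier) → ¬ value latticeAlgebra ρ e ≈ 0# →
    ∃[ β ] value boolAlgebra β e ≡ true
  safe-satisfiable e safe ρ h with family (List.map ρ (variables e))
  ... | m , _ , F , I , cov with Interpretation.represent F I ρ
  ... | κ , good , exact = _ , safe origin κ _ (proj₂ (positive (proj₁ (value elements κ e)) (proj₂ (value elements κ e)) nonzero))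
    where
    open Interpretation F I
    nonzero : ¬ interpret (value elements κ e) ≈ 0#
    nonzero p = h (≈-trans (≈-sym (interpret-value κ good ρ e (λ x q → exact x (cov _ (∈-map⁺ ρ q))))) p)
    positive : ∀ x u → ¬ interpret (x , u) ≈ 0# → ∃[ s ] truth s x ≡ true
    positive (false , false) u p = ⊥-elim (p ∼1≈0)
    positive (false , true)  u p = true , refl
    positive (true , s)      u p = s , ==-refl s

  constant : Bool → Carrier
  constant b = if b then 1# else 0#

  value-constant : ∀ (β : Word → Bool) e → value latticeAlgebra (constant ∘ β) e ≈ constant (value boolAlgebra β e)
  value-constant β (var x)   = ≈-refl
  value-constant β zero      = ≈-refl
  value-constant β one       = ≈-refl
  value-constant β (not e)   = ≈-trans (∼-cong (value-constant β e)) (negate (value boolAlgebra β e))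
    where
    negate : ∀ b → ∼ constant b ≈ constant (¬ᵇ b)
    negate true  = ∼1≈0
    negate false = ∼0≈1
  value-constant β (and e f) = ≈-trans (⊓-cong (value-constant β e) (value-constant β f))
    (conjoin (value boolAlgebra β e))
    where
    conjoin : ∀ b {b′} → constant b ⊓ constant b′ ≈ constant (b ∧ b′)
    conjoin true  = ⊓-identityˡ _
    conjoin false = ⊓-zeroˡ _
  value-constant β (or e f)  = ≈-trans
    (antisym (∨-least (⊑-trans (⊑-reflexive (value-constant β e)) (x≤x∨y _ _))
                      (⊑-trans (⊑-reflexive (value-constant β f)) (y≤x∨y _ _)))
             (∨-least (⊑-trans (⊑-reflexive (≈-sym (value-constant β e))) (x≤x∨y _ _))
                      (⊑-trans (⊑-reflexive (≈-sym (value-constant β f))) (y≤x∨y _ _))))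
    (disjoin (value boolAlgebra β e))
    where
    disjoin : ∀ b {b′} → constant b ⊔ₗ constant b′ ≈ constant (b ∨ b′)
    disjoin true  = antisym (maximum _) (x≤x∨y _ _)
    disjoin false = antisym (∨-least (minimum _) ⊑-refl) (y≤x∨y _ _)

  -- Common form of the two problems: `Φ` is equality to 1 for the strong one and being nonzero for
  -- the weak one.
  Satisfiable : ∀ {p} → (Carrier → Set p) → Language (c ⊔ p)
  Satisfiable Φ w = ∃[ n ] Σ (Term n) λ t → w ≡ ⟨ t ⟩ × (∃[ a ] Φ (eval L t a))

  eval-value : ∀ {n} (t : Term n) (b : Fin n → Carrier) ρ → (∀ i → ρ (numeral (toℕ i)) ≡ b i) →
    eval L t b ≡ value latticeAlgebra ρ (fromTerm t)
  eval-value (var i)   b ρ h = sym (h i)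
  eval-value zero      b ρ h = refl
  eval-value one       b ρ h = refl
  eval-value (not t)   b ρ h = cong ∼_ (eval-value t b ρ h)
  eval-value (and s t) b ρ h = cong₂ _⊓_ (eval-value s b ρ h) (eval-value t b ρ h)
  eval-value (or s t)  b ρ h = cong₂ _⊔ₗ_ (eval-value s b ρ h) (eval-value t b ρ h)

  module _ {p} {Φ : Carrier → Set p} where

    satisfiable⇒ : ∀ {w} → Satisfiable Φ w → ∃[ e ] w ≡ code e × ∃[ ρ ] Φ (value latticeAlgebra ρ e)
    satisfiable⇒ (n , t , eq , b , h) = fromTerm t , trans eq (code-fromTerm t) , ρ ,
      subst Φ (eval-value t b ρ agree) h
      where
      at : ∀ k → Dec (k < n) → Carrier
      at k (yes k<n) = b (Fin.fromℕ< k<n)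
      -- Variables with index at least `n` do not occur in `t`, so any value would do.
      at k (no _)    = 0#
      ρ : Word → Carrier
      ρ x = at (number x) (number x <? n)
      agree : ∀ i → ρ (numeral (toℕ i)) ≡ b i
      agree i rewrite number-numeral (toℕ i) with toℕ i <? n
      ... | yes q = cong b (FinP.fromℕ<-toℕ i q)
      ... | no q  = ⊥-elim (q (FinP.toℕ<n i))

    satisfiable⇐ : ∀ e ρ → Φ (value latticeAlgebra ρ e) → Satisfiable Φ (code e)
    satisfiable⇐ e ρ h with toTerm (bound e) e ≤-refl
    ... | t , eq = bound e , t , trans (cong code (sym eq)) (sym (code-fromTerm t)) , ρ ∘ numeral ∘ toℕ ,
      subst Φ (trans (cong (λ z → value latticeAlgebra ρ z) (sym eq)) (sym (eval-value t (ρ ∘ numeral ∘ toℕ) ρ (λ _ → refl)))) h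

-- Programs acting on some of the stacks

rename : ∀ {k K} → Vec (Fin K) k → Prog k → Prog K
rename ρ skip       = skip
rename ρ (push i b) = push (lookup ρ i) b
rename ρ (pop i P)  = pop (lookup ρ i) (λ x → rename ρ (P x))
rename ρ (P ⨾ Q)    = rename ρ P ⨾ rename ρ Q
rename ρ (loop P)   = loop (rename ρ P)

put : ∀ {k K} → Vec (Fin K) k → Stacks k → Stacks K → Stacks K
put []      []      σ = σ
put (i ∷ ρ) (w ∷ τ) σ = put ρ τ σ [ i ]≔ w

avoids : ∀ {k K} → Fin K → Vec (Fin K) k → Bool
avoids i []      = true
avoids i (j ∷ ρ) = ¬ᵇ ⌊ i FinP.≟ j ⌋ ∧ avoids i ρ

-- Boolean, so that for concrete positions the condition computes to the unit type and becomes an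
-- implicit argument of `frame`.
distinct : ∀ {k K} → Vec (Fin K) k → Bool
distinct []      = true
distinct (i ∷ ρ) = avoids i ρ ∧ distinct ρ

T-∧ : ∀ {a b} → T (a ∧ b) → T a × T b
T-∧ {true} t = tt , t

avoids-≢ : ∀ {k K} {i : Fin K} (ρ : Vec (Fin K) k) → T (avoids i ρ) → ∀ j → ¬ lookup ρ j ≡ i
avoids-≢ {i = i} (r ∷ ρ) t zero e with i FinP.≟ r
... | no ¬p = ¬p (sym e)
avoids-≢ {i = i} (r ∷ ρ) t (suc j) e = avoids-≢ ρ (proj₂ (T-∧ {¬ᵇ ⌊ i FinP.≟ r ⌋} t)) j e

lookup-put : ∀ {k K} (ρ : Vec (Fin K) k) τ σ i → T (distinct ρ) → lookup (put ρ τ σ) (lookup ρ i) ≡ lookup τ i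
lookup-put (r ∷ ρ) (w ∷ τ) σ zero    t = lookup∘updateAt r (put ρ τ σ)
lookup-put (r ∷ ρ) (w ∷ τ) σ (suc i) t with T-∧ {avoids r ρ} t
... | t₁ , t₂ = trans (lookup∘updateAt′ _ r (avoids-≢ ρ t₁ i) (put ρ τ σ)) (lookup-put ρ τ σ i t₂)

update-put : ∀ {k K} (ρ : Vec (Fin K) k) τ σ i f → T (distinct ρ) →
  updateAt (put ρ τ σ) (lookup ρ i) f ≡ put ρ (updateAt τ i f) σ
update-put (r ∷ ρ) (w ∷ τ) σ zero    f t = updateAt-updateAt-local r (put ρ τ σ) refl
update-put (r ∷ ρ) (w ∷ τ) σ (suc i) f t with T-∧ {avoids r ρ} t
... | t₁ , t₂ = trans (updateAt-commutes _ r (avoids-≢ ρ t₁ i) (put ρ τ σ)) (cong (_[ r ]≔ w) (update-put ρ τ σ i f t₂))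

run-rename : ∀ {k K} (ρ : Vec (Fin K) k) (P : Prog k) n τ σ → T (distinct ρ) →
  run (rename ρ P) n (put ρ τ σ) ≡ put ρ (run P n τ) σ
run-rename ρ skip       n τ σ t = refl
run-rename ρ (push i b) n τ σ t = update-put ρ τ σ i (b ∷_) t
run-rename ρ (pop i P)  n τ σ t
  rewrite lookup-put ρ τ σ i t | update-put ρ τ σ i (List.drop 1) t = run-rename ρ (P _) n _ σ t
run-rename ρ (P ⨾ Q)    n τ σ t rewrite run-rename ρ P n τ σ t = run-rename ρ Q n _ σ t
run-rename ρ (loop P)   n τ σ t = go n τ
  where
  go : ∀ m τ → iter m (run (rename ρ P) n) (put ρ τ σ) ≡ put ρ (iter m (run P n) τ) σ
  go zero    τ = refl
  go (suc m) τ rewrite run-rename ρ P n τ σ t = go m _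

-- A frame rule: a program specified on its own few stacks acts likewise on a selection from a
-- larger store and leaves the other stacks alone.
frame : ∀ {k K n τ τ′} (ρ : Vec (Fin K) k) (P : Prog k) {_ : T (distinct ρ)} → run P n τ ≡ τ′ →
  ∀ σ → run (rename ρ P) n (put ρ τ σ) ≡ put ρ τ′ σ
frame {n = n} {τ} ρ P {t} e σ = trans (run-rename ρ P n τ σ t) (cong (λ τ → put ρ τ σ) e)

pour : Prog 2
pour = pop 0F λ { nothing → skip ; (just b) → push 1F b }

run-pour : ∀ n m (xs ys : Word) → length xs ≤ m → iter m (run pour n) (xs ∷ ys ∷ []) ≡ [] ∷ (xs ʳ++ ys) ∷ []
run-pour n zero    []       ys h       = refl
run-pour n (suc m) []       ys h       = run-pour n m [] ys z≤n
run-pour n (suc m) (x ∷ xs) ys (s≤s h) = run-pour n m xs (x ∷ ys) h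

-- Tableaux

-- Cook and Levin's tableau, indexed by time and by the distance from the head:
-- moving the head shifts all cells, so no head positions occur.
module Tableau (M : TM) where
  open TM M

  Action : Set
  Action = State × Vec (Sym × Move) tapes

  Cell : Set
  Cell = Sym × Sym

  Tile : Set
  Tile = State × Action × Vec Cell tapes

  state : Tile → State
  state (q , _ , _) = q

  action : Tile → Action
  action (_ , a , _) = a

  cells : Tile → Vec Cell tapes
  cells (_ , _ , cs) = cs

  abstract
    finite-Action : Finite Action
    finite-Action = finite-× (states , ↔-refl) (finite-Vec (finite-× (finite-Symbol auxSymbols) finite-Move) tapes)

    finite-Tile : Finite Tile
    finite-Tile = finite-× (states , ↔-refl) (finite-× finite-Action
      (finite-Vec (finite-× (finite-Symbol auxSymbols) (finite-Symbol auxSymbols)) tapes))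

    finite-≟ : ∀ {A : Set} → Finite A → DecidableEquality A
    finite-≟ (n , f) = FinP.inj⇒≟ (↔⇒↣ f)

  nth : List Sym → ℕ → Sym
  nth []       _       = blank
  nth (s ∷ _)  zero    = s
  nth (_ ∷ ss) (suc o) = nth ss o

  -- The o-th cells to the left and to the right of the head; the scanned cell
  -- counts as the 0-th one to the right.
  cell : Tape auxSymbols → ℕ → Cell
  cell (tape ls s rs) o = nth ls o , nth (s ∷ rs) o

  isZero : ℕ → Bool
  isZero zero    = true
  isZero (suc _) = false

  -- How the cells c, d at distances o, o + 1 arise from the cells a, b of the
  -- previous row; z tells whether o = 0.
  Shifted : Bool → Sym × Move → Cell → Cell → Cell → Cell → Set
  Shifted z (s , left)  (la , ra) (lb , rb) (lc , rc) (ld , rd) =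
    lc ≡ lb × rd ≡ (if z then s else ra) × (T z → rc ≡ la)
  Shifted z (s , stay)  (la , ra) (lb , rb) (lc , rc) (ld , rd) =
    lc ≡ la × rc ≡ (if z then s else ra) × (T z → ⊤)
  Shifted z (s , right) (la , ra) (lb , rb) (lc , rc) (ld , rd) =
    ld ≡ la × rc ≡ rb × (T z → lc ≡ s)

  _≟ₛ_ : DecidableEquality Sym
  _≟ₛ_ = finite-≟ (finite-Symbol auxSymbols)

  guarded? : ∀ {A : Set} z → Dec A → Dec (T z → A)
  guarded? true  (yes a) = yes (λ _ → a)
  guarded? true  (no ¬a) = no (λ f → ¬a (f tt))
  guarded? false _       = yes (λ ())

  shifted? : ∀ z x a b c d → Dec (Shifted z x a b c d)
  shifted? z (s , left)  (la , ra) (lb , rb) (lc , rc) (ld , rd) =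
    (lc ≟ₛ lb) ×-dec (rd ≟ₛ _) ×-dec guarded? z (rc ≟ₛ la)
  shifted? z (s , stay)  (la , ra) (lb , rb) (lc , rc) (ld , rd) =
    (lc ≟ₛ la) ×-dec (rc ≟ₛ _) ×-dec guarded? z (yes tt)
  shifted? z (s , right) (la , ra) (lb , rb) (lc , rc) (ld , rd) =
    (ld ≟ₛ la) ×-dec (rc ≟ₛ rb) ×-dec guarded? z (lc ≟ₛ s)

  -- Idling is allowed, so that rows can be added after acceptance.
  Legal : State → Vec Sym tapes → Action → Set
  Legal q hs a = a ∈ δ q hs ⊎ a ≡ (q , keep hs)

  -- `a` and `b` are neighbours in one row, `c` and `d` their successors in the next. Every tile
  -- repeats the state and the action of its row, which makes both locally comparable. Legality is
  -- checked at the head alone, where the scanned symbols are known.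
  Window : Bool → Tile → Tile → Tile → Tile → Set
  Window z a b c d =
    state c ≡ proj₁ (action a) × action b ≡ action a ×
    (T z → Legal (state a) (Vec.map proj₂ (cells a)) (action a)) ×
    (∀ j → Shifted z (lookup (proj₂ (action a)) j)
      (lookup (cells a) j) (lookup (cells b) j) (lookup (cells c) j) (lookup (cells d) j))

  abstract
    window? : ∀ z a b c d → Dec (Window z a b c d)
    window? z a b c d =
      (state c FinP.≟ _) ×-dec (finite-≟ finite-Action (action b) (action a)) ×-dec
      guarded? z (_∈?_ (finite-≟ finite-Action) (action a) _ ⊎-dec finite-≟ finite-Action (action a) _) ×-dec
      FinP.all? (λ j → shifted? z (lookup (proj₂ (action a)) j)
        (lookup (cells a) j) (lookup (cells b) j) (lookup (cells c) j) (lookup (cells d) j))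

  cell-left : ∀ s τ o → nth (Tape.before (act (s , left) τ)) o ≡ nth (Tape.before τ) (suc o) ×
    proj₂ (cell (act (s , left) τ) (suc o)) ≡ (if isZero o then s else proj₂ (cell τ o)) ×
    proj₂ (cell (act (s , left) τ) 0) ≡ proj₁ (cell τ 0)
  cell-left s (tape []       x rs) zero    = refl , refl , refl
  cell-left s (tape []       x rs) (suc o) = refl , refl , refl
  cell-left s (tape (l ∷ ls) x rs) zero    = refl , refl , refl
  cell-left s (tape (l ∷ ls) x rs) (suc o) = refl , refl , refl

  cell-stay : ∀ s τ o → proj₂ (cell (act (s , stay) τ) o) ≡ (if isZero o then s else proj₂ (cell τ o))
  cell-stay s τ zero    = refl
  cell-stay s τ (suc o) = refl

  cell-right : ∀ s τ o → proj₁ (cell (act (s , right) τ) (suc o)) ≡ proj₁ (cell τ o) ×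
    proj₂ (cell (act (s , right) τ) o) ≡ proj₂ (cell τ (suc o)) ×
    proj₁ (cell (act (s , right) τ) 0) ≡ s
  cell-right s (tape ls x [])       zero    = refl , refl , refl
  cell-right s (tape ls x [])       (suc o) = refl , refl , refl
  cell-right s (tape ls x (r ∷ rs)) o       = refl , refl , refl

  shifted-act : ∀ x τ o → Shifted (isZero o) x (cell τ o) (cell τ (suc o)) (cell (act x τ) o) (cell (act x τ) (suc o))
  shifted-act (s , left)  τ o = let (p , q , r) = cell-left s τ o in p , q , zeroth o r
    where
    zeroth : ∀ o → proj₂ (cell (act (s , left) τ) 0) ≡ proj₁ (cell τ 0) →
      T (isZero o) → proj₂ (cell (act (s , left) τ) o) ≡ proj₁ (cell τ o)
    zeroth zero r _ = r
  shifted-act (s , stay)  τ o = refl , cell-stay s τ o , _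
  shifted-act (s , right) τ o = let (p , q , r) = cell-right s τ o in p , q , zeroth o r
    where
    zeroth : ∀ o → proj₁ (cell (act (s , right) τ) 0) ≡ s → T (isZero o) → proj₁ (cell (act (s , right) τ) o) ≡ s
    zeroth zero r _ = r

  -- What the window at a distance leaves open about the new cell is fixed by the window one closer
  -- to the head, or at the head by the clause for `z`. One more old cell than new ones must be
  -- known, as symbols come in from the next distance.
  shifted-determines : ∀ x τ r (old new : ℕ → Cell) → (∀ o → o ≤ suc r → old o ≡ cell τ o) →
    (∀ o → o ≤ r → Shifted (isZero o) x (old o) (old (suc o)) (new o) (new (suc o))) →
    ∀ o → o ≤ r → new o ≡ cell (act x τ) o
  shifted-determines x τ r old new eq sh o o≤r = go x sh o o≤r
    where
    at : ∀ {o} → o ≤ r → old o ≡ cell τ o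
    at h = eq _ (m≤n⇒m≤1+n h)
    go : ∀ x → (∀ o → o ≤ r → Shifted (isZero o) x (old o) (old (suc o)) (new o) (new (suc o))) →
      ∀ o → o ≤ r → new o ≡ cell (act x τ) o
    go (s , left) sh zero h with sh 0 h
    ... | p , q , z = cong₂ _,_
      (trans p (trans (cong proj₁ (eq 1 (s≤s z≤n))) (sym (proj₁ (cell-left s τ 0)))))
      (trans (z tt) (trans (cong proj₁ (at z≤n)) (sym (proj₂ (proj₂ (cell-left s τ 0))))))
    go (s , left) sh (suc o) h with sh (suc o) h | sh o (≤-trans (n≤1+n o) h)
    ... | p , _ , _ | _ , q , _ = cong₂ _,_
      (trans p (trans (cong proj₁ (eq (suc (suc o)) (s≤s h))) (sym (proj₁ (cell-left s τ (suc o))))))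
      (trans q (trans (cong (λ c → if isZero o then s else proj₂ c) (at (≤-trans (n≤1+n o) h)))
        (sym (proj₁ (proj₂ (cell-left s τ o))))))
    go (s , stay) sh o h with sh o h
    ... | p , q , _ = cong₂ _,_ (trans p (cong proj₁ (at h)))
      (trans q (trans (cong (λ c → if isZero o then s else proj₂ c) (at h)) (sym (cell-stay s τ o))))
    go (s , right) sh zero h with sh 0 h
    ... | _ , q , z = cong₂ _,_ (trans (z tt) (sym (proj₂ (proj₂ (cell-right s τ 0)))))
      (trans q (trans (cong proj₂ (eq 1 (s≤s z≤n))) (sym (proj₁ (proj₂ (cell-right s τ 0))))))
    go (s , right) sh (suc o) h with sh (suc o) h | sh o (≤-trans (n≤1+n o) h)
    ... | _ , q , _ | p , _ , _ = cong₂ _,_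
      (trans p (trans (cong proj₁ (at (≤-trans (n≤1+n o) h))) (sym (proj₁ (cell-right s τ o)))))
      (trans q (trans (cong proj₂ (eq (suc (suc o)) (s≤s h))) (sym (proj₁ (proj₂ (cell-right s τ (suc o)))))))

  Shows : ℕ → (ℕ → Tile) → Config M → Set
  Shows r row (q , ts) = ∀ o → o ≤ r → state (row o) ≡ q × (∀ j → lookup (cells (row o)) j ≡ cell (lookup ts j) o)

  vec-ext : ∀ {A : Set} {n} {xs ys : Vec A n} → (∀ j → lookup xs j ≡ lookup ys j) → xs ≡ ys
  vec-ext {xs = []}     {[]}     h = refl
  vec-ext {xs = x ∷ xs} {y ∷ ys} h = cong₂ _∷_ (h zero) (vec-ext (h ∘ suc))

  -- What a row says at distance o is only reliable if o cells further are known
  -- in the previous row, so the last of T rows is only known at the head.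
  tableau-sound : ∀ (V : ℕ → ℕ → Tile) T → (∀ t o → t < T → o < T →
      Window (isZero o) (V t o) (V t (suc o)) (V (suc t) o) (V (suc t) (suc o))) →
    ∀ r t c → r + t ≡ T → Shows r (V t) c → ∃[ k ] ∃[ c′ ] Run M k c c′ × proj₁ c′ ≡ state (V T 0)
  tableau-sound V T win zero    t c refl sh = 0 , c , done , sym (proj₁ (sh 0 z≤n))
  tableau-sound V T win (suc r) t c@(q , ts) refl sh = conclude (legal tt)
    where
    r<T : ∀ {o} → o ≤ r → o < suc r + t
    r<T h = s≤s (≤-trans h (m≤m+n r t))
    w : ∀ o → o ≤ r → Window (isZero o) (V t o) (V t (suc o)) (V (suc t) o) (V (suc t) (suc o))
    w o h = win t o (s≤s (m≤n+m t r)) (r<T h)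
    a = action (V t 0)
    legal = proj₁ (proj₂ (proj₂ (w 0 z≤n)))
    same-action : ∀ o → o ≤ suc r → action (V t o) ≡ a
    same-action zero    h       = refl
    same-action (suc o) (s≤s h) = trans (proj₁ (proj₂ (w o h))) (same-action o (m≤n⇒m≤1+n h))
    c₁ : Config M
    c₁ = proj₁ a , Vec.zipWith act (proj₂ a) ts
    shows₁ : Shows r (V (suc t)) c₁
    shows₁ o h = trans (proj₁ (w o h)) (cong proj₁ (same-action o (m≤n⇒m≤1+n h))) , λ j →
      trans (shifted-determines (lookup (proj₂ a) j) (lookup ts j) r
        (λ o → lookup (cells (V t o)) j) (λ o → lookup (cells (V (suc t) o)) j)
        (λ o h → proj₂ (sh o h) j)
        (λ o h → subst (λ b → Shifted (isZero o) (lookup (proj₂ b) j)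
            (lookup (cells (V t o)) j) (lookup (cells (V t (suc o))) j)
            (lookup (cells (V (suc t) o)) j) (lookup (cells (V (suc t) (suc o))) j)) (same-action o (m≤n⇒m≤1+n h))
          (proj₂ (proj₂ (proj₂ (w o h))) j)) o h)
        (cong (λ T → cell T o) (sym (lookup-zipWith act j (proj₂ a) ts)))
    scanned : Vec.map proj₂ (cells (V t 0)) ≡ heads ts
    scanned = vec-ext λ j → trans (lookup-map j proj₂ (cells (V t 0)))
      (trans (cong proj₂ (proj₂ (sh 0 z≤n) j)) (sym (lookup-map j Tape.head ts)))
    continue = tableau-sound V T win r (suc t) c₁ (+-suc r t) shows₁
    conclude : Legal (state (V t 0)) (Vec.map proj₂ (cells (V t 0))) a →
      ∃[ k ] ∃[ c′ ] Run M k c c′ × proj₁ c′ ≡ state (V T 0)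
    conclude l rewrite scanned | proj₁ (sh 0 z≤n) with l | continue
    ... | inj₁ p | k , c′ , run , e = suc k , c′ , step p run , e
    -- An idle row repeats the configuration, so it contributes no step to the run.
    ... | inj₂ p | k , c′ , run , e = k , c′ ,
      subst (λ c → Run M k c c′) (trans (cong (λ a → proj₁ a , Vec.zipWith act (proj₂ a) ts) p)
        (cong (q ,_) (act-keep ts))) run , e

  successor : Config M → Action → Config M
  successor (q , ts) (q′ , as) = q′ , Vec.zipWith act as ts

  -- A finite run prolonged for ever by idling in its last configuration, so that the tableau may
  -- have more rows than the run has steps.
  record Trace (c : Config M) (k : ℕ) (c′ : Config M) : Set where
    field
      at    : ℕ → Config M
      by    : ℕ → Action
      legal : ∀ t → Legal (proj₁ (at t)) (heads (proj₂ (at t))) (by t)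
      steps : ∀ t → at (suc t) ≡ successor (at t) (by t)
      first : at 0 ≡ c
      last  : ∀ t → k ≤ t → at t ≡ c′

  trace : ∀ {k c c′} → Run M k c c′ → Trace c k c′
  trace {c = c@(q , ts)} done = record
    { at = λ _ → c ; by = λ _ → q , keep (heads ts) ; legal = λ _ → inj₂ refl
    ; steps = λ _ → cong (q ,_) (sym (act-keep ts)) ; first = refl ; last = λ _ _ → refl }
  trace {c = c} (step {as = as} p r) = record
    { at = λ { zero → c ; (suc t) → at t } ; by = λ { zero → _ , as ; (suc t) → by t }
    ; legal = λ { zero → inj₁ p ; (suc t) → legal t } ; steps = λ { zero → first ; (suc t) → steps t }
    ; first = refl ; last = λ { (suc t) (s≤s h) → last t h } }
    where open Trace (trace r)

  module _ {c k c′} (tr : Trace c k c′) where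
    open Trace tr

    tile : ℕ → ℕ → Tile
    tile t o = proj₁ (at t) , by t , Vec.map (λ T → cell T o) (proj₂ (at t))

    tableau-complete : ∀ t o → Window (isZero o) (tile t o) (tile t (suc o)) (tile (suc t) o) (tile (suc t) (suc o))
    tableau-complete t o = cong proj₁ (steps t) , refl ,
      (λ z → subst (λ hs → Legal (proj₁ (at t)) hs (by t)) (scanned o z) (legal t)) , shifted
      where
      scanned : ∀ o → T (isZero o) → heads (proj₂ (at t)) ≡ Vec.map proj₂ (cells (tile t o))
      scanned zero _ = vec-ext λ j → trans (lookup-map j Tape.head (proj₂ (at t)))
        (sym (trans (lookup-map j proj₂ (cells (tile t 0))) (cong proj₂ (lookup-map j _ (proj₂ (at t))))))
      shifted : ∀ j → Shifted (isZero o) (lookup (proj₂ (by t)) j)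
        (lookup (cells (tile t o)) j) (lookup (cells (tile t (suc o))) j)
        (lookup (cells (tile (suc t) o)) j) (lookup (cells (tile (suc t) (suc o))) j)
      shifted j rewrite steps t
        | lookup-map j (λ T → cell T o) (proj₂ (at t)) | lookup-map j (λ T → cell T (suc o)) (proj₂ (at t))
        | lookup-map j (λ T → cell T o) (Vec.zipWith act (proj₂ (by t)) (proj₂ (at t)))
        | lookup-map j (λ T → cell T (suc o)) (Vec.zipWith act (proj₂ (by t)) (proj₂ (at t)))
        | lookup-zipWith act j (proj₂ (by t)) (proj₂ (at t)) = shifted-act (lookup (proj₂ (by t)) j) (lookup (proj₂ (at t)) j) o

-- The tableau as an expression

mapExp : ∀ {V W} → (V → W) → Exp V → Exp W
mapExp f (var x)   = var (f x)
mapExp f zero      = zero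
mapExp f one       = one
mapExp f (not e)   = not (mapExp f e)
mapExp f (and e g) = and (mapExp f e) (mapExp f g)
mapExp f (or e g)  = or (mapExp f e) (mapExp f g)

oneHot : ∀ {n} → Fin n → Vec Bool n
oneHot zero    = true ∷ Vec.replicate _ false
oneHot (suc i) = false ∷ oneHot i

-- The first bit set counts and the others are ignored, so the formula needs no part demanding that
-- exactly one bit is set.
hot : ∀ {n} → Vec Bool n → Maybe (Fin n)
hot []          = nothing
hot (true ∷ _)  = just zero
hot (false ∷ v) = Maybe.map suc (hot v)

hot-oneHot : ∀ {n} (i : Fin n) → hot (oneHot i) ≡ just i
hot-oneHot zero    = refl
hot-oneHot (suc i) = cong (Maybe.map suc) (hot-oneHot i)

-- Unary, so that a machine can produce it by emptying counters; the two separators make it uniquely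
-- readable.
label : ℕ → ℕ → ℕ → Word
label t o κ = replicate t false ++ true ∷ replicate o false ++ true ∷ replicate κ false

leading : Word → ℕ × Word
leading (false ∷ x) = Product.map₁ suc (leading x)
leading (true ∷ x)  = 0 , x
leading []          = 0 , []

leading-replicate : ∀ n x → leading (replicate n false ++ true ∷ x) ≡ (n , x)
leading-replicate zero    x = refl
leading-replicate (suc n) x = cong (Product.map₁ suc) (leading-replicate n x)

unlabel : Word → ℕ × ℕ × ℕ
unlabel x = let (t , y) = leading x ; (o , z) = leading y in t , o , length z

unlabel-label : ∀ t o κ → unlabel (label t o κ) ≡ (t , o , κ)
unlabel-label t o κ
  rewrite leading-replicate t (replicate o false ++ true ∷ replicate κ false)
        | leading-replicate o (replicate κ false) = cong (λ l → t , o , l) (length-replicate κ)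

-- A variable of a window at (t , o): the κ-th bit of the tile at (t , o) or one
-- of its successors.
Site : Set
Site = Bool × Bool × ℕ

site : ℕ → ℕ → Site → Word
site t o (x , y , κ) = label (if x then suc t else t) (if y then suc o else o) κ

-- A decision tree. Its size is exponential in `n`, which is harmless because the number of bits in
-- a window depends on the machine alone.
ask : ∀ {n} → Vec Site n → (Vec Bool n → Exp Site) → Exp Site
ask []       k = k []
ask (v ∷ vs) k = shannon v (ask vs (k ∘ (true ∷_))) (ask vs (k ∘ (false ∷_)))

value-ask : ∀ (β : Word → Bool) f {n} (vs : Vec Site n) k →
  value boolAlgebra β (mapExp f (ask vs k)) ≡ value boolAlgebra β (mapExp f (k (Vec.map (β ∘ f) vs)))
value-ask β f []       k = refl
value-ask β f (v ∷ vs) k with β (f v)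
... | true  = trans (∨-identityʳ _) (value-ask β f vs (k ∘ (true ∷_)))
... | false = value-ask β f vs (k ∘ (false ∷_))

safe-ask : ∀ f {n} (vs : Vec Site n) k → (∀ v → Safe (mapExp f (k v))) → Safe (mapExp f (ask vs k))
safe-ask f []       k h = h []
safe-ask f (v ∷ vs) k h = safe-shannon (f v) {mapExp f (ask vs (k ∘ (true ∷_)))} {mapExp f (ask vs (k ∘ (false ∷_)))}
  (safe-ask f vs _ (λ u → h (true ∷ u))) (safe-ask f vs _ (λ u → h (false ∷ u)))

truthExp : ∀ {V} → Bool → Exp V
truthExp b = if b then one else zero

value-truthExp : ∀ (β : Word → Bool) (f : Site → Word) b → value boolAlgebra β (mapExp f (truthExp b)) ≡ b
value-truthExp β f true  = refl
value-truthExp β f false = refl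

safe-truthExp : ∀ (f : Site → Word) b → Safe (mapExp f (truthExp b))
safe-truthExp f true  o ρ s h = refl
safe-truthExp f false o ρ s ()

⌊⌋-sound : ∀ {P : Set} (d : Dec P) → ⌊ d ⌋ ≡ true → P
⌊⌋-sound (yes p) _ = p

⌊⌋-complete : ∀ {P : Set} (d : Dec P) → P → ⌊ d ⌋ ≡ true
⌊⌋-complete (yes _) _ = refl
⌊⌋-complete (no ¬p) p = ⊥-elim (¬p p)

-- Nested to the left, so that in postfix notation each new conjunct is appended to what has been
-- written: its code followed by one symbol.
collect : (ℕ → Exp Word) → ℕ → ℕ → Exp Word → Exp Word
collect f zero    o e = e
collect f (suc n) o e = collect f n (suc o) (and e (f o))

Holds∧ : (Word → Bool) → Exp Word → Set
Holds∧ β e = value boolAlgebra β e ≡ true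

collect-sound : ∀ β f n o e → Holds∧ β (collect f n o e) →
  Holds∧ β e × (∀ i → o ≤ i → i < n + o → Holds∧ β (f i))
collect-sound β f zero    o e h = h , λ i o≤i i<o → ⊥-elim (<-irrefl refl (≤-trans i<o o≤i))
collect-sound β f (suc n) o e h with collect-sound β f n (suc o) (and e (f o)) h
... | h₁ , h₂ with ∧-true {value boolAlgebra β e} h₁
... | h₃ , h₄ = h₃ , λ i o≤i i< → case m≤n⇒m<n∨m≡n o≤i of λ
  { (inj₁ o<i) → h₂ i o<i (subst (i <_) (sym (+-suc n o)) i<)
  ; (inj₂ refl) → h₄ }

collect-complete : ∀ β f n o e → Holds∧ β e → (∀ i → Holds∧ β (f i)) → Holds∧ β (collect f n o e)
collect-complete β f zero    o e h k = h
collect-complete β f (suc n) o e h k = collect-complete β f n (suc o) (and e (f o)) (∧-intro h (k o)) k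

collect-safe : ∀ f n o e → Safe e → (∀ i → Safe (f i)) → Safe (collect f n o e)
collect-safe f zero    o e h k = h
collect-safe f (suc n) o e h k = collect-safe f n (suc o) (and e (f o)) (safe-and {e} {f o} h (k o)) k

module Formula (M : TM) where
  open TM M using (start; accept; states; tapes; extraTapes; auxSymbols)
  open Tableau M

  size : ℕ
  size = proj₁ finite-Tile

  -- The default for vectors with no bit set. Any tile would do, since every decoded tile has to fit
  -- the windows.
  blankTile : Tile
  blankTile = start , (start , Vec.replicate tapes (blank , stay)) , Vec.replicate tapes (blank , blank)

  abstract
    decodeTile : Vec Bool size → Tile
    decodeTile v = maybe′ (Inverse.from (proj₂ finite-Tile)) blankTile (hot v)

    encodeTile : Tile → Vec Bool size
    encodeTile x = oneHot (Inverse.to (proj₂ finite-Tile) x)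

    decode-encode : ∀ x → decodeTile (encodeTile x) ≡ x
    decode-encode x rewrite hot-oneHot (Inverse.to (proj₂ finite-Tile) x) = Inverse.inverseʳ (proj₂ finite-Tile) refl

  sites : Bool → Bool → Vec Site size
  sites x y = Vec.tabulate (λ κ → x , y , toℕ κ)

  read : Bool → Bool → (Tile → Exp Site) → Exp Site
  read x y k = ask (sites x y) (k ∘ decodeTile)

  startCells : Maybe Bool → Vec Cell tapes
  startCells x = (blank , maybe′ bit blank x) ∷ Vec.replicate extraTapes (blank , blank)

  Initial : Maybe Bool → Tile → Set
  Initial x v = state v ≡ start × cells v ≡ startCells x

  abstract
    finite-Cells : Finite (Vec Cell tapes)
    finite-Cells = finite-Vec (finite-× (finite-Symbol auxSymbols) (finite-Symbol auxSymbols)) tapes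

    initial? : ∀ x v → Dec (Initial x v)
    initial? x v = (state v FinP.≟ start) ×-dec finite-≟ finite-Cells (cells v) (startCells x)

  initialTile : Maybe Bool → Tile → Exp Site
  initialTile x v = truthExp ⌊ initial? x v ⌋

  initialExp : Maybe Bool → Exp Site
  initialExp x = read false false (initialTile x)

  window₄ : Bool → Tile → Tile → Tile → Tile → Exp Site
  window₄ z a b c d = truthExp ⌊ window? z a b c d ⌋

  window₃ : Bool → Tile → Tile → Tile → Exp Site
  window₃ z a b c = read true true (window₄ z a b c)

  window₂ : Bool → Tile → Tile → Exp Site
  window₂ z a b = read true false (window₃ z a b)

  window₁ : Bool → Tile → Exp Site
  window₁ z a = read false true (window₂ z a)

  windowExp : Bool → Exp Site
  windowExp z = read false false (window₁ z)

  acceptTile : Tile → Exp Site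
  acceptTile v = truthExp (accept (state v))

  acceptExp : Exp Site
  acceptExp = read false false acceptTile

  at : ℕ → ℕ → Exp Site → Exp Word
  at t o e = mapExp (site t o) e

  initials : Word → ℕ → Exp Word
  initials w o = at 0 o (initialExp (List.head (List.drop o w)))

  windows : ℕ → ℕ → Exp Word
  windows t o = at t o (windowExp (isZero o))

  grid : ℕ → ℕ → ℕ → Exp Word → Exp Word
  grid T zero    t e = e
  grid T (suc n) t e = grid T n (suc t) (collect (windows t) T 0 e)

  -- The first row is fixed on `T + 1` cells because one cell of knowledge is lost per step; after
  -- `T` steps the tile at the head is still reliable, and only its state is tested.
  formula : ℕ → Word → Exp Word
  formula T w = and (grid T T 0 (collect (initials w) (suc T) 0 one)) (at T 0 acceptExp)

  safe-read : ∀ f x y k → (∀ v → Safe (mapExp f (k v))) → Safe (mapExp f (read x y k))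
  safe-read f x y k h = safe-ask f (sites x y) (k ∘ decodeTile) (λ v → h (decodeTile v))

  formula-safe : ∀ T w → Safe (formula T w)
  formula-safe T w = safe-and {grid T T 0 _} {at T 0 acceptExp}
    (grid-safe T 0 _ (collect-safe (initials w) (suc T) 0 one (λ _ _ _ _ → refl)
      (λ o → safe-read (site 0 o) false false (initialTile (List.head (List.drop o w))) (λ v → safe-truthExp (site 0 o) ⌊ initial? (List.head (List.drop o w)) v ⌋))))
    (safe-read (site T 0) false false acceptTile (λ v → safe-truthExp (site T 0) (accept (state v))))
    where
    windows-safe : ∀ t o → Safe (windows t o)
    windows-safe t o =
      safe-read f false false (window₁ z) λ a → safe-read f false true (window₂ z a) λ b →
      safe-read f true false (window₃ z a b) λ c → safe-read f true true (window₄ z a b c) λ d → safe-truthExp f ⌊ window? z a b c d ⌋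
      where
      f = site t o
      z = isZero o
    grid-safe : ∀ n t e → Safe e → Safe (grid T n t e)
    grid-safe zero    t e h = h
    grid-safe (suc n) t e h = grid-safe n (suc t) _ (collect-safe (windows t) T 0 e h (windows-safe t))

  module _ (β : Word → Bool) where

    V : ℕ → ℕ → Tile
    V t o = decodeTile (Vec.tabulate (λ κ → β (label t o (toℕ κ))))

    value-read : ∀ t o x y k → value boolAlgebra β (mapExp (site t o) (read x y k)) ≡
      value boolAlgebra β (mapExp (site t o) (k (V (if x then suc t else t) (if y then suc o else o))))
    value-read t o x y k = trans (value-ask β (site t o) (sites x y) (k ∘ decodeTile))
      (cong (λ v → value boolAlgebra β (mapExp (site t o) (k (decodeTile v))))
        (sym (tabulate-∘ (β ∘ site t o) (λ κ → x , y , toℕ κ))))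

    value-initials : ∀ w o → value boolAlgebra β (initials w o) ≡ ⌊ initial? (List.head (List.drop o w)) (V 0 o) ⌋
    value-initials w o = trans (value-read 0 o false false (initialTile (List.head (List.drop o w)))) (value-truthExp β (site 0 o) _)

    value-windows : ∀ t o → value boolAlgebra β (windows t o) ≡
      ⌊ window? (isZero o) (V t o) (V t (suc o)) (V (suc t) o) (V (suc t) (suc o)) ⌋
    value-windows t o = trans (value-read t o false false (window₁ z)) (trans (value-read t o false true (window₂ z a))
      (trans (value-read t o true false (window₃ z a b)) (trans (value-read t o true true (window₄ z a b c))
      (value-truthExp β (site t o) _))))
      where
      z = isZero o
      a = V t o
      b = V t (suc o)
      c = V (suc t) o

    value-accept : ∀ t → value boolAlgebra β (at t 0 acceptExp) ≡ accept (state (V t 0))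
    value-accept t = trans (value-read t 0 false false acceptTile) (value-truthExp β (site t 0) _)

    grid-sound : ∀ T n t e → Holds∧ β (grid T n t e) →
      Holds∧ β e × (∀ i → t ≤ i → i < n + t → ∀ o → o < T → Holds∧ β (windows i o))
    grid-sound T zero    t e h = h , λ i t≤i i<t → ⊥-elim (<-irrefl refl (≤-trans i<t t≤i))
    grid-sound T (suc n) t e h with grid-sound T n (suc t) _ h
    ... | h₁ , h₂ with collect-sound β (windows t) T 0 e h₁
    ... | h₃ , h₄ = h₃ , λ i t≤i i< → case m≤n⇒m<n∨m≡n t≤i of λ
      { (inj₁ t<i) → h₂ i t<i (subst (i <_) (sym (+-suc n t)) i<)
      ; (inj₂ refl) → λ o o<T → h₄ o z≤n (subst (o <_) (sym (+-identityʳ T)) o<T) }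

    grid-complete : ∀ T n t e → Holds∧ β e → (∀ t o → Holds∧ β (windows t o)) → Holds∧ β (grid T n t e)
    grid-complete T zero    t e h k = h
    grid-complete T (suc n) t e h k = grid-complete T n (suc t) _ (collect-complete β (windows t) T 0 e h (k t)) k

  nth-input : ∀ w o → cell (inputTape w) o ≡ (blank , maybe′ bit blank (List.head (List.drop o w)))
  nth-input []      zero    = refl
  nth-input []      (suc o) = refl
  nth-input (b ∷ w) o       = cong (blank ,_) (go (b ∷ w) o)
    where
    go : ∀ w o → nth (List.map bit w) o ≡ maybe′ bit blank (List.head (List.drop o w))
    go []      zero    = refl
    go []      (suc o) = refl
    go (b ∷ w) zero    = refl
    go (b ∷ w) (suc o) = go w o

  initial-cells : ∀ w o j → lookup (startCells (List.head (List.drop o w))) j ≡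
    cell (lookup (proj₂ (initial M w)) j) o
  initial-cells w o zero    = sym (nth-input w o)
  initial-cells w o (suc j) = go extraTapes o j
    where
    go : ∀ n o j → lookup (Vec.replicate n (blank , blank)) j ≡ cell (lookup (Vec.replicate n emptyTape) j) o
    go (suc n) zero    zero    = refl
    go (suc n) (suc o) zero    = refl
    go (suc n) o       (suc j) = go n o j

  formula-sound : ∀ n w β → Holds∧ β (formula n w) → ∃[ k ] AcceptsIn M k w
  formula-sound n w β h with ∧-true {value boolAlgebra β (grid n n 0 _)} h
  ... | h₁ , h₂ with grid-sound β n n 0 _ h₁
  ... | h₃ , h₄ with collect-sound β (initials w) (suc n) 0 one h₃
  ... | _ , h₅ with tableau-sound (V β) n
      (λ t o t<n o<n → ⌊⌋-sound (window? _ _ _ _ _) (trans (sym (value-windows β t o))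
        (h₄ t z≤n (subst (t <_) (sym (+-identityʳ n)) t<n) o o<n)))
      n 0 (initial M w) (+-identityʳ n) shows
    where
    shows : Shows n (V β 0) (initial M w)
    shows o o≤n with ⌊⌋-sound (initial? _ (V β 0 o)) (trans (sym (value-initials β w o))
      (h₅ o z≤n (s≤s (≤-trans o≤n (≤-reflexive (sym (+-identityʳ n)))))))
    ... | p , q = p , λ j → trans (cong (λ v → lookup v j) q) (initial-cells w o j)
  ... | k , c′ , r , e = k , c′ , r , subst T (sym (trans (cong accept e) (trans (sym (value-accept β n)) h₂))) tt

  -- The trace fills the whole infinite grid. A variable gets the bit of the tile at the place that
  -- `unlabel` reads off its name, and idling carries acceptance from row `k` to row `n`.
  formula-complete : ∀ n w k → k ≤ n → AcceptsIn M k w → ∃[ β ] Holds∧ β (formula n w)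
  formula-complete n w k k≤n (c′ , r , acc) = β , ∧-intro
    (grid-complete β n n 0 _ (collect-complete β (initials w) (suc n) 0 one refl
      (λ o → trans (value-initials β w o) (⌊⌋-complete (initial? _ _) (initially o))))
      (λ t o → trans (value-windows β t o) (⌊⌋-complete (window? _ _ _ _ _) (windowed t o))))
    (trans (value-accept β n) (trans (cong (accept ∘ state) (V-tile n 0))
      (trans (cong (accept ∘ proj₁) (Trace.last tr n k≤n)) (T-true acc))))
    where
    tr = trace r
    T-true : ∀ {b} → T b → b ≡ true
    T-true {true} _ = refl
    bitAt : ℕ → ∀ {n} → Vec Bool n → Bool
    bitAt _       []      = false
    bitAt zero    (b ∷ _) = b
    bitAt (suc κ) (_ ∷ v) = bitAt κ v
    β : Word → Bool
    β x = let (t , o , κ) = unlabel x in bitAt κ (encodeTile (tile tr t o))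
    tabulate-bitAt : ∀ {n} (v : Vec Bool n) → Vec.tabulate (λ κ → bitAt (toℕ κ) v) ≡ v
    tabulate-bitAt []      = refl
    tabulate-bitAt (b ∷ v) = cong (b ∷_) (tabulate-bitAt v)
    V-tile : ∀ t o → V β t o ≡ tile tr t o
    V-tile t o = trans (cong decodeTile (trans
      (tabulate-cong (λ κ → cong (λ { (t , o , κ) → bitAt κ (encodeTile (tile tr t o)) }) (unlabel-label t o (toℕ κ))))
      (tabulate-bitAt (encodeTile (tile tr t o))))) (decode-encode _)
    initially : ∀ o → Initial (List.head (List.drop o w)) (V β 0 o)
    initially o rewrite V-tile 0 o | Trace.first tr = refl ,
      vec-ext (λ j → trans (lookup-map j (λ τ → cell τ o) (proj₂ (initial M w))) (sym (initial-cells w o j)))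
    windowed : ∀ t o → Window (isZero o) (V β t o) (V β t (suc o)) (V β (suc t) o) (V β (suc t) (suc o))
    windowed t o rewrite V-tile t o | V-tile t (suc o) | V-tile (suc t) o | V-tile (suc t) (suc o) = tableau-complete tr t o

-- The reduction

ones : ℕ → Word
ones n = replicate n true

ones-ʳ++ : ∀ m n → ones m ʳ++ ones n ≡ ones (m + n)
ones-ʳ++ zero    n = refl
ones-ʳ++ (suc m) n = trans (ones-ʳ++ m (suc n)) (cong ones (+-suc m n))

spell : Word → Word
spell []      = []
spell (b ∷ x) = true ∷ b ∷ spell x

name-++ : ∀ x y → name (x ++ y) ≡ spell x ++ name y
name-++ []      y = refl
name-++ (b ∷ x) y = cong (λ w → true ∷ b ∷ w) (name-++ x y)

-- The stacks are: the reversed input, the output, the input, the counters for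
-- time and distance, and a scratch stack.
module Emission (p : Polynomial) where

  write : Word → Prog 6
  write []      = skip
  write (b ∷ w) = push 1F b ⨾ write w

  -- The first two pushes form the pair that spells a `false` digit; the tick itself moves to the
  -- third stack, from which `count` pours it back.
  tally : Prog 3
  tally = pop 0F λ { nothing → skip ; (just _) → push 1F true ⨾ push 1F false ⨾ push 2F true }

  count : Fin 6 → Prog 6
  count i = rename (i ∷ 1F ∷ 5F ∷ []) (loopP p tally) ⨾ rename (5F ∷ i ∷ []) (loopP p pour)

  -- The expression is fixed in advance, so its text is part of the program; only the counters for
  -- time and distance are inserted at run time. A reference to the next row or the next distance
  -- adds one `false` to the counter in question.
  emit : Exp Site → Prog 6
  emit zero      = write (false ∷ false ∷ false ∷ [])
  emit one       = write (false ∷ false ∷ true ∷ [])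
  emit (not e)   = emit e ⨾ write (false ∷ true ∷ false ∷ [])
  emit (and e f) = emit e ⨾ emit f ⨾ write (false ∷ true ∷ true ∷ [])
  emit (or e f)  = emit e ⨾ emit f ⨾ write (true ∷ false ∷ false ∷ [])
  emit (var (x , y , κ)) =
    write (true ∷ false ∷ true ∷ spell (if x then false ∷ [] else [])) ⨾ count 3F ⨾
    write (spell (true ∷ (if y then false ∷ [] else []))) ⨾ count 4F ⨾
    write (name (true ∷ replicate κ false))

  -- One round more than `p` gives, because the first row has `⟦ p ⟧ n + 1` cells.
  clear : Prog 6
  clear = loopP (p ⊕ const 1) (pop 4F λ _ → skip)

  module _ (n : ℕ) where

    τ : ℕ
    τ = ⟦ p ⟧ n

    run-tally : ∀ m t s out → t ≤ m → iter m (run tally n) (ones t ∷ out ∷ ones s ∷ []) ≡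
      [] ∷ (spell (replicate t false) ʳ++ out) ∷ ones (t + s) ∷ []
    run-tally zero    zero    s out h       = refl
    run-tally (suc m) zero    s out h       = run-tally m zero s out z≤n
    run-tally (suc m) (suc t) s out (s≤s h) = trans (run-tally m t (suc s) (false ∷ true ∷ out) h)
      (cong (λ k → [] ∷ (spell (replicate t false) ʳ++ false ∷ true ∷ out) ∷ ones k ∷ []) (+-suc t s))

    stacks : Word → Word → Word → ℕ → ℕ → Stacks 6
    stacks inp out src t o = inp ∷ out ∷ src ∷ ones t ∷ ones o ∷ [] ∷ []

    run-write : ∀ w inp out src t o → run (write w) n (stacks inp out src t o) ≡ stacks inp (w ʳ++ out) src t o
    run-write []      inp out src t o = refl
    run-write (b ∷ w) inp out src t o = run-write w inp (b ∷ out) src t o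

    tallied : ∀ t out → t ≤ τ → run (loopP p tally) n (ones t ∷ out ∷ [] ∷ []) ≡
      [] ∷ (spell (replicate t false) ʳ++ out) ∷ ones t ∷ []
    tallied t out h = trans (run-loopP p tally n _) (trans (run-tally τ t 0 out h)
      (cong (λ k → [] ∷ (spell (replicate t false) ʳ++ out) ∷ ones k ∷ []) (+-identityʳ t)))

    restored : ∀ t → t ≤ τ → run (loopP p pour) n (ones t ∷ [] ∷ []) ≡ [] ∷ ones t ∷ []
    restored t h = trans (run-loopP p pour n _) (trans
      (run-pour n τ (ones t) [] (≤-trans (≤-reflexive (length-replicate t)) h))
      (cong (λ w → [] ∷ w ∷ []) (trans (ones-ʳ++ t 0) (cong ones (+-identityʳ t)))))

    run-count₃ : ∀ inp out src t o → t ≤ τ → run (count 3F) n (stacks inp out src t o) ≡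
      stacks inp (spell (replicate t false) ʳ++ out) src t o
    run-count₃ inp out src t o h = trans
      (cong (run (rename (5F ∷ 3F ∷ []) (loopP p pour)) n)
        (frame (3F ∷ 1F ∷ 5F ∷ []) (loopP p tally) (tallied t out h) (stacks inp out src t o)))
      (frame (5F ∷ 3F ∷ []) (loopP p pour) (restored t h)
        (stacks inp (spell (replicate t false) ʳ++ out) src t o))

    run-count₄ : ∀ inp out src t o → o ≤ τ → run (count 4F) n (stacks inp out src t o) ≡
      stacks inp (spell (replicate o false) ʳ++ out) src t o
    run-count₄ inp out src t o h = trans
      (cong (run (rename (5F ∷ 4F ∷ []) (loopP p pour)) n)
        (frame (4F ∷ 1F ∷ 5F ∷ []) (loopP p tally) (tallied o out h) (stacks inp out src t o)))
      (frame (5F ∷ 4F ∷ []) (loopP p pour) (restored o h)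
        (stacks inp (spell (replicate o false) ʳ++ out) src t o))

    code-site : ∀ t o x y κ →
      code (var (site t o (x , y , κ))) ≡
      (true ∷ false ∷ true ∷ spell (if x then false ∷ [] else [])) ++ spell (replicate t false) ++
      spell (true ∷ (if y then false ∷ [] else [])) ++ spell (replicate o false) ++ name (true ∷ replicate κ false)
    code-site t o x y κ = cong (λ w → true ∷ false ∷ true ∷ w) (begin
      name (site t o (x , y , κ))
        ≡⟨ cong name (split x t _) ⟩
      name (bump x ++ replicate t false ++ true ∷ replicate (if y then suc o else o) false ++ true ∷ replicate κ false)
        ≡⟨ name-++ (bump x) _ ⟩
      spell (bump x) ++ name (replicate t false ++ _)
        ≡⟨ cong (spell (bump x) ++_) (name-++ (replicate t false) _) ⟩
      spell (bump x) ++ spell (replicate t false) ++ true ∷ true ∷ name (replicate (if y then suc o else o) false ++ _)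
        ≡⟨ cong (λ w → spell (bump x) ++ spell (replicate t false) ++ true ∷ true ∷ w)
             (trans (cong name (split y o _)) (trans (name-++ (bump y) _) (cong (spell (bump y) ++_) (name-++ (replicate o false) _)))) ⟩
      spell (bump x) ++ spell (replicate t false) ++ spell (true ∷ bump y) ++ spell (replicate o false) ++
        name (true ∷ replicate κ false) ∎)
      where
      open ≡-Reasoning
      bump : Bool → Word
      bump x = if x then false ∷ [] else []
      split : ∀ x t (w : Word) → replicate (if x then suc t else t) false ++ w ≡ bump x ++ replicate t false ++ w
      split true  t w = refl
      split false t w = refl

    run-pieces : ∀ w₁ w₃ w₅ inp out src t o → t ≤ τ → o ≤ τ →
      run (write w₁ ⨾ count 3F ⨾ write w₃ ⨾ count 4F ⨾ write w₅) n (stacks inp out src t o) ≡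
      stacks inp (w₅ ʳ++ spell (replicate o false) ʳ++ w₃ ʳ++ spell (replicate t false) ʳ++ w₁ ʳ++ out) src t o
    run-pieces w₁ w₃ w₅ inp out src t o h k
      rewrite run-write w₁ inp out src t o
            | run-count₃ inp (w₁ ʳ++ out) src t o h
            | run-write w₃ inp (spell (replicate t false) ʳ++ w₁ ʳ++ out) src t o
            | run-count₄ inp (w₃ ʳ++ spell (replicate t false) ʳ++ w₁ ʳ++ out) src t o k =
      run-write w₅ inp _ src t o

    run-emit : ∀ e inp out src t o → t ≤ τ → o ≤ τ →
      run (emit e) n (stacks inp out src t o) ≡ stacks inp (code (mapExp (site t o) e) ʳ++ out) src t o
    run-emit zero      inp out src t o h k = refl
    run-emit one       inp out src t o h k = refl
    run-emit (not e)   inp out src t o h k rewrite run-emit e inp out src t o h k =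
      trans (run-write (false ∷ true ∷ false ∷ []) inp _ src t o)
        (cong (λ w → stacks inp w src t o) (sym (++-ʳ++ (code (mapExp (site t o) e)))))
    run-emit (and e f) inp out src t o h k
      rewrite run-emit e inp out src t o h k | run-emit f inp (code (mapExp (site t o) e) ʳ++ out) src t o h k =
      trans (run-write (false ∷ true ∷ true ∷ []) inp _ src t o)
        (cong (λ w → stacks inp w src t o) (sym (trans (++-ʳ++ (code (mapExp (site t o) e)))
          (++-ʳ++ (code (mapExp (site t o) f))))))
    run-emit (or e f)  inp out src t o h k
      rewrite run-emit e inp out src t o h k | run-emit f inp (code (mapExp (site t o) e) ʳ++ out) src t o h k =
      trans (run-write (true ∷ false ∷ false ∷ []) inp _ src t o)
        (cong (λ w → stacks inp w src t o) (sym (trans (++-ʳ++ (code (mapExp (site t o) e)))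
          (++-ʳ++ (code (mapExp (site t o) f))))))
    run-emit (var (x , y , κ)) inp out src t o h k =
      trans (run-pieces w₁ w₃ w₅ inp out src t o h k)
        (cong (λ w → stacks inp w src t o) (sym (trans (cong (_ʳ++ out) (code-site t o x y κ))
          (trans (++-ʳ++ w₁) (trans (++-ʳ++ (spell (replicate t false))) (trans (++-ʳ++ w₃)
            (++-ʳ++ (spell (replicate o false)))))))))
      where
      w₁ w₃ w₅ : Word
      w₁ = true ∷ false ∷ true ∷ spell (if x then false ∷ [] else [])
      w₃ = spell (true ∷ (if y then false ∷ [] else []))
      w₅ = name (true ∷ replicate κ false)

    emit-and : ∀ f e inp src t o → t ≤ τ → o ≤ τ →
      run (emit f ⨾ write (false ∷ true ∷ true ∷ [])) n (stacks inp (code e ʳ++ []) src t o) ≡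
      stacks inp (code (and e (mapExp (site t o) f)) ʳ++ []) src t o
    emit-and f e inp src t o h k rewrite run-emit f inp (code e ʳ++ []) src t o h k =
      trans (run-write (false ∷ true ∷ true ∷ []) inp _ src t o)
        (cong (λ w → stacks inp w src t o) (sym (trans (++-ʳ++ (code e)) (++-ʳ++ (code (mapExp (site t o) f))))))

    run-clear : ∀ inp out src t o → o ≤ suc τ → run clear n (stacks inp out src t o) ≡ stacks inp out src t 0
    run-clear inp out src t o h = trans (run-loopP (p ⊕ const 1) (pop 4F λ _ → skip) n _)
      (go (τ + 1) o (≤-trans h (≤-reflexive (+-comm 1 τ))))
      where
      go : ∀ m o → o ≤ m → iter m (run (pop 4F λ _ → skip) n) (stacks inp out src t o) ≡ stacks inp out src t 0
      go zero    zero    h       = refl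
      go (suc m) zero    h       = go m zero z≤n
      go (suc m) (suc o) (s≤s h) = go m o h

module Reduction (M : TM) (p : Polynomial) where
  open Formula M
  open Tableau M using (isZero)
  open Emission p hiding (τ)

  -- The letter popped is the one at the current distance; beyond the input the stack is empty,
  -- which stands for a blank cell.
  initialStep : Prog 6
  initialStep = pop 2F λ x → (emit (initialExp x) ⨾ write (false ∷ true ∷ true ∷ [])) ⨾ push 4F true

  -- An empty distance counter means the head, where the windows have additional conditions; from a
  -- nonempty one the popped tick is put back before emitting.
  windowStep : Prog 6
  windowStep = pop 4F λ
    { nothing  → (emit (windowExp true) ⨾ write (false ∷ true ∷ true ∷ [])) ⨾ push 4F true
    ; (just b) → push 4F b ⨾ (emit (windowExp false) ⨾ write (false ∷ true ∷ true ∷ [])) ⨾ push 4F true }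

  rowStep : Prog 6
  rowStep = loopP p windowStep ⨾ clear ⨾ push 3F true

  -- The output starts with `one`, the empty conjunction, so that every further piece can be
  -- followed by the symbol for `and`. The first loop restores the original order of the input,
  -- which loading has reversed.
  reduction : Prog 6
  reduction =
    rename (0F ∷ 2F ∷ []) (loop pour) ⨾ write (false ∷ false ∷ true ∷ []) ⨾
    loopP (p ⊕ const 1) initialStep ⨾ clear ⨾
    loopP p rowStep ⨾ (emit acceptExp ⨾ write (false ∷ true ∷ true ∷ []))

  module _ (w : Word) where

    n : ℕ
    n = length w

    τ : ℕ
    τ = ⟦ p ⟧ n

    out : Exp Word → Word
    out e = code e ʳ++ []

    drop-suc : ∀ o (u : Word) → List.drop 1 (List.drop o u) ≡ List.drop (suc o) u
    drop-suc zero    u       = refl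
    drop-suc (suc o) []      = refl
    drop-suc (suc o) (_ ∷ u) = drop-suc o u

    run-initials : ∀ m o e → m + o ≤ suc τ →
      iter m (run initialStep n) (stacks n [] (out e) (List.drop o w) 0 o) ≡
      stacks n [] (out (collect (initials w) m o e)) (List.drop (m + o) w) 0 (m + o)
    run-initials zero    o e h = refl
    run-initials (suc m) o e h
      rewrite emit-and n (initialExp (List.head (List.drop o w))) e [] (List.drop 1 (List.drop o w)) 0 o z≤n
                (≤-trans (m≤n+m o m) (s≤s⁻¹ h))
            | drop-suc o w =
      trans (run-initials m (suc o) (and e (initials w o)) (≤-trans (≤-reflexive (+-suc m o)) h))
        (cong (λ k → stacks n [] (out (collect (initials w) (suc m) o e)) (List.drop k w) 0 k) (+-suc m o))

    run-window : ∀ src t o e → t ≤ τ → o ≤ τ → run windowStep n (stacks n [] (out e) src t o) ≡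
      stacks n [] (out (and e (windows t o))) src t (suc o)
    run-window src t zero    e h k rewrite emit-and n (windowExp true) e [] src t 0 h k = refl
    run-window src t (suc o) e h k rewrite emit-and n (windowExp false) e [] src t (suc o) h k = refl

    run-windows : ∀ src t m o e → t ≤ τ → m + o ≤ τ →
      iter m (run windowStep n) (stacks n [] (out e) src t o) ≡
      stacks n [] (out (collect (windows t) m o e)) src t (m + o)
    run-windows src t zero    o e h k = refl
    run-windows src t (suc m) o e h k
      rewrite run-window src t o e h (≤-trans (m≤n+m o (suc m)) k) =
      trans (run-windows src t m (suc o) (and e (windows t o)) h (≤-trans (≤-reflexive (+-suc m o)) k))
        (cong (λ j → stacks n [] (out (collect (windows t) (suc m) o e)) src t j) (+-suc m o))

    run-rows : ∀ src m t e → m + t ≤ τ →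
      iter m (run rowStep n) (stacks n [] (out e) src t 0) ≡ stacks n [] (out (grid τ m t e)) src (m + t) 0
    run-rows src zero    t e h = refl
    run-rows src (suc m) t e h = trans (cong (iter m (run rowStep n)) row)
      (trans (run-rows src m (suc t) (collect (windows t) τ 0 e) (≤-trans (≤-reflexive (+-suc m t)) h))
        (cong (λ j → stacks n [] (out (grid τ (suc m) t e)) src j 0) (+-suc m t)))
      where
      row : run rowStep n (stacks n [] (out e) src t 0) ≡ stacks n [] (out (collect (windows t) τ 0 e)) src (suc t) 0
      row
        rewrite run-loopP p windowStep n (stacks n [] (out e) src t 0)
              | run-windows src t τ 0 e (≤-trans (m≤n+m t (suc m)) h) (≤-reflexive (+-identityʳ τ))
              | run-clear n [] (out (collect (windows t) τ 0 e)) src t (τ + 0)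
                  (≤-trans (≤-reflexive (+-identityʳ τ)) (n≤1+n τ)) = refl

    run-reduction : run reduction n (List.reverse w ∷ [] ∷ Vec.replicate 4 []) ≡
      stacks n [] (out (formula τ w)) (List.drop (suc τ + 0) w) (τ + 0) 0
    run-reduction
      rewrite frame {n = n} (0F ∷ 2F ∷ []) (loop pour)
                (trans (run-pour n n (List.reverse w) [] (≤-reflexive (length-reverse w)))
                       (cong (λ u → [] ∷ u ∷ []) (reverse-involutive w)))
                (stacks n (List.reverse w) [] [] 0 0)
            | run-loopP (p ⊕ const 1) initialStep n (stacks n [] (out one) w 0 0)
            | +-comm τ 1
            | run-initials (suc τ) 0 one (≤-reflexive (+-identityʳ (suc τ)))
            | run-clear n [] (out (collect (initials w) (suc τ) 0 one)) (List.drop (suc τ + 0) w) 0 (suc τ + 0)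
                (≤-reflexive (+-identityʳ (suc τ)))
            | run-loopP p rowStep n (stacks n [] (out (collect (initials w) (suc τ) 0 one)) (List.drop (suc τ + 0) w) 0 0)
            | run-rows (List.drop (suc τ + 0) w) τ 0 (collect (initials w) (suc τ) 0 one) (≤-reflexive (+-identityʳ τ))
            | emit-and n acceptExp (grid τ τ 0 (collect (initials w) (suc τ) 0 one)) [] (List.drop (suc τ + 0) w) (τ + 0) 0
                (≤-reflexive (+-identityʳ τ)) z≤n
            | +-identityʳ τ = refl

    reduces : List.reverse (lookup (run reduction n (List.reverse w ∷ [] ∷ Vec.replicate 4 [])) 1F) ≡
      code (formula τ w)
    reduces = trans (cong (λ σ → List.reverse (lookup σ 1F)) run-reduction) (reverse-involutive (code (formula τ w)))

  abstract
    reduce : Word → Word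
    reduce w = List.reverse (lookup (run reduction (length w) (List.reverse w ∷ [] ∷ Vec.replicate 4 [])) 1F)

    reduce-computable : PolyTimeComputable reduce
    reduce-computable = compute reduction

    tableau : Word → Exp Word
    tableau w = formula (⟦ p ⟧ (length w)) w

    reduce-≡ : ∀ w → reduce w ≡ code (tableau w)
    reduce-≡ = reduces

    tableau-safe : ∀ w → Safe (tableau w)
    tableau-safe w = formula-safe (⟦ p ⟧ (length w)) w

    satisfiable⇒accepts : ∀ w β → value boolAlgebra β (tableau w) ≡ true → ∃[ k ] AcceptsIn M k w
    satisfiable⇒accepts w = formula-sound (⟦ p ⟧ (length w)) w

    accepts⇒satisfiable : ∀ w k → k ≤ ⟦ p ⟧ (length w) → AcceptsIn M k w →
      ∃[ β ] value boolAlgebra β (tableau w) ≡ true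
    accepts⇒satisfiable w = formula-complete (⟦ p ⟧ (length w)) w

-- The verifier

pattern 10F = suc 9F
pattern 11F = suc 10F

-- Reading an empty stack as `false` pads short certificates; elsewhere the lengths are known and
-- the choice is immaterial.
pop′ : ∀ {k} → Fin k → (Bool → Prog k) → Prog k
pop′ i P = pop i (P ∘ Maybe.fromMaybe false)

padded : ℕ → Word → Word
padded zero    xs       = []
padded (suc m) []       = false ∷ padded m []
padded (suc m) (x ∷ xs) = x ∷ padded m xs

length-padded : ∀ m xs → length (padded m xs) ≡ m
length-padded zero    xs       = refl
length-padded (suc m) []       = cong suc (length-padded m [])
length-padded (suc m) (x ∷ xs) = cong suc (length-padded m xs)

padded-exact : ∀ xs → padded (length xs) xs ≡ xs
padded-exact []       = refl
padded-exact (x ∷ xs) = cong (x ∷_) (padded-exact xs)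

drop-exact : ∀ (xs ys : Word) → List.drop (length xs) (xs ++ ys) ≡ ys
drop-exact []       ys = refl
drop-exact (x ∷ xs) ys = drop-exact xs ys

replicate-ʳ++ : ∀ m (b : Bool) z → replicate m b ʳ++ z ≡ replicate m b ++ z
replicate-ʳ++ zero    b z = refl
replicate-ʳ++ (suc m) b z = trans (replicate-ʳ++ m b (b ∷ z)) (go m)
  where
  go : ∀ m → replicate m b ++ b ∷ z ≡ b ∷ replicate m b ++ z
  go zero    = refl
  go (suc m) = cong (b ∷_) (go m)

-- The longest prefix of trues, padded with falses.
normal : Bool → Word → Word
normal f []       = []
normal f (u ∷ us) = (f ∧ u) ∷ normal (f ∧ u) us

length-normal : ∀ f us → length (normal f us) ≡ length us
length-normal f []       = refl
length-normal f (u ∷ us) = cong suc (length-normal (f ∧ u) us)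

normal-unary : ∀ m us → length us ≡ m → normal true us ≡ unary (index m us)
normal-unary zero    []           h = refl
normal-unary (suc m) (true ∷ us)  h = cong (true ∷_) (normal-unary m us (suc-injective h))
normal-unary (suc m) (false ∷ us) h = cong (false ∷_) (go m us (suc-injective h))
  where
  go : ∀ m us → length us ≡ m → normal false us ≡ unary {m} zero
  go zero    []       h = refl
  go (suc m) (u ∷ us) h = cong (false ∷_) (go m us (suc-injective h))

normal-fixed : ∀ m u → Unary m u → normal true u ≡ u
normal-fixed m u (i , refl) = trans (normal-unary m (unary i) (length-unary i)) (cong unary (index-unary i))

-- Stack subroutines with a fixed number of rounds

copy : Prog 2
copy = pop′ 0F λ b → push 1F b

discard : Prog 1
discard = pop 0F λ _ → skip

copy₂ : Prog 3
copy₂ = pop′ 0F λ b → push 1F b ⨾ push 2F b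

blanks : Prog 1
blanks = push 0F false

choose : Bool → Prog 3
choose c = pop′ 0F λ a → pop′ 1F λ b → push 2F (if c then a else b)

compare : Prog 5
compare = pop′ 0F λ a → pop′ 1F λ b → push 2F a ⨾ push 3F b ⨾ pop′ 4F λ f → push 4F (f ∧ (a == b))

normalise : Prog 3
normalise = pop′ 0F λ u → pop′ 1F λ f → push 1F (f ∧ u) ⨾ push 2F (f ∧ u)

module _ {n : ℕ} where

  iter-copy : ∀ m (xs r ys : Word) → length xs ≡ m → iter m (run copy n) ((xs ++ r) ∷ ys ∷ []) ≡ r ∷ (xs ʳ++ ys) ∷ []
  iter-copy zero    []       r ys h = refl
  iter-copy (suc m) (x ∷ xs) r ys h = iter-copy m xs r (x ∷ ys) (suc-injective h)

  iter-restore : ∀ m (xs ys : Word) → length xs ≡ m →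
    iter m (run copy n) ((xs ʳ++ []) ∷ ys ∷ []) ≡ [] ∷ (xs ++ ys) ∷ []
  iter-restore m xs ys h = begin
    iter m (run copy n) ((xs ʳ++ []) ∷ ys ∷ [])          ≡⟨ cong (λ z → iter m (run copy n) (z ∷ ys ∷ [])) (++-identityʳ (xs ʳ++ [])) ⟨
    iter m (run copy n) (((xs ʳ++ []) ++ []) ∷ ys ∷ [])  ≡⟨ iter-copy m (xs ʳ++ []) [] ys (trans (length-reverse xs) h) ⟩
    [] ∷ ((xs ʳ++ []) ʳ++ ys) ∷ []                       ≡⟨ cong (λ z → [] ∷ z ∷ []) (ʳ++-ʳ++ xs) ⟩
    [] ∷ (xs ++ ys) ∷ []                                 ∎
    where open ≡-Reasoning

  iter-padded : ∀ m (xs ys : Word) → iter m (run copy n) (xs ∷ ys ∷ []) ≡ List.drop m xs ∷ (padded m xs ʳ++ ys) ∷ []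
  iter-padded zero    xs       ys = refl
  iter-padded (suc m) []       ys = trans (iter-padded m [] (false ∷ ys)) (cong (_∷ (padded m [] ʳ++ false ∷ ys) ∷ []) (drop-all m [] z≤n))
  iter-padded (suc m) (x ∷ xs) ys = iter-padded m xs (x ∷ ys)

  iter-discard : ∀ m (xs : Word) → iter m (run discard n) (xs ∷ []) ≡ List.drop m xs ∷ []
  iter-discard zero    xs       = refl
  iter-discard (suc m) []       = trans (iter-discard m []) (cong (_∷ []) (drop-all m [] z≤n))
  iter-discard (suc m) (x ∷ xs) = iter-discard m xs

  iter-copy₂ : ∀ m (xs r ys zs : Word) → length xs ≡ m →
    iter m (run copy₂ n) ((xs ++ r) ∷ ys ∷ zs ∷ []) ≡ r ∷ (xs ʳ++ ys) ∷ (xs ʳ++ zs) ∷ []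
  iter-copy₂ zero    []       r ys zs h = refl
  iter-copy₂ (suc m) (x ∷ xs) r ys zs h = iter-copy₂ m xs r (x ∷ ys) (x ∷ zs) (suc-injective h)

  iter-blanks : ∀ m (ys : Word) → iter m (run blanks n) (ys ∷ []) ≡ (replicate m false ʳ++ ys) ∷ []
  iter-blanks zero    ys = refl
  iter-blanks (suc m) ys = iter-blanks m (false ∷ ys)

  iter-choose : ∀ c m (xs ys zs : Word) → length xs ≡ m → length ys ≡ m →
    iter m (run (choose c) n) (xs ∷ ys ∷ zs ∷ []) ≡ [] ∷ [] ∷ ((if c then xs else ys) ʳ++ zs) ∷ []
  iter-choose true  zero    []       []       zs h k = refl
  iter-choose false zero    []       []       zs h k = refl
  iter-choose true  (suc m) (x ∷ xs) (y ∷ ys) zs h k = iter-choose true m xs ys (x ∷ zs) (suc-injective h) (suc-injective k)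
  iter-choose false (suc m) (x ∷ xs) (y ∷ ys) zs h k = iter-choose false m xs ys (y ∷ zs) (suc-injective h) (suc-injective k)

  iter-compare : ∀ m f (xs ys r s p q : Word) → length xs ≡ m → length ys ≡ m →
    iter m (run compare n) ((xs ++ r) ∷ (ys ++ s) ∷ p ∷ q ∷ (f ∷ []) ∷ []) ≡
    r ∷ s ∷ (xs ʳ++ p) ∷ (ys ʳ++ q) ∷ ((f ∧ same xs ys) ∷ []) ∷ []
  iter-compare zero    f []       []       r s p q h k = cong (λ b → r ∷ s ∷ p ∷ q ∷ (b ∷ []) ∷ []) (sym (∧-identityʳ f))
  iter-compare (suc m) f (x ∷ xs) (y ∷ ys) r s p q h k =
    trans (iter-compare m (f ∧ (x == y)) xs ys r s (x ∷ p) (y ∷ q) (suc-injective h) (suc-injective k))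
      (cong (λ b → r ∷ s ∷ (xs ʳ++ x ∷ p) ∷ (ys ʳ++ y ∷ q) ∷ (b ∷ []) ∷ []) (∧-assoc f (x == y) (same xs ys)))

  iter-normalise : ∀ m f (us zs : Word) → length us ≡ m →
    ∃[ g ] iter m (run normalise n) (us ∷ (f ∷ []) ∷ zs ∷ []) ≡ [] ∷ (g ∷ []) ∷ (normal f us ʳ++ zs) ∷ []
  iter-normalise zero    f []       zs h = f , refl
  iter-normalise (suc m) f (u ∷ us) zs h = iter-normalise m (f ∧ u) us ((f ∧ u) ∷ zs) (suc-injective h)

  looped : ∀ {k} q (P : Prog k) {σ σ′} → iter (⟦ q ⟧ n) (run P n) σ ≡ σ′ → run (loopP q P) n σ ≡ σ′
  looped q P {σ} e = trans (run-loopP q P n σ) e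

  sequence : ∀ {k} (P Q : Prog k) {σ σ′ σ″} → run P n σ ≡ σ′ → run Q n σ′ ≡ σ″ → run (P ⨾ Q) n σ ≡ σ″
  sequence P Q e e′ = trans (cong (run Q n) e) e′

-- Names vary in length. Pairs headed by `true` for digits and by `false` for padding bring them to
-- a common length, so that keys can be compared bit by bit.
key : ℕ → Word → Word
key zero    x       = []
key (suc m) []      = false ∷ false ∷ key m []
key (suc m) (b ∷ x) = true ∷ b ∷ key m x

length-key : ∀ m x → length (key m x) ≡ m + m
length-key zero    x       = refl
length-key (suc m) []      = cong suc (trans (cong suc (length-key m [])) (sym (+-suc m m)))
length-key (suc m) (b ∷ x) = cong suc (trans (cong suc (length-key m x)) (sym (+-suc m m)))

key-injective : ∀ m x y → length x ≤ m → length y ≤ m → key m x ≡ key m y → x ≡ y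
key-injective m       []      []      h       k       e = refl
key-injective (suc m) []      (b ∷ y) h       k       ()
key-injective (suc m) (a ∷ x) []      h       k       ()
key-injective (suc m) (a ∷ x) (b ∷ y) (s≤s h) (s≤s k) e with ∷-injective (proj₂ (∷-injective e))
... | refl , e′ = cong (a ∷_) (key-injective m x y h k e′)

-- Reads a name and pads it; the third stack tells that the name is complete,
-- and the fourth that it was incomplete.
spelling : Prog 4
spelling = pop 2F λ
  { (just b) → push 2F b ⨾ push 1F false ⨾ push 1F false
  ; nothing  → pop 0F λ
    { nothing      → push 3F true ⨾ push 2F true
    ; (just false) → push 2F true ⨾ push 1F false ⨾ push 1F false
    ; (just true)  → pop 0F λ
      { nothing  → push 3F true ⨾ push 2F true
      ; (just b) → push 1F true ⨾ push 1F b } } }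

iter-spelled : ∀ n m (r z fail : Word) →
  iter m (run spelling n) (r ∷ z ∷ (true ∷ []) ∷ fail ∷ []) ≡ r ∷ (key m [] ʳ++ z) ∷ (true ∷ []) ∷ fail ∷ []
iter-spelled n zero    r z fail = refl
iter-spelled n (suc m) r z fail = iter-spelled n m r (false ∷ false ∷ z) fail

Spelled : ℕ → Word → Maybe (Word × Word) → Stacks 4 → Set
Spelled m z (just (x , r)) σ = σ ≡ r ∷ (key m x ʳ++ z) ∷ (true ∷ []) ∷ [] ∷ []
Spelled m z nothing        σ = ∃[ r ] ∃[ y ] σ ≡ r ∷ y ∷ (true ∷ []) ∷ (true ∷ []) ∷ []

-- A round takes one digit, or meets the end of the name, or notices that the input is cut short, so
-- fewer than `m` bits are settled within `m` rounds. The round at the end of the name and all later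
-- ones pad the key.
iter-spelling : ∀ n m w (z : Word) → length w < m →
  Spelled m z (readName w) (iter m (run spelling n) (w ∷ z ∷ [] ∷ [] ∷ []))
iter-spelling n (suc m) []              z h       = _ , _ , iter-spelled n m [] z (true ∷ [])
iter-spelling n (suc m) (false ∷ w)     z h       = iter-spelled n m w (false ∷ false ∷ z) []
iter-spelling n (suc m) (true ∷ [])     z h       = _ , _ , iter-spelled n m [] z (true ∷ [])
iter-spelling n (suc m) (true ∷ b ∷ w)  z (s≤s h)
  with readName w | iter-spelling n m w (b ∷ true ∷ z) (≤-trans (n≤1+n _) h)
... | just _  | e = e
... | nothing | e = e

-- Tables from names to codes of elements

Entry : Set
Entry = Word × Word

flat : List Entry → Word
flat []             = []
flat ((k , c) ∷ es) = k ++ c ++ flat es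

-- The last match wins.
find : Word → Word → List Entry → Word
find k d []              = d
find k d ((k′ , c) ∷ es) = find k (if same k k′ then c else d) es

Sized : ℕ → ℕ → List Entry → Set
Sized l m = All (λ e → length (proj₁ e) ≡ l × length (proj₂ e) ≡ m)

length-find : ∀ {l m} k d es → length d ≡ m → Sized l m es → length (find k d es) ≡ m
length-find k d []             h []               = h
length-find k d ((k′ , c) ∷ es) h ((_ , h′) ∷ hs) with same k k′
... | true  = length-find k c es h′ hs
... | false = length-find k d es h hs

-- The leading bit separates the test for emptiness from the reading of the kind: one pop tells
-- whether there is a value, and the pops after it may rely on that.
encode : Element → Word
encode ((k , s) , u) = true ∷ k ∷ s ∷ u

encodes : List Element → Word
encodes []       = []
encodes (x ∷ xs) = encode x ++ encodes xs

-- Normalising the word makes every certificate yield names of actual atoms, so soundness asks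
-- nothing of the certificate.
element : Word → Element
element (k ∷ s ∷ u) = (k , s) , normal true u
element _           = (false , false) , []

split : ∀ i j (t : Word) → length t ≡ i + j → ∃[ x ] ∃[ y ] t ≡ x ++ y × length x ≡ i × length y ≡ j
split zero    j t       h = [] , t , refl , refl , h
split (suc i) j (b ∷ t) h with split i j t (suc-injective h)
... | x , y , refl , hx , hy = b ∷ x , y , refl , cong suc hx , hy

-- Fixed widths leave no format to check: cutting at multiples of the entry size always succeeds.
parse-table : ∀ i l c (t : Word) → length t ≡ i * (l + c) → ∃[ es ] length es ≡ i × Sized l c es × flat es ≡ t
parse-table zero    l c []      h = [] , refl , [] , refl
parse-table (suc i) l c t       h with split (l + c) (i * (l + c)) t h
... | xy , z , refl , hxy , hz with split l c xy hxy | parse-table i l c z hz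
... | x , y , refl , hx , hy | es , he , hs , refl = (x , y) ∷ es , cong suc he , (hx , hy) ∷ hs , sym (++-assoc x y (flat es))

module Verifier (W : Polynomial) (test : Kind → Bool) where

  abstract
    -- A name occurring in an input of length `n` has at most `n` digits, with two bits each in a
    -- key. A code has two bits for the kind besides the name of an atom. At most `n` variables
    -- occur, so `n` entries suffice.
    keyLength codeLength tableLength : Polynomial
    keyLength   = X ⊕ X
    codeLength  = const 2 ⊕ W
    tableLength = X ⊗ (keyLength ⊕ codeLength)

    keyLength-≡ : ∀ n → ⟦ keyLength ⟧ n ≡ n + n
    keyLength-≡ n = refl

    codeLength-≡ : ∀ n → ⟦ codeLength ⟧ n ≡ 2 + ⟦ W ⟧ n
    codeLength-≡ n = refl

    tableLength-≡ : ∀ n → ⟦ tableLength ⟧ n ≡ n * (⟦ keyLength ⟧ n + ⟦ codeLength ⟧ n)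
    tableLength-≡ n = refl

  -- On a match the earlier result is discarded, which is why the last match wins. In either case
  -- the entry goes to the copy of the table, from which the table is restored.
  select : Bool → Prog 6
  select true  = rename (4F ∷ []) (loopP codeLength discard) ⨾ rename (2F ∷ 3F ∷ 4F ∷ []) (loopP codeLength copy₂)
  select false = rename (2F ∷ 3F ∷ []) (loopP codeLength copy)

  -- The stacks are: the key, a copy, the table, a copy, the result, a flag.
  probe : Prog 6
  probe = push 5F true ⨾ rename (0F ∷ 2F ∷ 1F ∷ 3F ∷ 5F ∷ []) (loopP keyLength compare) ⨾
    rename (1F ∷ 0F ∷ []) (loopP keyLength copy) ⨾ pop′ 5F select

  search : Prog 6
  search = rename (4F ∷ []) (loopP codeLength blanks) ⨾ loop probe ⨾
    rename (3F ∷ 2F ∷ []) (loopP tableLength copy) ⨾ rename (0F ∷ []) (loopP keyLength discard)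

  -- The stacks are: the code found (reversed), a copy, a flag, the values.
  store : Prog 4
  store = rename (0F ∷ 1F ∷ []) (loopP codeLength copy) ⨾ pop′ 1F λ k → pop′ 1F λ s →
    push 2F true ⨾ rename (1F ∷ 2F ∷ 0F ∷ []) (loopP W normalise) ⨾ pop 2F (λ _ → skip) ⨾
    rename (0F ∷ 3F ∷ []) (loopP W copy) ⨾ push 3F s ⨾ push 3F k ⨾ push 3F true

  module _ (n : ℕ) where

    private
      l m c : ℕ
      l = ⟦ keyLength ⟧ n
      c = ⟦ codeLength ⟧ n
      m = ⟦ W ⟧ n

    blank-code : Word
    blank-code = replicate c false

    run-select : ∀ b k (x d r t : Word) → length x ≡ c → length d ≡ c →
      run (select b) n (k ∷ [] ∷ (x ++ r) ∷ t ∷ (d ʳ++ []) ∷ [] ∷ []) ≡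
      k ∷ [] ∷ r ∷ (x ʳ++ t) ∷ ((if b then x else d) ʳ++ []) ∷ [] ∷ []
    run-select true  k x d r t h h′ = sequence
      (rename (4F ∷ []) (loopP codeLength discard)) (rename (2F ∷ 3F ∷ 4F ∷ []) (loopP codeLength copy₂))
      (frame (4F ∷ []) (loopP codeLength discard)
        (looped codeLength discard (trans (iter-discard {n} c (d ʳ++ []))
          (cong (_∷ []) (drop-all c (d ʳ++ []) (≤-reflexive (trans (length-reverse d) h′))))))
        (k ∷ [] ∷ (x ++ r) ∷ t ∷ (d ʳ++ []) ∷ [] ∷ []))
      (frame (2F ∷ 3F ∷ 4F ∷ []) (loopP codeLength copy₂) (looped codeLength copy₂ (iter-copy₂ {n} c x r t [] h))
        (k ∷ [] ∷ (x ++ r) ∷ t ∷ [] ∷ [] ∷ []))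
    run-select false k x d r t h h′ = frame (2F ∷ 3F ∷ []) (loopP codeLength copy)
      (looped codeLength copy (iter-copy {n} c x r t h)) (k ∷ [] ∷ (x ++ r) ∷ t ∷ (d ʳ++ []) ∷ [] ∷ [])

    run-probe : ∀ k k′ (x d r t : Word) → length k ≡ l → length k′ ≡ l → length x ≡ c → length d ≡ c →
      run probe n (k ∷ [] ∷ (k′ ++ x ++ r) ∷ t ∷ (d ʳ++ []) ∷ [] ∷ []) ≡
      k ∷ [] ∷ r ∷ ((k′ ++ x) ʳ++ t) ∷ ((if same k k′ then x else d) ʳ++ []) ∷ [] ∷ []
    run-probe k k′ x d r t hk hk′ hx hd = sequence
      (rename (0F ∷ 2F ∷ 1F ∷ 3F ∷ 5F ∷ []) (loopP keyLength compare))
      (rename (1F ∷ 0F ∷ []) (loopP keyLength copy) ⨾ pop′ 5F select)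
      (frame (0F ∷ 2F ∷ 1F ∷ 3F ∷ 5F ∷ []) (loopP keyLength compare)
        (looped keyLength compare compared)
        (k ∷ [] ∷ (k′ ++ x ++ r) ∷ t ∷ (d ʳ++ []) ∷ (true ∷ []) ∷ []))
      (sequence (rename (1F ∷ 0F ∷ []) (loopP keyLength copy)) (pop′ 5F select)
        (frame (1F ∷ 0F ∷ []) (loopP keyLength copy)
          (looped keyLength copy (trans (iter-restore {n} l k [] hk) (cong (λ k → [] ∷ k ∷ []) (++-identityʳ k))))
          ([] ∷ (k ʳ++ []) ∷ (x ++ r) ∷ (k′ ʳ++ t) ∷ (d ʳ++ []) ∷ (same k k′ ∷ []) ∷ []))
        (trans (run-select (same k k′) k x d r (k′ ʳ++ t) hx hd)
          (cong (λ t → k ∷ [] ∷ r ∷ t ∷ ((if same k k′ then x else d) ʳ++ []) ∷ [] ∷ []) (sym (++-ʳ++ k′)))))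
      where
      compared : iter l (run compare n) (k ∷ (k′ ++ x ++ r) ∷ [] ∷ t ∷ (true ∷ []) ∷ []) ≡
        [] ∷ (x ++ r) ∷ (k ʳ++ []) ∷ (k′ ʳ++ t) ∷ (same k k′ ∷ []) ∷ []
      compared = trans
        (cong (λ k⁺ → iter l (run compare n) (k⁺ ∷ (k′ ++ x ++ r) ∷ [] ∷ t ∷ (true ∷ []) ∷ [])) (sym (++-identityʳ k)))
        (iter-compare {n} l true k k′ [] (x ++ r) [] t hk hk′)

    iter-probe : ∀ k (d t : Word) es → length k ≡ l → length d ≡ c → Sized l c es →
      iter (length es) (run probe n) (k ∷ [] ∷ flat es ∷ t ∷ (d ʳ++ []) ∷ [] ∷ []) ≡
      k ∷ [] ∷ [] ∷ (flat es ʳ++ t) ∷ (find k d es ʳ++ []) ∷ [] ∷ []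
    iter-probe k d t []             hk hd []                  = refl
    iter-probe k d t ((k′ , x) ∷ es) hk hd ((hk′ , hx) ∷ hs) = trans
      (cong (iter (length es) (run probe n)) (run-probe k k′ x d (flat es) t hk hk′ hx hd))
      (trans (iter-probe k (if same k k′ then x else d) ((k′ ++ x) ʳ++ t) es hk chosen hs)
        (cong (λ t → k ∷ [] ∷ [] ∷ t ∷ (find k (if same k k′ then x else d) es ʳ++ []) ∷ [] ∷ [])
          (trans (sym (++-ʳ++ (k′ ++ x))) (cong (_ʳ++ t) (++-assoc k′ x (flat es))))))
      where
      chosen : length (if same k k′ then x else d) ≡ c
      chosen with same k k′
      ... | true  = hx
      ... | false = hd

    length-flat : ∀ es → Sized l c es → length (flat es) ≡ length es * (l + c)
    length-flat []             []               = refl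
    length-flat ((k , x) ∷ es) ((hk , hx) ∷ hs) = begin
      length (k ++ x ++ flat es)                  ≡⟨ length-++ k ⟩
      length k + length (x ++ flat es)            ≡⟨ cong (length k +_) (length-++ x) ⟩
      length k + (length x + length (flat es))    ≡⟨ cong₂ (λ i j → i + (j + length (flat es))) hk hx ⟩
      l + (c + length (flat es))                  ≡⟨ +-assoc l c _ ⟨
      l + c + length (flat es)                    ≡⟨ cong (l + c +_) (length-flat es hs) ⟩
      l + c + length es * (l + c)                 ∎
      where open ≡-Reasoning

    found : Word → List Entry → Word
    found k es = find k blank-code es

    run-search : ∀ k es → length k ≡ l → length es ≡ n → Sized l c es →
      run search n (k ∷ [] ∷ flat es ∷ [] ∷ [] ∷ [] ∷ []) ≡
      [] ∷ [] ∷ flat es ∷ [] ∷ (found k es ʳ++ []) ∷ [] ∷ []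
    run-search k es hk he hs = sequence
      (rename (4F ∷ []) (loopP codeLength blanks))
      (loop probe ⨾ rename (3F ∷ 2F ∷ []) (loopP tableLength copy) ⨾ rename (0F ∷ []) (loopP keyLength discard))
      (frame (4F ∷ []) (loopP codeLength blanks) (looped codeLength blanks (iter-blanks {n} c []))
        (k ∷ [] ∷ flat es ∷ [] ∷ [] ∷ [] ∷ []))
      (sequence (loop probe)
        (rename (3F ∷ 2F ∷ []) (loopP tableLength copy) ⨾ rename (0F ∷ []) (loopP keyLength discard))
        (subst (λ j → iter j (run probe n) (k ∷ [] ∷ flat es ∷ [] ∷ (blank-code ʳ++ []) ∷ [] ∷ []) ≡
            k ∷ [] ∷ [] ∷ (flat es ʳ++ []) ∷ (found k es ʳ++ []) ∷ [] ∷ []) he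
          (iter-probe k blank-code [] es hk (length-replicate c) hs))
        (sequence (rename (3F ∷ 2F ∷ []) (loopP tableLength copy)) (rename (0F ∷ []) (loopP keyLength discard))
          (frame (3F ∷ 2F ∷ []) (loopP tableLength copy)
            (looped tableLength copy (trans (iter-restore {n} (⟦ tableLength ⟧ n) (flat es) [] size)
              (cong (λ t → [] ∷ t ∷ []) (++-identityʳ (flat es)))))
            (k ∷ [] ∷ [] ∷ (flat es ʳ++ []) ∷ (found k es ʳ++ []) ∷ [] ∷ []))
          (frame (0F ∷ []) (loopP keyLength discard)
            (looped keyLength discard (trans (iter-discard {n} l k) (cong (_∷ []) (drop-all l k (≤-reflexive hk)))))
            (k ∷ [] ∷ flat es ∷ [] ∷ (found k es ʳ++ []) ∷ [] ∷ []))))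
      where
      size : length (flat es) ≡ ⟦ tableLength ⟧ n
      size = trans (length-flat es hs) (trans (cong (_* (l + c)) he) (sym (tableLength-≡ n)))

    run-store : ∀ (x val : Word) → length x ≡ c →
      run store n ((x ʳ++ []) ∷ [] ∷ [] ∷ val ∷ []) ≡ [] ∷ [] ∷ [] ∷ (encode (element x) ++ val) ∷ []
    run-store x val h = go x (trans h (codeLength-≡ n)) (frame (0F ∷ 1F ∷ []) (loopP codeLength copy)
      (looped codeLength copy (trans (iter-restore {n} c x [] h) (cong (λ t → [] ∷ t ∷ []) (++-identityʳ x))))
      ((x ʳ++ []) ∷ [] ∷ [] ∷ val ∷ []))
      where
      go : ∀ x → length x ≡ 2 + m → ∀ {σ} →
        run (rename (0F ∷ 1F ∷ []) (loopP codeLength copy)) n σ ≡ [] ∷ x ∷ [] ∷ val ∷ [] →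
        run store n σ ≡ [] ∷ [] ∷ [] ∷ (encode (element x) ++ val) ∷ []
      go (k ∷ s ∷ u) h {σ} e with iter-normalise {n} m true u [] (suc-injective (suc-injective h))
      ... | g , e′ rewrite e
        | frame (1F ∷ 2F ∷ 0F ∷ []) (loopP W normalise) (looped W normalise e′) ([] ∷ u ∷ (true ∷ []) ∷ val ∷ []) =
        cong (λ σ → run (push 3F s ⨾ push 3F k ⨾ push 3F true) n σ)
          (frame (0F ∷ 3F ∷ []) (loopP W copy)
            (looped W copy (iter-restore {n} m (normal true u) val
              (trans (length-normal true u) (suc-injective (suc-injective h)))))
            ((normal true u ʳ++ []) ∷ [] ∷ [] ∷ val ∷ []))

  -- The stacks are: the values, three scratch stacks, a flag, the failures.
  merge : (Kind → Kind → Bool → Kind × Bool) → Kind → Kind → Bool → Prog 6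
  merge f κ₁ κ₂ e = rename (3F ∷ 1F ∷ 0F ∷ []) (loopP W (choose (proj₂ (f κ₁ κ₂ e)))) ⨾
    push 0F (proj₂ (proj₁ (f κ₁ κ₂ e))) ⨾ push 0F (proj₁ (proj₁ (f κ₁ κ₂ e))) ⨾ push 0F true

  -- There are finitely many kinds, so they are held in the control, as parameters of the program;
  -- only the words need loops.
  second : (Kind → Kind → Bool → Kind × Bool) → Kind → Prog 6
  second f κ₂ = pop 0F λ
    { nothing  → push 5F true
    ; (just _) → pop′ 0F λ k → pop′ 0F λ s → push 4F true ⨾
        rename (0F ∷ 2F ∷ 3F ∷ 1F ∷ 4F ∷ []) (loopP W compare) ⨾ pop′ 4F (merge f (k , s) κ₂) }

  binary : (Kind → Kind → Bool → Kind × Bool) → Prog 6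
  binary f = pop 0F λ
    { nothing  → push 5F true
    ; (just _) → pop′ 0F λ k → pop′ 0F λ s →
        rename (0F ∷ 1F ∷ []) (loopP W copy) ⨾ rename (1F ∷ 2F ∷ []) (loopP W copy) ⨾ second f (k , s) }

  unary-not : Prog 2
  unary-not = pop 0F λ
    { nothing  → push 1F true
    ; (just _) → pop′ 0F λ k → pop′ 0F λ s → push 0F (¬ᵇ s) ⨾ push 0F k ⨾ push 0F true }

  constantly : Bool → Prog 1
  constantly b = loopP W blanks ⨾ push 0F b ⨾ push 0F false ⨾ push 0F true

  -- The stacks are: the reversed input, the certificate and the verdict, the
  -- input, the table and a copy, the name and a copy, the code found and a
  -- copy, the values, a flag, the failures.
  fetch : Prog 12
  fetch = rename (6F ∷ 5F ∷ []) (loopP keyLength copy) ⨾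
    rename (5F ∷ 6F ∷ 3F ∷ 4F ∷ 7F ∷ 10F ∷ []) search ⨾ rename (7F ∷ 8F ∷ 10F ∷ 9F ∷ []) store

  resume : Prog 12
  resume = pop 10F (λ _ → skip) ⨾ pop 11F λ { (just b) → push 11F b ; nothing → fetch }

  lookupName : Prog 12
  lookupName = rename (2F ∷ 6F ∷ 10F ∷ 11F ∷ []) (loop spelling) ⨾ resume

  operate : (Kind → Kind → Bool → Kind × Bool) → Prog 12
  operate f = rename (9F ∷ 7F ∷ 8F ∷ 6F ∷ 10F ∷ 11F ∷ []) (binary f)

  symbolP : Bool → Bool → Bool → Prog 12
  symbolP false false false = rename (9F ∷ []) (constantly false)
  symbolP false false true  = rename (9F ∷ []) (constantly true)
  symbolP false true  false = rename (9F ∷ 11F ∷ []) unary-not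
  symbolP false true  true  = operate meet
  symbolP true  false false = operate join
  symbolP true  false true  = lookupName
  symbolP true  true  _     = push 11F true

  -- One symbol per round. A raised failure flag or an exhausted input makes the remaining rounds
  -- idle, so as many rounds as the input has bits are enough.
  body₁ : Prog 12
  body₁ = pop 11F λ
    { (just b) → push 11F b
    ; nothing  → pop 2F λ
      { nothing  → skip
      ; (just a) → pop 2F λ
        { nothing  → push 11F true
        ; (just b) → pop 2F λ
          { nothing  → push 11F true
          ; (just c) → symbolP a b c } } } }

  -- Recognises the parser result `just ([] , v ∷ [])`: after one value has been removed, the
  -- leading bit of a second one would show up in the last pop.
  judge : Prog 12
  judge = pop 11F λ
    { (just _) → push 1F false
    ; nothing  → pop 2F λ
      { (just _) → push 1F false
      ; nothing  → pop 9F λ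
        { nothing  → push 1F false
        ; (just _) → pop′ 9F λ k → pop′ 9F λ s → rename (9F ∷ []) (loopP W discard) ⨾
          pop 9F λ { (just _) → push 1F false ; nothing → push 1F (test (k , s)) } } } }

  -- Copying a fixed number of bits cuts or pads a certificate of the wrong length, so every
  -- certificate is treated as a table.
  verifier : Prog 12
  verifier = rename (0F ∷ 2F ∷ []) (loop pour) ⨾ rename (1F ∷ 3F ∷ []) (loopP tableLength copy) ⨾
    loop body₁ ⨾ judge

  module _ (n : ℕ) where

    private
      w′ = ⟦ W ⟧ n

    run-merge : ∀ f κ₁ κ₂ e (u v val : Word) → length u ≡ w′ → length v ≡ w′ →
      run (merge f κ₁ κ₂ e) n (val ∷ (v ʳ++ []) ∷ [] ∷ (u ʳ++ []) ∷ [] ∷ [] ∷ []) ≡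
      (encode (proj₁ (f κ₁ κ₂ e) , (if proj₂ (f κ₁ κ₂ e) then u else v)) ++ val) ∷ [] ∷ [] ∷ [] ∷ [] ∷ [] ∷ []
    run-merge f κ₁ κ₂ e u v val hu hv = trans
      (cong (run (push 0F (proj₂ κ) ⨾ push 0F (proj₁ κ) ⨾ push 0F true) n)
        (frame (3F ∷ 1F ∷ 0F ∷ []) (loopP W (choose b))
          (looped W (choose b) (iter-choose {n} b w′ (u ʳ++ []) (v ʳ++ []) val
            (trans (length-reverse u) hu) (trans (length-reverse v) hv)))
          (val ∷ (v ʳ++ []) ∷ [] ∷ (u ʳ++ []) ∷ [] ∷ [] ∷ [])))
      (cong (λ z → (true ∷ proj₁ κ ∷ proj₂ κ ∷ z) ∷ [] ∷ [] ∷ [] ∷ [] ∷ [] ∷ []) (chosen b))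
      where
      κ = proj₁ (f κ₁ κ₂ e)
      b = proj₂ (f κ₁ κ₂ e)
      chosen : ∀ b → (if b then u ʳ++ [] else v ʳ++ []) ʳ++ val ≡ (if b then u else v) ++ val
      chosen true  = ʳ++-ʳ++ u
      chosen false = ʳ++-ʳ++ v

    copied : ∀ (v r : Word) → length v ≡ w′ → ∀ P →
      run (rename (0F ∷ 1F ∷ []) (loopP W copy) ⨾ rename (1F ∷ 2F ∷ []) (loopP W copy) ⨾ P) n
        ((v ++ r) ∷ [] ∷ [] ∷ [] ∷ [] ∷ [] ∷ []) ≡ run P n (r ∷ [] ∷ v ∷ [] ∷ [] ∷ [] ∷ [])
    copied v r h P = sequence (rename (0F ∷ 1F ∷ []) (loopP W copy)) (rename (1F ∷ 2F ∷ []) (loopP W copy) ⨾ P)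
      (frame (0F ∷ 1F ∷ []) (loopP W copy) (looped W copy (iter-copy {n} w′ v r [] h))
        ((v ++ r) ∷ [] ∷ [] ∷ [] ∷ [] ∷ [] ∷ []))
      (sequence (rename (1F ∷ 2F ∷ []) (loopP W copy)) P
        (frame (1F ∷ 2F ∷ []) (loopP W copy)
          (looped W copy (trans (iter-restore {n} w′ v [] h) (cong (λ v → [] ∷ v ∷ []) (++-identityʳ v))))
          (r ∷ (v ʳ++ []) ∷ [] ∷ [] ∷ [] ∷ [] ∷ []))
        refl)

    run-binary : ∀ f x y (val : Word) → length (proj₂ x) ≡ w′ → length (proj₂ y) ≡ w′ →
      run (binary f) n ((encode y ++ encode x ++ val) ∷ [] ∷ [] ∷ [] ∷ [] ∷ [] ∷ []) ≡
      (encode (combine f x y) ++ val) ∷ [] ∷ [] ∷ [] ∷ [] ∷ [] ∷ []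
    run-binary f x@((k , s) , u) y@(κ₂ , v) val hu hv = trans
      (copied v (encode x ++ val) hv (second f κ₂))
      (trans (cong (run (pop′ 4F (merge f (k , s) κ₂)) n)
        (frame (0F ∷ 2F ∷ 3F ∷ 1F ∷ 4F ∷ []) (loopP W compare)
          (looped W compare (trans
            (cong (λ v⁺ → iter w′ (run compare n) ((u ++ val) ∷ v⁺ ∷ [] ∷ [] ∷ (true ∷ []) ∷ [])) (sym (++-identityʳ v)))
            (iter-compare {n} w′ true u v val [] [] [] hu hv)))
          ((u ++ val) ∷ [] ∷ v ∷ [] ∷ (true ∷ []) ∷ [] ∷ [])))
        (run-merge f (k , s) κ₂ (same u v) u v val hu hv))

    state : Word → Word → Word → Word → Word → Stacks 12
    state c src tab val fail = [] ∷ c ∷ src ∷ tab ∷ [] ∷ [] ∷ [] ∷ [] ∷ [] ∷ val ∷ [] ∷ fail ∷ []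

    Failed : Stacks 12 → Set
    Failed σ = ∃[ b ] List.head (lookup σ 11F) ≡ just b

    run-constantly : ∀ b (val : Word) → run (constantly b) n (val ∷ []) ≡
      (encode ((false , b) , replicate w′ false) ++ val) ∷ []
    run-constantly b val = sequence (loopP W blanks) (push 0F b ⨾ push 0F false ⨾ push 0F true)
      (looped W blanks (trans (iter-blanks {n} w′ val) (cong (_∷ []) (replicate-ʳ++ w′ false val)))) refl

    run-operate : ∀ f c src tab x y (val : Word) → length (proj₂ x) ≡ w′ → length (proj₂ y) ≡ w′ →
      run (operate f) n (state c src tab (encode y ++ encode x ++ val) []) ≡
      state c src tab (encode (combine f x y) ++ val) []
    run-operate f c src tab x y val hx hy =
      frame {n = n} {τ = (encode y ++ encode x ++ val) ∷ [] ∷ [] ∷ [] ∷ [] ∷ [] ∷ []}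
        {τ′ = (encode (combine f x y) ++ val) ∷ [] ∷ [] ∷ [] ∷ [] ∷ [] ∷ []}
        (9F ∷ 7F ∷ 8F ∷ 6F ∷ 10F ∷ 11F ∷ []) (binary f) (run-binary f x y val hx hy)
        (state c src tab (encode y ++ encode x ++ val) [])

    operate-fails : ∀ f c src tab y → length (proj₂ y) ≡ w′ →
      Failed (run (operate f) n (state c src tab (encodes (y ∷ [])) []))
    operate-fails f c src tab y hy = true , cong (List.head ∘ (λ σ → lookup σ 11F))
      (frame {n = n} {τ = encodes (y ∷ []) ∷ [] ∷ [] ∷ [] ∷ [] ∷ [] ∷ []}
        {τ′ = [] ∷ [] ∷ proj₂ y ∷ [] ∷ [] ∷ (true ∷ []) ∷ []}
        (9F ∷ 7F ∷ 8F ∷ 6F ∷ 10F ∷ 11F ∷ []) (binary f)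
        (copied (proj₂ y) [] hy (second f (proj₁ y))) (state c src tab (encodes (y ∷ [])) []))

    module Table (es : List Entry) (he : length es ≡ n)
      (hs : Sized (⟦ keyLength ⟧ n) (⟦ codeLength ⟧ n) es) where

      ρ : Word → Element
      ρ x = element (found n (key n x) es)

      run-fetch : ∀ c src val x →
        run fetch n ([] ∷ c ∷ src ∷ flat es ∷ [] ∷ [] ∷ (key n x ʳ++ []) ∷ [] ∷ [] ∷ val ∷ [] ∷ [] ∷ []) ≡
        state c src (flat es) (encode (ρ x) ++ val) []
      run-fetch c src val x = sequence
        (rename (6F ∷ 5F ∷ []) (loopP keyLength copy))
        (rename (5F ∷ 6F ∷ 3F ∷ 4F ∷ 7F ∷ 10F ∷ []) search ⨾ rename (7F ∷ 8F ∷ 10F ∷ 9F ∷ []) store)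
        (frame (6F ∷ 5F ∷ []) (loopP keyLength copy)
          (looped keyLength copy (trans (iter-restore {n} (⟦ keyLength ⟧ n) (key n x) [] hk)
            (cong (λ k → [] ∷ k ∷ []) (++-identityʳ (key n x)))))
          ([] ∷ c ∷ src ∷ flat es ∷ [] ∷ [] ∷ (key n x ʳ++ []) ∷ [] ∷ [] ∷ val ∷ [] ∷ [] ∷ []))
        (sequence (rename (5F ∷ 6F ∷ 3F ∷ 4F ∷ 7F ∷ 10F ∷ []) search) (rename (7F ∷ 8F ∷ 10F ∷ 9F ∷ []) store)
          (frame (5F ∷ 6F ∷ 3F ∷ 4F ∷ 7F ∷ 10F ∷ []) search (run-search n (key n x) es hk he hs)
            ([] ∷ c ∷ src ∷ flat es ∷ [] ∷ key n x ∷ [] ∷ [] ∷ [] ∷ val ∷ [] ∷ [] ∷ []))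
          (frame (7F ∷ 8F ∷ 10F ∷ 9F ∷ []) store
            (run-store n (found n (key n x) es) val
              (length-find (key n x) (blank-code n) es (length-replicate (⟦ codeLength ⟧ n)) hs))
            ([] ∷ c ∷ src ∷ flat es ∷ [] ∷ [] ∷ [] ∷ (found n (key n x) es ʳ++ []) ∷ [] ∷ val ∷ [] ∷ [] ∷ [])))
        where
        hk : length (key n x) ≡ ⟦ keyLength ⟧ n
        hk = trans (length-key n x) (sym (keyLength-≡ n))

      ρ-width : ∀ x → length (proj₂ (ρ x)) ≡ w′
      ρ-width x = go (found n (key n x) es) (trans
        (length-find (key n x) (blank-code n) es (length-replicate (⟦ codeLength ⟧ n)) hs) (codeLength-≡ n))
        where
        go : ∀ z → length z ≡ 2 + w′ → length (proj₂ (element z)) ≡ w′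
        go (k ∷ s ∷ u) h = trans (length-normal true u) (suc-injective (suc-injective h))

      𝔸 : Algebra Element
      𝔸 = elementAlgebra (replicate w′ false)

      open Parser 𝔸 ρ using (parse; parse₁; token; Reads; parse₁-sound; parse-sound; unparse; parse-complete; parse-complete⁻¹)

      width : ∀ e → length (proj₂ (value 𝔸 ρ e)) ≡ w′
      width (var x)   = ρ-width x
      width zero      = length-replicate w′
      width one       = length-replicate w′
      width (not e)   = width e
      width (and e f) with proj₂ (meet (proj₁ (value 𝔸 ρ e)) (proj₁ (value 𝔸 ρ f)) (same (proj₂ (value 𝔸 ρ e)) (proj₂ (value 𝔸 ρ f))))
      ... | true  = width e
      ... | false = width f
      width (or e f)  with proj₂ (join (proj₁ (value 𝔸 ρ e)) (proj₁ (value 𝔸 ρ f)) (same (proj₂ (value 𝔸 ρ e)) (proj₂ (value 𝔸 ρ f))))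
      ... | true  = width e
      ... | false = width f

      -- The simulation relation between parser and stacks. A failure only fixes the flag, as the
      -- other stacks may hold remains of an interrupted operation.
      Outcome : Word → Maybe (Word × List Element) → Stacks 12 → Set
      Outcome c (just (r , vs)) σ = σ ≡ state c r (flat es) (encodes vs) []
      Outcome c nothing         σ = Failed σ

      outcome-name : ∀ c src vs → length src < n →
        Outcome c (Maybe.map (λ (x , r) → r , ρ x ∷ vs) (readName src))
          (run lookupName n (state c src (flat es) (encodes vs) []))
      outcome-name c src vs h with readName src | iter-spelling n n src [] h
      ... | just (x , r) | e = trans
        (cong (run resume n)
          (frame {n = n} {τ = src ∷ [] ∷ [] ∷ [] ∷ []} (2F ∷ 6F ∷ 10F ∷ 11F ∷ []) (loop spelling) e (state c src (flat es) (encodes vs) [])))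
        (run-fetch c r (encodes vs) x)
      ... | nothing | r , y , e = true , cong (List.head ∘ (λ σ → lookup σ 11F))
        (cong (run resume n)
          (frame {n = n} {τ = src ∷ [] ∷ [] ∷ [] ∷ []} (2F ∷ 6F ∷ 10F ∷ 11F ∷ []) (loop spelling) e (state c src (flat es) (encodes vs) [])))

      -- `Reads` says that the values on the stack come from expressions, whose words have the width
      -- `w′` that the loops rely on; `length r < n` gives the loop over a name enough rounds.
      outcome-symbol : ∀ w c a b d r vs ts → Reads w (a ∷ b ∷ d ∷ r , vs) ts → length r < n →
        Outcome c (token a b d r vs) (run (symbolP a b d) n (state c r (flat es) (encodes vs) []))
      outcome-symbol w c false false false r vs ts R h =
        frame (9F ∷ []) (constantly false) (run-constantly false (encodes vs)) (state c r (flat es) (encodes vs) [])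
      outcome-symbol w c false false true  r vs ts R h =
        frame (9F ∷ []) (constantly true) (run-constantly true (encodes vs)) (state c r (flat es) (encodes vs) [])
      outcome-symbol w c false true  false r []       ts R h = true , refl
      outcome-symbol w c false true  false r (v ∷ vs) ts R h = refl
      outcome-symbol w c false true  true  r []       ts R h = true , refl
      outcome-symbol w c false true  true  r (v ∷ []) (t ∷ []) (refl , _) h = operate-fails meet c r (flat es) v (width t)
      outcome-symbol w c false true  true  r (v ∷ u ∷ vs) (t ∷ t′ ∷ ts) (refl , _) h =
        run-operate meet c r (flat es) u v (encodes vs) (width t′) (width t)
      outcome-symbol w c true  false false r []       ts R h = true , refl
      outcome-symbol w c true  false false r (v ∷ []) (t ∷ []) (refl , _) h = operate-fails join c r (flat es) v (width t)
      outcome-symbol w c true  false false r (v ∷ u ∷ vs) (t ∷ t′ ∷ ts) (refl , _) h =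
        run-operate join c r (flat es) u v (encodes vs) (width t′) (width t)
      outcome-symbol w c true  false true  r vs ts R h = outcome-name c r vs h
      outcome-symbol w c true  true  d     r vs ts R h = true , refl

      outcome-body : ∀ w c r vs ts → length w ≡ n → Reads w (r , vs) ts →
        Outcome c (parse₁ r vs) (run body₁ n (state c r (flat es) (encodes vs) []))
      outcome-body w c []              vs ts h R = refl
      outcome-body w c (a ∷ [])        vs ts h R = true , refl
      outcome-body w c (a ∷ b ∷ [])    vs ts h R = true , refl
      outcome-body w c (a ∷ b ∷ d ∷ r) vs ts h R = outcome-symbol w c a b d r vs ts R
        (≤-trans (s≤s (≤-trans (n≤1+n _) (n≤1+n _))) (≤-trans (m≤n+m _ (length (unparse ts)))
          (≤-reflexive (trans (sym (length-++ (unparse ts))) (trans (cong length (sym (proj₂ R))) h)))))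

      failed-body : ∀ σ → Failed σ → Failed (run body₁ n σ)
      failed-body σ (b , e) rewrite e = b , cong List.head (lookup∘updateAt 11F (updateAt σ 11F (List.drop 1)))

      failed-iter : ∀ j σ → Failed σ → Failed (iter j (run body₁ n) σ)
      failed-iter zero    σ h = h
      failed-iter (suc j) σ h = failed-iter j _ (failed-body σ h)

      outcome-parse : ∀ j w c r vs ts → length w ≡ n → Reads w (r , vs) ts →
        Outcome c (parse j r vs) (iter j (run body₁ n) (state c r (flat es) (encodes vs) []))
      outcome-parse zero    w c r vs ts h R = refl
      outcome-parse (suc j) w c r vs ts h R with parse₁ r vs in eq | outcome-body w c r vs ts h R
      ... | nothing         | failed = failed-iter j _ failed
      ... | just (r′ , vs′) | e with parse₁-sound r vs eq R
      ...   | ts′ , R′ = subst (Outcome c (parse j r′ vs′)) (cong (iter j (run body₁ n)) (sym e))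
        (outcome-parse j w c r′ vs′ ts′ h R′)

      judged : ∀ c src vs → Word
      judged c src vs = lookup (run judge n (state c src (flat es) (encodes vs) [])) 1F

      run-discard : ∀ c (v : Element) r → length (proj₂ v) ≡ w′ →
        run (rename (9F ∷ []) (loopP W discard)) n (state c [] (flat es) (proj₂ v ++ r) []) ≡ state c [] (flat es) r []
      run-discard c v r h = frame {n = n} {τ = (proj₂ v ++ r) ∷ []} {τ′ = r ∷ []} (9F ∷ []) (loopP W discard)
        (looped W discard (trans (iter-discard {n} w′ (proj₂ v ++ r)) (cong (_∷ [])
          (trans (cong (λ j → List.drop j (proj₂ v ++ r)) (sym h)) (drop-exact (proj₂ v) r)))))
        (state c [] (flat es) (proj₂ v ++ r) [])

      judge-complete : ∀ c v → length (proj₂ v) ≡ w′ → List.head (judged c [] (v ∷ [])) ≡ just (test (proj₁ v))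
      judge-complete c v h rewrite run-discard c v [] h = refl

      judge-sound : ∀ c src vs ts → vs ≡ List.map (value 𝔸 ρ) ts → List.head (judged c src vs) ≡ just true →
        src ≡ [] × ∃[ v ] vs ≡ v ∷ [] × test (proj₁ v) ≡ true
      judge-sound c (_ ∷ _) vs           ts           e    ()
      judge-sound c []      []           ts           e    ()
      judge-sound c []      (v ∷ [])     (t ∷ [])     refl h = refl , v , refl ,
        just-injective (trans (sym (judge-complete c v (width t))) h)
      judge-sound c []      (v ∷ u ∷ vs) (t ∷ _ ∷ ts) refl h rewrite run-discard c v (encodes (u ∷ vs)) (width t) =
        case h of λ ()

      judge-failed : ∀ σ → Failed σ → ¬ List.head (lookup (run judge n σ) 1F) ≡ just true
      judge-failed σ (b , e) h rewrite e
        | lookup∘updateAt 1F {f = false ∷_} (updateAt σ 11F (List.drop 1)) = case h of λ ()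

      verdict-sound : ∀ w c → length w ≡ n →
        List.head (lookup (run judge n (iter n (run body₁ n) (state c w (flat es) [] []))) 1F) ≡ just true →
        ∃[ e ] w ≡ code e × test (proj₁ (value 𝔸 ρ e)) ≡ true
      verdict-sound w c h v with parse n w [] in eq | outcome-parse n w c w [] [] h (refl , refl)
      ... | nothing        | failed = ⊥-elim (judge-failed (iter n (run body₁ n) (state c w (flat es) [] [])) failed v)
      ... | just (r , vs)  | e with parse-sound n w [] {es = []} eq (refl , refl)
      ...   | ts , R with judge-sound c r vs ts (proj₁ R) (trans (cong (λ σ → List.head (lookup (run judge n σ) 1F)) (sym e)) v)
      ...     | refl , x , refl , t with parse-complete⁻¹ n w x eq
      ...       | f , w≡ , refl = f , w≡ , t

      verdict-complete : ∀ f c → length (code f) ≡ n → test (proj₁ (value 𝔸 ρ f)) ≡ true →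
        List.head (lookup (run judge n (iter n (run body₁ n) (state c (code f) (flat es) [] []))) 1F) ≡ just true
      verdict-complete f c h t with parse n (code f) [] | parse-complete f n (≤-reflexive h) | outcome-parse n (code f) c (code f) [] [] h (refl , refl)
      ... | just _ | refl | e = trans (cong (λ σ → List.head (lookup (run judge n σ) 1F)) e)
        (trans (judge-complete c (value 𝔸 ρ f) (width f)) (cong just t))

  module _ (w : Word) where

    private
      n = length w
      t = ⟦ tableLength ⟧ n

    prepared : ∀ c → run verifier n (List.reverse w ∷ c ∷ Vec.replicate 10 []) ≡
      run judge n (iter n (run body₁ n) (state n (List.drop t c) w (padded t c ʳ++ []) [] []))
    prepared c = sequence {n} (rename (0F ∷ 2F ∷ []) (loop pour)) (rename (1F ∷ 3F ∷ []) (loopP tableLength copy) ⨾ loop body₁ ⨾ judge)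
      (frame {n = n} {τ = List.reverse w ∷ [] ∷ []} (0F ∷ 2F ∷ []) (loop pour)
        (trans (run-pour n n (List.reverse w) [] (≤-reflexive (length-reverse w)))
               (cong (λ u → [] ∷ u ∷ []) (reverse-involutive w)))
        (List.reverse w ∷ c ∷ Vec.replicate 10 []))
      (sequence {n} (rename (1F ∷ 3F ∷ []) (loopP tableLength copy)) (loop body₁ ⨾ judge)
        (frame {n = n} {τ = c ∷ [] ∷ []} (1F ∷ 3F ∷ []) (loopP tableLength copy)
          (looped tableLength copy (iter-padded {n} t c []))
          ([] ∷ c ∷ w ∷ Vec.replicate 9 []))
        refl)

    verifier-sound : ∀ c → verdict verifier w c ≡ just true →
      Σ (List Entry) λ es → Σ (length es ≡ n) λ he → Σ (Sized (⟦ keyLength ⟧ n) (⟦ codeLength ⟧ n) es) λ hs →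
      ∃[ e ] w ≡ code e × test (proj₁ (value (Table.𝔸 n es he hs) (Table.ρ n es he hs) e)) ≡ true
    verifier-sound c v with parse-table n (⟦ keyLength ⟧ n) (⟦ codeLength ⟧ n) (padded t c ʳ++ [])
      (trans (length-reverse (padded t c)) (trans (length-padded t c) (tableLength-≡ n)))
    ... | es , he , hs , e = es , he , hs , Table.verdict-sound n es he hs w (List.drop t c) refl
      (subst (λ z → List.head (lookup (run judge n (iter n (run body₁ n) (state n (List.drop t c) w z [] []))) 1F) ≡ just true)
        (sym e) (trans (cong (λ σ → List.head (lookup σ 1F)) (sym (prepared c))) v))

    verifier-complete : ∀ es (he : length es ≡ n) (hs : Sized (⟦ keyLength ⟧ n) (⟦ codeLength ⟧ n) es) f → w ≡ code f →
      test (proj₁ (value (Table.𝔸 n es he hs) (Table.ρ n es he hs) f)) ≡ true →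
      length (List.reverse (flat es)) ≡ t × verdict verifier w (List.reverse (flat es)) ≡ just true
    verifier-complete es he hs f refl h = len , trans (cong (λ σ → List.head (lookup σ 1F)) (prepared cert))
      (subst (λ z → List.head (lookup (run judge n (iter n (run body₁ n) (state n (List.drop t cert) w z [] []))) 1F) ≡ just true)
        (sym table) (Table.verdict-complete n es he hs f (List.drop t cert) refl h))
      where
      cert = List.reverse (flat es)
      len : length cert ≡ t
      len = trans (length-reverse (flat es)) (trans (length-flat n es hs)
        (trans (cong (_* (⟦ keyLength ⟧ n + ⟦ codeLength ⟧ n)) he) (sym (tableLength-≡ n))))
      table : padded t cert ʳ++ [] ≡ flat es
      table = trans (cong (_ʳ++ []) (trans (cong (λ j → padded j cert) (sym len)) (padded-exact cert)))
        (reverse-involutive (flat es))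

  abstract
    Accepted : Word → Word → Set
    Accepted w c = verdict verifier w c ≡ just true

    accepted-sound : ∀ w c → Accepted w c →
      Σ (List Entry) λ es → Σ (length es ≡ length w) λ he →
      Σ (Sized (⟦ keyLength ⟧ (length w)) (⟦ codeLength ⟧ (length w)) es) λ hs →
      ∃[ e ] w ≡ code e × test (proj₁ (value (Table.𝔸 (length w) es he hs) (Table.ρ (length w) es he hs) e)) ≡ true
    accepted-sound = verifier-sound

    accepted-complete : ∀ w es (he : length es ≡ length w)
      (hs : Sized (⟦ keyLength ⟧ (length w)) (⟦ codeLength ⟧ (length w)) es) f → w ≡ code f →
      test (proj₁ (value (Table.𝔸 (length w) es he hs) (Table.ρ (length w) es he hs) f)) ≡ true →
      length (List.reverse (flat es)) ≡ ⟦ tableLength ⟧ (length w) × Accepted w (List.reverse (flat es))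
    accepted-complete = verifier-complete

    verified : ∀ {ℓ} (A : Language ℓ) → (∀ w c → Accepted w c → A w) →
      (∀ w → A w → ∃[ c ] length c ≤ ⟦ tableLength ⟧ (length w) × Accepted w c) → NP A
    verified = decide verifier tableLength

-- Completeness

bits : Element → Word
bits ((k , s) , u) = k ∷ s ∷ u

length-name : ∀ x → length x ≤ length (name x)
length-name []      = z≤n
length-name (b ∷ x) = s≤s (m≤n⇒m≤1+n (length-name x))

≤-++ : ∀ {i j} (xs ys : Word) → i ≤ length xs → j ≤ length ys → i + j ≤ length (xs ++ ys)
≤-++ xs ys h k = ≤-trans (+-mono-≤ h k) (≤-reflexive (sym (length-++ xs)))

length-variables : ∀ e → length (variables e) ≤ length (code e)
length-variables (var x)   = s≤s z≤n
length-variables zero      = z≤n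
length-variables one       = z≤n
length-variables (not e)   = ≤-trans (≤-reflexive (sym (+-identityʳ _))) (≤-++ (code e) _ (length-variables e) z≤n)
length-variables (and e f) = ≤-trans (≤-reflexive (length-++ (variables e)))
  (≤-++ (code e) _ (length-variables e) (≤-trans (≤-reflexive (sym (+-identityʳ _))) (≤-++ (code f) _ (length-variables f) z≤n)))
length-variables (or e f)  = ≤-trans (≤-reflexive (length-++ (variables e)))
  (≤-++ (code e) _ (length-variables e) (≤-trans (≤-reflexive (sym (+-identityʳ _))) (≤-++ (code f) _ (length-variables f) z≤n)))

≤-++ˡ : ∀ {i} (xs ys : Word) → i ≤ length xs → i ≤ length (xs ++ ys)
≤-++ˡ xs ys h = ≤-trans (≤-trans h (m≤m+n _ _)) (≤-reflexive (sym (length-++ xs)))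

≤-++ʳ : ∀ {i} (xs ys : Word) → i ≤ length ys → i ≤ length (xs ++ ys)
≤-++ʳ xs ys h = ≤-trans (≤-trans h (m≤n+m _ _)) (≤-reflexive (sym (length-++ xs)))

length-variable : ∀ e {x} → x ∈ variables e → length x ≤ length (code e)
length-variable (var x)   (here refl) = m≤n⇒m≤1+n (m≤n⇒m≤1+n (m≤n⇒m≤1+n (length-name x)))
length-variable (not e)   p = ≤-++ˡ (code e) _ (length-variable e p)
length-variable (and e f) p with ∈-++⁻ (variables e) p
... | inj₁ q = ≤-++ˡ (code e) _ (length-variable e q)
... | inj₂ q = ≤-++ʳ (code e) _ (≤-++ˡ (code f) _ (length-variable f q))
length-variable (or e f)  p with ∈-++⁻ (variables e) p
... | inj₁ q = ≤-++ˡ (code e) _ (length-variable e q)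
... | inj₂ q = ≤-++ʳ (code e) _ (≤-++ˡ (code f) _ (length-variable f q))

module _ (n : ℕ) (κ : Word → Element) where

  listed : Word → Entry
  listed x = key n x , bits (κ x)

  -- Either `x` is still to come or the result is already right, and an entry with the same key
  -- belongs to the same variable because keys are injective on short names.
  find-entry : ∀ x d xs → length x ≤ n → (∀ y → y ∈ xs → length y ≤ n) → x ∈ xs ⊎ d ≡ bits (κ x) →
    find (key n x) d (List.map listed xs) ≡ bits (κ x)
  find-entry x d []       hx hs (inj₂ e) = e
  find-entry x d (y ∷ xs) hx hs p with same (key n x) (key n y) in eq
  ... | true  = find-entry x (bits (κ y)) xs hx (λ z → hs z ∘ there)
    (inj₂ (cong (bits ∘ κ) (sym (key-injective n x y hx (hs y (here refl)) (same-true _ _ eq)))))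
  ... | false = find-entry x d xs hx (λ z → hs z ∘ there) (remaining p)
    where
    remaining : x ∈ y ∷ xs ⊎ d ≡ bits (κ x) → x ∈ xs ⊎ d ≡ bits (κ x)
    remaining (inj₁ (here refl)) = case trans (sym eq) (same-refl (key n x)) of λ ()
    remaining (inj₁ (there q))   = inj₁ q
    remaining (inj₂ e)           = inj₂ e

find-++ : ∀ k d es fs → find k d (es ++ fs) ≡ find k (find k d es) fs
find-++ k d []              fs = refl
find-++ k d ((k′ , c) ∷ es) fs = find-++ k (if same k k′ then c else d) es fs

module Completeness {c ℓ₁ ℓ₂} (em : ExcludedMiddle (c ⊔ ℓ₁ ⊔ ℓ₂))
  (L : Ortholattice c ℓ₁ ℓ₂) (modular : Modular L) (height : HasHeight L 2) where

  open HeightTwo em L modular height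
  open Ortholattice L using (Carrier; _≈_; 0#; 1#; module Eq; maximum) renaming (trans to ⊑-trans; reflexive to ⊑-reflexive)

  -- The kind alone settles `Φ`, whichever independent family interprets the names, so the verifier
  -- needs no access to `L`.
  Tests : ∀ {p} → (Carrier → Set p) → (Kind → Bool) → Set _
  Tests Φ test = ∀ {m} (F : Vec Carrier (suc m)) (I : Independent F) x →
    test (proj₁ x) ≡ true ⇔ Φ (Interpretation.interpret F I x)

  membership : ∀ {p} {Φ : Carrier → Set p} (test : Kind → Bool) →
    (∀ {x y} → x ≈ y → Φ x → Φ y) → Tests Φ test → NP (Satisfiable Φ)
  membership {Φ = Φ} test Φ-resp tests = verified (Satisfiable Φ) sound complete
    where
    W  = proj₁ names
    nm = proj₂ names
    open Verifier W test

    good : ∀ n es (he : length es ≡ n) (hs : Sized (⟦ keyLength ⟧ n) (⟦ codeLength ⟧ n) es) x →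
      Unary (⟦ W ⟧ n) (proj₂ (Table.ρ n es he hs x))
    good n es he hs x = go (found n (key n x) es) (trans
      (length-find (key n x) (blank-code n) es (length-replicate (⟦ codeLength ⟧ n)) hs) (codeLength-≡ n))
      where
      go : ∀ z → length z ≡ 2 + ⟦ W ⟧ n → Unary (⟦ W ⟧ n) (proj₂ (element z))
      go (k ∷ s ∷ u) h = index (⟦ W ⟧ n) u , normal-unary (⟦ W ⟧ n) u (suc-injective (suc-injective h))

    sound : ∀ w c → Accepted w c → Satisfiable Φ w
    -- No values have to be covered here: any independent family of the right width turns the codes
    -- into elements.
    sound w c v with accepted-sound w c v | nm (length w) [] z≤n
    ... | es , he , hs , e , refl , t | F , I , _ = satisfiable⇐ {Φ = Φ} e (interpret ∘ κ)
      (Φ-resp (interpret-value κ (good (length w) es he hs) (interpret ∘ κ) e (λ _ _ → Eq.refl))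
        (Equivalence.to (tests F I (value elements κ e)) t))
      where
      open Interpretation F I
      κ = Table.ρ (length w) es he hs

    complete : ∀ w → Satisfiable Φ w → ∃[ c ] length c ≤ ⟦ tableLength ⟧ (length w) × Accepted w c
    complete w sat with satisfiable⇒ {Φ = Φ} sat
    ... | e , refl , ρ , φ with nm (length (code e)) (List.map ρ (variables e))
        (≤-trans (≤-reflexive (length-map ρ (variables e))) (length-variables e))
    ... | F , I , cov with Interpretation.represent F I ρ
    ... | κ , κ-good , exact = _ , ≤-reflexive (proj₁ result) , proj₂ result
      where
      open Interpretation F I
      n = length (code e)
      xs = variables e
      l = ⟦ keyLength ⟧ n
      b = ⟦ codeLength ⟧ n

      padding : List Entry
      padding = replicate (n ∸ length xs) (replicate l false , replicate b false)

      es : List Entry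
      -- The padding keys consist of falses, and so does the key of the empty name. As the last
      -- match wins, the padding must come first.
      es = padding ++ List.map (listed n κ) xs

      he : length es ≡ n
      he = begin
        length es                                       ≡⟨ length-++ padding ⟩
        length padding + length (List.map (listed n κ) xs) ≡⟨ cong₂ _+_ (length-replicate (n ∸ length xs)) (length-map (listed n κ) xs) ⟩
        n ∸ length xs + length xs                       ≡⟨ m∸n+n≡m (length-variables e) ⟩
        n                                               ∎
        where open ≡-Reasoning

      size-entry : ∀ x → length (key n x) ≡ l × length (bits (κ x)) ≡ b
      size-entry x = trans (length-key n x) (sym (keyLength-≡ n)) ,
        trans (cong (2 +_) (trans (cong length (proj₂ (κ-good x))) (length-unary (proj₁ (κ-good x))))) (sym (codeLength-≡ n))

      hs : Sized l b es
      hs = AllP.++⁺ (AllP.replicate⁺ (n ∸ length xs) (length-replicate l , length-replicate b))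
        (AllP.map⁺ (All.universal size-entry xs))

      κ′ : Word → Element
      κ′ = Table.ρ n es he hs

      κ′≡κ : ∀ x → x ∈ xs → κ′ x ≡ κ x
      κ′≡κ x p = trans (cong element (trans (find-++ (key n x) (blank-code n) padding (List.map (listed n κ) xs))
        (find-entry n κ x _ xs (length-variable e p) (λ y → length-variable e) (inj₁ p))))
        (cong (proj₁ (κ x) ,_) (normal-fixed (⟦ W ⟧ n) (proj₂ (κ x)) (κ-good x)))

      agrees : interpret (value elements κ′ e) ≈ value latticeAlgebra ρ e
      agrees = interpret-value κ′ (good n es he hs) ρ e λ x p →
        Eq.trans (Eq.reflexive (cong interpret (κ′≡κ x p))) (exact x (cov _ (∈-map⁺ ρ p)))

      result = accepted-complete (code e) es he hs e refl
        (Equivalence.from (tests F I (value elements κ′ e)) (Φ-resp (Eq.sym agrees) φ))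

  -- `Φ` lies between equality to 1 and being nonzero. An accepted input gives value 1 on constants,
  -- while any nonzero value already forces acceptance, so the reduction works for every `Φ` in
  -- between.
  hardness : ∀ {p} {Φ : Carrier → Set p} →
    (∀ {x} → x ≈ 1# → Φ x) → (∀ {x} → Φ x → ¬ x ≈ 0#) → NPHard (Satisfiable Φ)
  hardness {Φ = Φ} top⇒ ⇒nonzero A (M , p , spec) = reduce , reduce-computable , λ w → mk⇔ (forward w) (backward w)
    where
    open Reduction M p

    forward : ∀ w → A w → Satisfiable Φ (reduce w)
    forward w a with proj₂ (spec w) a
    ... | k , k≤ , acc with accepts⇒satisfiable w k k≤ acc
    ... | β , h = subst (Satisfiable Φ) (sym (reduce-≡ w)) (satisfiable⇐ {Φ = Φ} (tableau w) (constant ∘ β)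
      (top⇒ (Eq.trans (value-constant β (tableau w)) (Eq.reflexive (cong constant h)))))

    backward : ∀ w → Satisfiable Φ (reduce w) → A w
    backward w sat with satisfiable⇒ {Φ = Φ} (subst (Satisfiable Φ) (reduce-≡ w) sat)
    ... | e , eq , ρ , φ with code-injective (tableau w) e eq
    ... | refl with safe-satisfiable (tableau w) (tableau-safe w) ρ (⇒nonzero φ)
    ... | β , h = Equivalence.from (proj₁ (spec w)) (satisfiable⇒accepts w β h)

  1≉0 : ¬ 1# ≈ 0#
  1≉0 p = a≉0 (≈0 (⊑-trans (maximum a) (⊑-reflexive p)))

  strong : Kind → Bool
  strong (k , s) = ¬ᵇ k ∧ s

  strong-tests : Tests (_≈ 1#) strong
  strong-tests F I ((false , true)  , u) = mk⇔ (λ _ → Eq.refl) (λ _ → refl)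
  strong-tests F I ((false , false) , u) = mk⇔ (λ ()) (λ p → ⊥-elim (1≉0 (Eq.trans (Eq.sym p) ∼1≈0)))
  strong-tests F I ((true , s)      , u) = mk⇔ (λ ())
    (λ p → ⊥-elim (proj₂ (sign-proper s (independent-proper I _)) p))

  weak : Kind → Bool
  weak (k , s) = k ∨ s

  weak-tests : Tests (λ x → ¬ x ≈ 0#) weak
  weak-tests F I ((false , true)  , u) = mk⇔ (λ _ → 1≉0) (λ _ → refl)
  weak-tests F I ((false , false) , u) = mk⇔ (λ ()) (λ p → ⊥-elim (p ∼1≈0))
  weak-tests F I ((true , s)      , u) = mk⇔ (λ _ → proj₁ (sign-proper s (independent-proper I _))) (λ _ → refl)

theorem2p14 : ∀ {c ℓ₁ ℓ₂} → ExcludedMiddle (c ⊔ ℓ₁ ⊔ ℓ₂) →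
    (L : Ortholattice c ℓ₁ ℓ₂) → Modular L → HasHeight L 2 →
    NPComplete (StrongSAT L) × NPComplete (WeakSAT L)
theorem2p14 em L modular height =
  (membership strong (λ p q → Eq.trans (Eq.sym p) q) strong-tests , hardness id (λ p q → 1≉0 (Eq.trans (Eq.sym p) q))) ,
  (membership weak (λ p q r → q (Eq.trans p r)) weak-tests , hardness (λ p q → 1≉0 (Eq.trans (Eq.sym p) q)) id)
  where
  open Completeness em L modular height
  open Ortholattice L using (module Eq)
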